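{- Let $\epsilon$ be a real number with $0 < \epsilon \leq \frac{1}{2}$ and let $p$ be a prime with $p \geq \max\{75^{3/\epsilon}, e^{100}\}$ (i.e. $p^{\epsilon/3} \geq 75$ and $p \geq e^{100}$). Then \[ \#\left\{ q \text{ prime} : p^{\epsilon/3} < q \leq 72\, p^{\frac{1}{2}+\epsilon},\ q \text{ is a cubic residue modulo } p \right\} \;\geq\; \frac{1}{15}\, p^{\epsilon/3}. \]
   Context: A prime $q$ is a cubic residue modulo $p$ if $q \not\equiv 0 \pmod p$ and $q \equiv y^3 \pmod p$ for some integer $y$. -}

module Defs where

open import Algebra.Definitions.RawSemiring as RawSemiring using ()
open import Data.Integer.Solver renaming (module +-*-Solver to ℤ-Solver)
open import Data.Nat.Solver renaming (module +-*-Solver to ℕ-Solver)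
open import Data.Integer.Base as ℤ using (ℤ; +_; -[1+_])
import Data.Integer.Properties as ℤ
import Data.Integer.Divisibility as ℤ
open import Data.List.Base using (length)
open import Data.List.Membership.Propositional using (_∈_)
open import Data.List.Relation.Unary.Unique.Propositional using (Unique)
open import Data.Nat.Base as ℕ using (ℕ; zero; suc; _!)
import Data.Nat.Divisibility as ℕ
import Data.Nat.Properties as ℕ
open import Data.Product.Base using (∃; ∃-syntax; _×_; _,_)
open import Data.Rational.Base
open import Data.Rational.Properties
import Data.Rational.Unnormalised.Base as ℚᵘ
import Data.Rational.Unnormalised.Properties as ℚᵘ
open import Function.Bundles using (_⇔_)
open import Relation.Binary.PropositionalEquality
  using (_≡_; refl; sym; trans; cong; subst; subst₂)
open import Relation.Nullary.Negation using (¬_)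

private
  <⇒≱ : ∀ {p q : ℚ} → p < q → ¬ q ≤ p
  <⇒≱ p<q q≤p = <-irrefl refl (<-≤-trans p<q q≤p)

-- Real numbers as one-sided Dedekind cuts of ℚ.  No locatedness is required,
-- so this is the classical notion: it is the usual real line only in the
-- presence of excluded middle.

record ℝ : Set₁ where
  field
    lower     : ℚ → Set
    inhabited : ∃[ s ] lower s
    proper    : ∃[ u ] ¬ lower u
    downward  : ∀ {s r} → s ≤ r → lower r → lower s
    rounded   : ∀ {s} → lower s → ∃[ r ] (s < r × lower r)

open ℝ public

infix 4 _≤ʳ_ _<ʳ_

_≤ʳ_ : ℝ → ℝ → Set
x ≤ʳ y = ∀ {s} → lower x s → lower y s

_<ʳ_ : ℝ → ℝ → Set
x <ʳ y = ∃[ s ] (lower y s × ¬ lower x s)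

lower<upper : ∀ x {s u} → lower x s → ¬ lower x u → s < u
lower<upper x s∈x u∉x = ≰⇒> λ u≤s → u∉x (downward x u≤s s∈x)

sup : (A : ℚ → Set) → ∃ A → ∃[ u ] (∀ {a} → A a → a ≤ u) → ℝ
sup A (a , a∈A) (u , bound) = record
  { lower     = λ s → ∃[ a ] (A a × s < a)
  ; inhabited = a - 1ℚ , a , a∈A , a-1<a
  ; proper    = u , λ (a , a∈A , u<a) → <⇒≱ u<a (bound a∈A)
  ; downward  = λ s≤r (a , a∈A , r<a) → a , a∈A , ≤-<-trans s≤r r<a
  ; rounded   = λ (a , a∈A , s<a) → let r , s<r , r<a = <-dense s<a in
                  r , s<r , a , a∈A , r<a
  }
  where
  a-1<a : a - 1ℚ < a
  a-1<a = <-respʳ-≡ (+-identityʳ a) (+-monoʳ-< a (negative⁻¹ (- 1ℚ)))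

⌜_⌝ : ℚ → ℝ
⌜ q ⌝ = sup (λ a → a ≡ q) (q , refl) (q , ≤-reflexive)

ι : ℕ → ℚ
ι n = + n / 1

infixl 6 _+ʳ_
infixl 7 _·ʳ_

_+ʳ_ : ℝ → ℝ → ℝ
x +ʳ y = sup (λ t → ∃[ a ] ∃[ b ] (lower x a × lower y b × t ≡ a + b))
  (let a , a∈x = inhabited x ; b , b∈y = inhabited y in
    a + b , a , b , a∈x , b∈y , refl)
  (let u , u∉x = proper x ; v , v∉y = proper y in
    u + v , λ { (a , b , a∈x , b∈y , refl) →
      +-mono-≤ (<⇒≤ (lower<upper x a∈x u∉x)) (<⇒≤ (lower<upper y b∈y v∉y)) })

_·ʳ_ : (c : ℚ) .{{_ : NonNegative c}} → ℝ → ℝ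
c ·ʳ x = sup (λ t → ∃[ a ] (lower x a × t ≡ c * a))
  (let a , a∈x = inhabited x in c * a , a , a∈x , refl)
  (let u , u∉x = proper x in
    c * u , λ { (a , a∈x , refl) →
      *-monoˡ-≤-nonNeg c (<⇒≤ (lower<upper x a∈x u∉x)) })

-- Powers

infixr 8 _^_ _^ᶻ_ _^ʳ_

_^_ : ℚ → ℕ → ℚ
_^_ = RawSemiring._^_ +-*-rawSemiring

_^ᶻ_ : (n : ℕ) .{{_ : ℕ.NonZero n}} → ℤ → ℚ
n ^ᶻ (+ k)    = ι (n ℕ.^ k)
n ^ᶻ -[1+ k ] = _/_ (+ 1) (n ℕ.^ suc k) {{ℕ.m^n≢0 n (suc k)}}

private
  /-≤ : ∀ a b c d .{{_ : ℕ.NonZero b}} .{{_ : ℕ.NonZero d}} →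
        a ℕ.* d ℕ.≤ c ℕ.* b → + a / b ≤ + c / d
  /-≤ a (suc b) c (suc d) ad≤cb = toℚᵘ-cancel-≤
    (ℚᵘ.≤-respˡ-≃ (ℚᵘ.≃-sym (toℚᵘ-fromℚᵘ (ℚᵘ.mkℚᵘ (+ a) b)))
      (ℚᵘ.≤-respʳ-≃ (ℚᵘ.≃-sym (toℚᵘ-fromℚᵘ (ℚᵘ.mkℚᵘ (+ c) d)))
        (ℚᵘ.*≤* (subst₂ ℤ._≤_ (ℤ.pos-* a (suc d)) (ℤ.pos-* c (suc b))
          (ℤ.+≤+ ad≤cb)))))

  ι-mono-≤ : ∀ {m n} → m ℕ.≤ n → ι m ≤ ι n
  ι-mono-≤ {m} {n} m≤n = /-≤ m 1 n 1 (ℕ.*-monoˡ-≤ 1 m≤n)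

  ι-* : ∀ m n → ι m * ι n ≡ ι (m ℕ.* n)
  ι-* m n = toℚᵘ-injective (ℚᵘ.≃-trans (toℚᵘ-homo-* (ι m) (ι n))
    (ℚᵘ.≃-trans (ℚᵘ.*-cong (toℚᵘ-fromℚᵘ m/1) (toℚᵘ-fromℚᵘ n/1))
      (ℚᵘ.≃-trans (ℚᵘ.*≡* (cong (ℤ._* + 1) (sym (ℤ.pos-* m n))))
        (ℚᵘ.≃-sym (toℚᵘ-fromℚᵘ (ℚᵘ.mkℚᵘ (+ (m ℕ.* n)) 0))))))
    where
    m/1 = ℚᵘ.mkℚᵘ (+ m) 0
    n/1 = ℚᵘ.mkℚᵘ (+ n) 0

  ι-^ : ∀ m k → ι m ^ k ≡ ι (m ℕ.^ k)
  ι-^ m zero    = refl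
  ι-^ m (suc k) = trans (cong (ι m *_) (ι-^ m k)) (ι-* m (m ℕ.^ k))

  0≤ι : ∀ n → 0ℚ ≤ ι n
  0≤ι n = ι-mono-≤ {0} {n} ℕ.z≤n

  ^-nonNeg : ∀ {s} → 0ℚ ≤ s → ∀ k → 0ℚ ≤ s ^ k
  ^-nonNeg 0≤s zero = nonNegative⁻¹ 1ℚ
  ^-nonNeg {s} 0≤s (suc k) = nonNegative⁻¹ (s * s ^ k)
    {{nonNeg*nonNeg⇒nonNeg s {{nonNegative 0≤s}}
        (s ^ k) {{nonNegative (^-nonNeg 0≤s k)}}}}

  ^-mono-≤ : ∀ {s t} → 0ℚ ≤ s → s ≤ t → ∀ k → s ^ k ≤ t ^ k
  ^-mono-≤ 0≤s s≤t zero = ≤-refl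
  ^-mono-≤ {s} {t} 0≤s s≤t (suc k) = ≤-trans
    (*-monoˡ-≤-nonNeg s {{nonNegative 0≤s}} (^-mono-≤ 0≤s s≤t k))
    (*-monoʳ-≤-nonNeg (t ^ k)
      {{nonNegative (^-nonNeg (≤-trans 0≤s s≤t) k)}} s≤t)

  ^-mono-< : ∀ {s t} → 0ℚ ≤ s → s < t → ∀ k → s ^ suc k < t ^ suc k
  ^-mono-< {s} {t} 0≤s s<t k = ≤-<-trans
    (*-monoˡ-≤-nonNeg s {{nonNegative 0≤s}} (^-mono-≤ 0≤s (<⇒≤ s<t) k))
    (*-monoˡ-<-pos (t ^ k) {{^-pos k}} s<t)
    where
    t-pos : Positive t
    t-pos = positive (≤-<-trans 0≤s s<t)
    ^-pos : ∀ k → Positive (t ^ k)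
    ^-pos zero    = _
    ^-pos (suc k) = pos*pos⇒pos t {{t-pos}} (t ^ k) {{^-pos k}}

  ^ᶻ-≤ : ∀ n .{{_ : ℕ.NonZero n}} a k → a ℤ.≤ + k → n ^ᶻ a ≤ ι (n ℕ.^ k)
  ^ᶻ-≤ n (+ m) k (ℤ.+≤+ m≤k) = ι-mono-≤ (ℕ.^-monoʳ-≤ n m≤k)
  ^ᶻ-≤ n -[1+ m ] k _ = /-≤ 1 (n ℕ.^ suc m) (n ℕ.^ k) 1
    {{ℕ.m^n≢0 n (suc m)}}
    (ℕ.*-mono-≤ (ℕ.m^n>0 n k) (ℕ.m^n>0 n (suc m)))

  ↥≤ : ∀ r u → r < u → ↥ r ℤ.≤ + (ℤ.∣ ↥ u ∣ ℕ.* ↧ₙ r)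
  ↥≤ (mkℚ -[1+ _ ] _ _) u r<u = ℤ.-≤+
  ↥≤ (mkℚ (+ m) d _) (mkℚ (+ j) e _) (*<* m*e<j*d) =
    ℤ.+≤+ (ℕ.≤-trans (ℕ.m≤m*n m (suc e)) (ℤ.drop‿+≤+
      (subst₂ ℤ._≤_ (sym (ℤ.pos-* m (suc e))) (sym (ℤ.pos-* j (suc d)))
        (ℤ.<⇒≤ m*e<j*d))))
  ↥≤ (mkℚ (+ m) d _) (mkℚ -[1+ j ] e _) (*<* m*e<j*d) with
    subst (ℤ._< -[1+ j ] ℤ.* + suc d) (sym (ℤ.pos-* m (suc e))) m*e<j*d
  ... | ()

-- 0 ≤ t ≤ n^r for r = a/b, stated without roots as t^b ≤ n^a.

0≤_≤_^^_ : ℚ → (n : ℕ) .{{_ : ℕ.NonZero n}} → ℚ → Set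
0≤ t ≤ n ^^ r = 0ℚ ≤ t × t ^ ↧ₙ r ≤ n ^ᶻ ↥ r

private
  ^^-bound : ∀ {n} .{{_ : ℕ.NonZero n}} {r u t} → r < u →
             0≤ t ≤ n ^^ r → t ≤ ι (n ℕ.^ ℤ.∣ ↥ u ∣)
  ^^-bound {n} {r} {u} {t} r<u (_ , t^b≤n^a) = ≮⇒≥ λ n^k<t →
    <⇒≱ (^-mono-< (0≤ι (n ℕ.^ k)) n^k<t (ℚ.denominator-1 r))
      (≤-trans t^b≤n^a (≤-trans (^ᶻ-≤ n (↥ r) (k ℕ.* ↧ₙ r) (↥≤ r u r<u))
        (≤-reflexive (sym (trans (ι-^ (n ℕ.^ k) (↧ₙ r))
          (cong ι (ℕ.^-*-assoc n k (↧ₙ r))))))))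
    where k = ℤ.∣ ↥ u ∣

  0-^^ : ∀ n .{{_ : ℕ.NonZero n}} r → 0≤ 0ℚ ≤ n ^^ r
  0-^^ n r = ≤-refl , ≤-trans
    (≤-reflexive (*-zeroˡ (0ℚ ^ ℚ.denominator-1 r))) (0≤^ᶻ (↥ r))
    where
    0≤^ᶻ : ∀ a → 0ℚ ≤ n ^ᶻ a
    0≤^ᶻ (+ k)    = 0≤ι (n ℕ.^ k)
    0≤^ᶻ -[1+ k ] = /-≤ 0 1 1 (n ℕ.^ suc k) {{_}} {{ℕ.m^n≢0 n (suc k)}} ℕ.z≤n

-- n^y = sup { n^r : r ∈ ℚ, r < y }, valid since n ≥ 1.

_^ʳ_ : (n : ℕ) .{{_ : ℕ.NonZero n}} → ℝ → ℝ
n ^ʳ y = sup (λ t → ∃[ r ] (lower y r × 0≤ t ≤ n ^^ r))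
  (let r , r∈y = inhabited y in 0ℚ , r , r∈y , 0-^^ n r)
  (let u , u∉y = proper y in
    ι (n ℕ.^ ℤ.∣ ↥ u ∣) , λ (r , r∈y , t≤n^r) →
      ^^-bound {r = r} {u = u} (lower<upper y r∈y u∉y) t≤n^r)

-- The exponential at a natural number, by its power series

expTerm : ℕ → ℕ → ℚ
expTerm n k = _/_ (+ (n ℕ.^ k)) (k !) {{k ℕ.!≢0}}

expSum : ℕ → ℕ → ℚ
expSum n zero    = 0ℚ
expSum n (suc N) = expSum n N + expTerm n N

private
  0≤expTerm : ∀ n k → 0ℚ ≤ expTerm n k
  0≤expTerm n k = /-≤ 0 1 (n ℕ.^ k) (k !) {{_}} {{k ℕ.!≢0}} ℕ.z≤n

  p≤p+q : ∀ p {q} → 0ℚ ≤ q → p ≤ p + q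
  p≤p+q p 0≤q = ≤-trans (≤-reflexive (sym (+-identityʳ p))) (+-monoʳ-≤ p 0≤q)

  expSum-mono : ∀ n m N → expSum n N ≤ expSum n (m ℕ.+ N)
  expSum-mono n zero    N = ≤-refl
  expSum-mono n (suc m) N =
    ≤-trans (expSum-mono n m N) (p≤p+q _ (0≤expTerm n (m ℕ.+ N)))

  -- Once k ≥ 2n the terms at least halve, so the tail is at most twice its
  -- first term.
  2expTerm : ℕ → ℕ → ℚ
  2expTerm n k = expTerm n k + expTerm n k

  double : ∀ a b .{{_ : ℕ.NonZero b}} → + a / b + + a / b ≡ + (2 ℕ.* a) / b
  double a (suc b) = toℚᵘ-injective (ℚᵘ.≃-trans (toℚᵘ-homo-+ (fromℚᵘ q) (fromℚᵘ q))
    (ℚᵘ.≃-trans (ℚᵘ.+-cong (toℚᵘ-fromℚᵘ q) (toℚᵘ-fromℚᵘ q))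
      (ℚᵘ.≃-trans (ℚᵘ.*≡* eq) (ℚᵘ.≃-sym (toℚᵘ-fromℚᵘ (ℚᵘ.mkℚᵘ (+ (2 ℕ.* a)) b))))))
    where
    q = ℚᵘ.mkℚᵘ (+ a) b
    d = + suc b
    eq : (+ a ℤ.* d ℤ.+ + a ℤ.* d) ℤ.* d ≡ + (2 ℕ.* a) ℤ.* (d ℤ.* d)
    eq = trans (solve 2 (λ x y → (x :* y :+ x :* y) :* y :=
                                 (con (+ 2) :* x) :* (y :* y)) refl (+ a) d)
               (cong (ℤ._* (d ℤ.* d)) (sym (ℤ.pos-* 2 a)))
      where open ℤ-Solver

  halving : ∀ n j → 2expTerm n (suc (j ℕ.+ 2 ℕ.* n)) ≤ expTerm n (j ℕ.+ 2 ℕ.* n)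
  halving n j = ≤-trans
    (≤-reflexive (double (n ℕ.^ suc k) (suc k !) {{suc k ℕ.!≢0}}))
    (/-≤ (2 ℕ.* n ℕ.^ suc k) (suc k !) (n ℕ.^ k) (k !)
      {{suc k ℕ.!≢0}} {{k ℕ.!≢0}}
      (begin
        2 ℕ.* (n ℕ.* n ℕ.^ k) ℕ.* k !
          ≡⟨ solve 3 (λ x y z → con 2 :* (x :* y) :* z := y :* (con 2 :* x :* z))
               refl n (n ℕ.^ k) (k !) ⟩
        n ℕ.^ k ℕ.* (2 ℕ.* n ℕ.* k !)
          ≤⟨ ℕ.*-monoʳ-≤ (n ℕ.^ k) (ℕ.*-monoˡ-≤ (k !)
               (ℕ.m≤n⇒m≤1+n (ℕ.m≤n+m (2 ℕ.* n) j))) ⟩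
        n ℕ.^ k ℕ.* (suc k ℕ.* k !) ∎))
    where
    k = j ℕ.+ 2 ℕ.* n
    open ℕ.≤-Reasoning
    open ℕ-Solver

  expBound : ℕ → ℚ
  expBound n = expSum n (2 ℕ.* n) + 2expTerm n (2 ℕ.* n)

  expSum-tail : ∀ n j →
    expSum n (j ℕ.+ 2 ℕ.* n) + 2expTerm n (j ℕ.+ 2 ℕ.* n) ≤ expBound n
  expSum-tail n zero    = ≤-refl
  expSum-tail n (suc j) = ≤-trans
    (≤-trans (+-monoʳ-≤ (S + t) (halving n j)) (≤-reflexive (+-assoc S t t)))
    (expSum-tail n j)
    where
    S = expSum n (j ℕ.+ 2 ℕ.* n)
    t = expTerm n (j ℕ.+ 2 ℕ.* n)

  expSum-bound : ∀ n N → expSum n N ≤ expBound n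
  expSum-bound n N = ≤-trans
    (subst (λ M → expSum n N ≤ expSum n M) (ℕ.+-comm (2 ℕ.* n) N)
      (expSum-mono n (2 ℕ.* n) N))
    (≤-trans (p≤p+q _ (≤-trans (0≤expTerm n k) (p≤p+q _ (0≤expTerm n k))))
      (expSum-tail n N))
    where k = N ℕ.+ 2 ℕ.* n

exp : ℕ → ℝ
exp n = sup (λ t → ∃[ N ] t ≡ expSum n N)
  (0ℚ , 0 , refl)
  (expBound n , λ { (N , refl) → expSum-bound n N })

CubicResidue : (p q : ℕ) → Set
CubicResidue p q =
  ¬ (p ℕ.∣ q) × ∃[ y ] (+ p ℤ.∣ (+ q ℤ.- y ℤ.^ 3))

-- { n | P n } is finite with exactly k elements.
HasCardinality : (ℕ → Set) → ℕ → Set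
HasCardinality P k =
  ∃[ ns ] (Unique ns × (∀ n → n ∈ ns ⇔ P n) × length ns ≡ k)

{-
Suppose p = 3f + 1, with cubic Gaussian periods η₀, η₁, η₂.  Let t₀, t₁, t₂ satisfy
the multiplication table of the periods modulo a prime q ≠ p.  The function equal
to f at 0 and to tₖ on the k-th cubic class modulo p is then a common eigenfunction
of the periods, acting as sums of shifts, with eigenvalues tᵢ; so ηᵢ^q ≡ ηᵢ₊ₛ, where
s is the class of q, gives tᵢ ≡ tᵢ₊ₛ.  If s ≠ 0 all tᵢ agree, which forces q ∣ p.
Such tᵢ exist whenever q divides a primitive value of the index form
F(u, v) = M u³ + B u²v - (3M + B) uv² + M v³, where B² + 3BM + 9M² = p.  Thus all
prime divisors q ≠ p of primitive values of F are cubic residues.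

Let X = p^(ε/3) and m = ⌊X⌋.  Along a line in direction (1, 0) or (-1, 1),
whichever gives the larger leading coefficient W ≥ √p / 3, F takes 3m values g(n)
with W n³ ≤ |g(n)| < 72 √p m³.  As F has discriminant p², a prime q contributes to
the product of the g(n) at most the cube of its contribution to (3m)!, up to a
factor (max |g|)³.  Hence the number T of primes dividing the product satisfies
W^(3m) ≤ (max |g|)^(3T), where max |g| ≤ 900 W².  At most m/3 + O(1) of these primes
are ≤ m, since nearly all primes are ±1 modulo 6; the others suffice.

If p ≡ 2 (mod 3), every q ≠ p is a cubic residue, and the same count is applied
to the values of a linear polynomial.
-}
module Submission where

-- Neither ζ nor a ring of cyclotomic integers is constructed. The shift of integer-valued
-- functions, taken modulo q, plays the role of ζ, and a period is the sum of the shifts over one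
-- cubic class. Composition of additive operators does not commute, so Frobenius is proved in any
-- semiring for commuting elements, and serves for integers and operators alike.
--
-- The tᵢ come from the Delone-Faddeev correspondence: a root θ of F(u, 1) modulo q gives the ring
-- with basis 1, Mθ, Mθ² + Bθ, and integer translations turn this basis into the periods.
--
-- Real powers are compared through integers only: squares remove √p, and sixth powers fit X⁶ =
-- p^(2ε) ≤ p. The identity 27F² + G² = 4pQ³ with Q = u² - uv + v² gives F² ≤ 5000 p m⁶, and √5000 <
-- 72. As p ≥ e^100, W is so large that (900 W²)⁵ ≤ W^11; hence T ≥ 5m/11, and removing m/3 small
-- primes leaves 4m/33, above m/15 with room for the additive constants.
--
-- Excluded middle provides the floor m, points outside a cut, and a decision of membership in the
-- counted set.

-- The Frobenius identity for commuting elements in characteristic q.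

module Frobenius where

  open import Algebra.Bundles using (Semiring)
  open import Data.Nat.Base as ℕ using (ℕ; zero; suc; _!; _<_; _∸_; s≤s; z≤n)
  import Data.Nat.Properties as ℕ
  open import Data.Nat.Combinatorics using (_C_; nCk≡n!/k![n-k]!; nCn≡1; k![n∸k]!∣n!)
  open import Data.Nat.Divisibility using (_∣_; divides; ∣⇒≤; m∣m*n; >⇒∤)
  open import Data.Nat.DivMod using (m/n*n≡m)
  open import Data.Nat.Primality using (Prime; euclidsLemma; prime⇒nonTrivial; ¬prime[0])
  open import Data.Fin.Base using (Fin; zero; suc; fromℕ; inject₁)
  open import Data.Fin.Properties using (toℕ-fromℕ; toℕ-inject₁; toℕ<n)
  open import Data.Sum.Base using (inj₁; inj₂)
  open import Relation.Binary.PropositionalEquality as ≡ using (_≡_; cong; subst)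
  open import Relation.Nullary.Negation using (¬_; contradiction)

  prime∤! : ∀ {q} → Prime q → ∀ {k} → k < q → ¬ q ∣ k !
  prime∤! {q} pr {zero} k<q q∣1 =
    ℕ.<⇒≱ (ℕ.nonTrivial⇒n>1 q {{prime⇒nonTrivial pr}}) (∣⇒≤ q∣1)
  prime∤! {q} pr {suc k} k<q q∣k! with euclidsLemma (suc k) (k !) pr q∣k!
  ... | inj₁ q∣1+k = >⇒∤ k<q q∣1+k
  ... | inj₂ q∣k!′ = prime∤! pr (ℕ.<-trans (ℕ.n<1+n k) k<q) q∣k!′

  -- The prime q divides q! = C(q,k) k! (q - k)! but neither of the two factorials.
  prime∣C : ∀ {q} → Prime q → ∀ {k} → 0 < k → k < q → q ∣ q C k
  prime∣C {q@(suc q-1)} pr {k} 0<k k<q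
    with euclidsLemma (q C k) (k ! ℕ.* (q ∸ k) !) pr q∣product
    where
    instance _ = k ℕ.!* q ∸ k !≢0
    q∣product : q ∣ (q C k) ℕ.* (k ! ℕ.* (q ∸ k) !)
    q∣product = subst (q ∣_)
      (≡.sym (≡.trans (cong (ℕ._* (k ! ℕ.* (q ∸ k) !)) (nCk≡n!/k![n-k]! (ℕ.<⇒≤ k<q)))
        (m/n*n≡m (k![n∸k]!∣n! (ℕ.<⇒≤ k<q)))))
      (m∣m*n (q-1 !))
  ... | inj₁ q∣C = q∣C
  ... | inj₂ q∣k![q-k]! with euclidsLemma (k !) ((q ∸ k) !) pr q∣k![q-k]!
  ...   | inj₁ q∣k!     = contradiction q∣k! (prime∤! pr k<q)
  ...   | inj₂ q∣[q-k]! = contradiction q∣[q-k]!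
    (prime∤! pr (ℕ.∸-monoʳ-< 0<k (ℕ.<⇒≤ k<q)))

  module _ {a ℓ} (S : Semiring a ℓ) where

    open Semiring S hiding (zero)
    open import Algebra.Properties.Semiring.Mult S
    open import Algebra.Properties.Semiring.Exp S
    open import Algebra.Properties.Semiring.Sum S
    open import Algebra.Properties.Semiring.Binomial S using (theorem; binomialTerm)
    open import Relation.Binary.Reasoning.Setoid setoid

    private
      sum-zero : ∀ {n} (t : Fin n → Carrier) → (∀ i → t i ≈ 0#) → sum t ≈ 0#
      sum-zero {n} t t≈0 = trans (sum-cong-≋ t≈0) (sum-replicate-zero n)

    module _ {q} (pr : Prime q) (char : ∀ x → q × x ≈ 0#) where

      -- In the binomial expansion all inner terms are multiples of q. Only `x` and `y` are asked to
      -- commute, because the operators to which this is applied form a noncommutative semiring.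
      frobenius-+ : ∀ {x y} → x * y ≈ y * x → (x + y) ^ q ≈ x ^ q + y ^ q
      frobenius-+ {x} {y} xy≈yx = expand q pr char
        where
        -- Generalised over `q` together with its hypotheses, so that matching on `q` refines them
        -- as well.
        expand : ∀ q → Prime q → (∀ x → q × x ≈ 0#) → (x + y) ^ q ≈ x ^ q + y ^ q
        expand zero pr _ = contradiction pr ¬prime[0]
        expand q@(suc q-1) pr char = begin
          (x + y) ^ q ≈⟨ theorem x y xy≈yx q ⟩
          term zero + sum rest ≈⟨ +-cong first (sum-init-last rest) ⟩
          y ^ q + (sum (λ i → rest (inject₁ i)) + rest (fromℕ q-1))
            ≈⟨ +-congˡ (+-cong (sum-zero _ middle) final) ⟩
          y ^ q + (0# + x ^ q) ≈⟨ +-congˡ (+-identityˡ _) ⟩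
          y ^ q + x ^ q ≈⟨ +-comm _ _ ⟩
          x ^ q + y ^ q ∎
          where
          term = binomialTerm x y q
          rest : Fin q → Carrier
          rest i = term (suc i)
          first : term zero ≈ y ^ q
          first = trans (×-homo-1 _) (*-identityˡ _)
          middle : ∀ i → rest (inject₁ i) ≈ 0#
          middle i = ∣-× (prime∣C pr (s≤s z≤n)
            (s≤s (subst (_< q-1) (≡.sym (toℕ-inject₁ i)) (toℕ<n i))))
            where
            ∣-× : ∀ {n x} → q ∣ n → n × x ≈ 0#
            ∣-× {x = x} (divides k ≡.refl) = begin
              (k ℕ.* q) × x ≡⟨ cong (_× x) (ℕ.*-comm k q) ⟩
              (q ℕ.* k) × x ≈⟨ ×-assocˡ x q k ⟨
              q × (k × x)   ≈⟨ char (k × x) ⟩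
              0#            ∎
          final : rest (fromℕ q-1) ≈ x ^ q
          final rewrite toℕ-fromℕ q-1 | nCn≡1 q | ℕ.n∸n≡0 q-1 =
            trans (×-homo-1 _) (*-identityʳ _)

      commutes-sum : ∀ {n x} (t : Fin n → Carrier) → (∀ i → x * t i ≈ t i * x) →
        x * sum t ≈ sum t * x
      commutes-sum {zero}      t commutes = trans (zeroʳ _) (sym (zeroˡ _))
      commutes-sum {suc n} {x} t commutes = begin
        x * (t zero + sum (λ i → t (suc i)))       ≈⟨ distribˡ _ _ _ ⟩
        x * t zero + x * sum (λ i → t (suc i))
          ≈⟨ +-cong (commutes zero) (commutes-sum (λ i → t (suc i)) (λ i → commutes (suc i))) ⟩
        t zero * x + sum (λ i → t (suc i)) * x     ≈⟨ distribʳ _ _ _ ⟨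
        (t zero + sum (λ i → t (suc i))) * x       ∎

      frobenius-sum : ∀ {n} (t : Fin n → Carrier) → (∀ i j → t i * t j ≈ t j * t i) →
        sum t ^ q ≈ sum (λ i → t i ^ q)
      frobenius-sum {zero}  t commute = 0^ q pr
        where
        0^ : ∀ q → Prime q → 0# ^ q ≈ 0#
        0^ zero    pr = contradiction pr ¬prime[0]
        0^ (suc q) _  = zeroˡ _
      frobenius-sum {suc n} t commute = trans
        (frobenius-+ (commutes-sum (λ i → t (suc i)) (λ i → commute zero (suc i))))
        (+-congˡ (frobenius-sum (λ i → t (suc i)) (λ i j → commute (suc i) (suc j))))

open import Data.List.Base using (List; []; _∷_; length; filter; map; upTo; applyUpTo)
open import Data.List.Membership.Propositional using (_∈_; find; lose)
import Data.List.Properties as List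
open import Data.List.Relation.Unary.All as All using (All; []; _∷_)
import Data.List.Relation.Unary.All.Properties as All
open import Data.List.Relation.Unary.AllPairs using (AllPairs; []; _∷_)
import Data.List.Relation.Unary.AllPairs.Properties as AllPairs
open import Data.List.Relation.Unary.Any as Any using (Any; here; there; any?)
open import Data.List.Relation.Unary.Unique.Propositional using (Unique)
import Data.List.Relation.Unary.Unique.Propositional.Properties as Unique
open import Data.Nat.Base as ℕ using (ℕ; zero; suc)
import Data.Nat.Divisibility as ℕ
open import Data.Nat.Primality using (Prime; prime?; prime⇒nonZero; prime⇒nonTrivial; prime⇒irreducible; euclidsLemma; ¬prime[0]; ¬prime[1])
import Data.Nat.Properties as ℕ
open import Data.Product.Base using (∃-syntax; _×_; _,_; proj₁; proj₂)
open import Data.Sum.Base using (_⊎_; inj₁; inj₂; [_,_]′)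
open import Level using (0ℓ)
open import Relation.Binary.PropositionalEquality using (_≡_; _≢_; refl; sym; trans; cong; cong₂; subst; subst₂; module ≡-Reasoning)
open import Relation.Nullary.Decidable using (Dec; yes; no; does; ¬?; _×-dec_; map′; from-yes)
open import Relation.Nullary.Negation using (¬_; contradiction)
open import Relation.Unary using (Decidable)

-- Congruences of integers and arithmetic modulo a prime.

module Congruence where

  open Frobenius using (frobenius-+)
  open import Algebra.Bundles using (Semiring)
  open import Data.Integer.Base hiding (suc; pred)
  open import Data.Integer.Divisibility.Signed
  open import Data.Integer.DivMod using (_%ℕ_; _/ℕ_; a≡a%ℕn+[a/ℕn]*n)
  open import Data.Integer.Properties
  open import Data.Integer.Tactic.RingSolver using (solve-∀)
  open import Data.Sum.Base using (_⊎_; [_,_]′) renaming (map to map-⊎)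
  open import Relation.Binary.Bundles using (Setoid)

  infix 4 _≡_[_] _≡?_[_]

  -- A record rather than a synonym for `m ∣ a - b`: the two sides can then be inferred from the
  -- type, which subtraction would not allow.
  record _≡_[_] (a b m : ℤ) : Set where
    constructor ∣⇒≡
    field ≡⇒∣ : m ∣ a - b

  open _≡_[_] public

  _≡?_[_] : ∀ a b m → Dec (a ≡ b [ m ])
  a ≡? b [ m ] = map′ ∣⇒≡ ≡⇒∣ (m ∣? (a - b))

  module _ {m : ℤ} where

    ∣-resp : ∀ {a b} → a ≡ b → m ∣ a → m ∣ b
    ∣-resp = subst (m ∣_)

    mod-reflexive : ∀ {a b} → a ≡ b → a ≡ b [ m ]
    mod-reflexive {a} refl = ∣⇒≡ (divides 0ℤ (+-inverseʳ a))

    mod-refl : ∀ {a} → a ≡ a [ m ]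
    mod-refl = mod-reflexive refl

    mod-sym : ∀ {a b} → a ≡ b [ m ] → b ≡ a [ m ]
    mod-sym {a} {b} (∣⇒≡ d) = ∣⇒≡ (∣-resp (lemma a b) (∣m⇒∣-m d))
      where
      lemma : ∀ a b → - (a - b) ≡ b - a
      lemma = solve-∀

    mod-trans : ∀ {a b c} → a ≡ b [ m ] → b ≡ c [ m ] → a ≡ c [ m ]
    mod-trans {a} {b} {c} (∣⇒≡ d) (∣⇒≡ e) =
      ∣⇒≡ (∣-resp (lemma a b c) (∣m∣n⇒∣m+n d e))
      where
      lemma : ∀ a b c → (a - b) + (b - c) ≡ a - c
      lemma = solve-∀

    mod-+ : ∀ {a b c d} → a ≡ b [ m ] → c ≡ d [ m ] → a + c ≡ b + d [ m ]
    mod-+ {a} {b} {c} {d} (∣⇒≡ x) (∣⇒≡ y) =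
      ∣⇒≡ (∣-resp (lemma a b c d) (∣m∣n⇒∣m+n x y))
      where
      lemma : ∀ a b c d → (a - b) + (c - d) ≡ (a + c) - (b + d)
      lemma = solve-∀

    mod-* : ∀ {a b c d} → a ≡ b [ m ] → c ≡ d [ m ] → a * c ≡ b * d [ m ]
    mod-* {a} {b} {c} {d} (∣⇒≡ x) (∣⇒≡ y) =
      ∣⇒≡ (∣-resp (lemma a b c d) (∣m∣n⇒∣m+n (∣m⇒∣m*n c x) (∣n⇒∣m*n b y)))
      where
      lemma : ∀ a b c d → (a - b) * c + b * (c - d) ≡ a * c - b * d
      lemma = solve-∀

    mod-neg : ∀ {a b} → a ≡ b [ m ] → - a ≡ - b [ m ]
    mod-neg {a} {b} (∣⇒≡ x) = ∣⇒≡ (∣-resp (lemma a b) (∣m⇒∣-m x))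
      where
      lemma : ∀ a b → - (a - b) ≡ - a - - b
      lemma = solve-∀

    mod-minus : ∀ {a b c d} → a ≡ b [ m ] → c ≡ d [ m ] → a - c ≡ b - d [ m ]
    mod-minus x y = mod-+ x (mod-neg y)

    mod-^ : ∀ {a b} k → a ≡ b [ m ] → a ^ k ≡ b ^ k [ m ]
    mod-^ zero    x = mod-refl
    mod-^ (suc k) x = mod-* x (mod-^ k x)

    ∣⇒≡0 : ∀ {a} → m ∣ a → a ≡ 0ℤ [ m ]
    ∣⇒≡0 {a} d = ∣⇒≡ (∣-resp (sym (+-identityʳ a)) d)

    ≡0⇒∣ : ∀ {a} → a ≡ 0ℤ [ m ] → m ∣ a
    ≡0⇒∣ {a} (∣⇒≡ d) = ∣-resp (+-identityʳ a) d

    mod-∣ : ∀ {a b} → a ≡ b [ m ] → m ∣ a → m ∣ b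
    mod-∣ x d = ≡0⇒∣ (mod-trans (mod-sym x) (∣⇒≡0 d))

  mod-setoid : ℤ → Setoid 0ℓ 0ℓ
  mod-setoid m = record
    { Carrier = ℤ
    ; _≈_ = _≡_[ m ]
    ; isEquivalence = record { refl = mod-refl ; sym = mod-sym ; trans = mod-trans }
    }

  mod-semiring : ℤ → Semiring 0ℓ 0ℓ
  mod-semiring m = record
    { Carrier = ℤ
    ; _≈_ = _≡_[ m ]
    ; _+_ = _+_
    ; _*_ = _*_
    ; 0# = 0ℤ
    ; 1# = 1ℤ
    ; isSemiring = record
      { isSemiringWithoutAnnihilatingZero = record
        { +-isCommutativeMonoid = record
          { isMonoid = record
            { isSemigroup = record
              { isMagma = record
                { isEquivalence = Setoid.isEquivalence (mod-setoid m)
                ; ∙-cong = mod-+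
                }
              ; assoc = λ a b c → mod-reflexive (+-assoc a b c)
              }
            ; identity = (λ a → mod-reflexive (+-identityˡ a)) , λ a → mod-reflexive (+-identityʳ a)
            }
          ; comm = λ a b → mod-reflexive (+-comm a b)
          }
        ; *-cong = mod-*
        ; *-assoc = λ a b c → mod-reflexive (*-assoc a b c)
        ; *-identity = (λ a → mod-reflexive (*-identityˡ a)) , λ a → mod-reflexive (*-identityʳ a)
        ; distrib = (λ a b c → mod-reflexive (*-distribˡ-+ a b c)) , λ a b c → mod-reflexive (*-distribʳ-+ a b c)
        }
      ; zero = (λ a → mod-reflexive (*-zeroˡ a)) , λ a → mod-reflexive (*-zeroʳ a)
      }
    }

  ∣⇒∣ℕ : ∀ {q n} → + q ∣ + n → q ℕ.∣ n
  ∣⇒∣ℕ = ∣⇒∣ᵤ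

  %ℕ-mod : ∀ a n .{{_ : ℕ.NonZero n}} → a ≡ + (a %ℕ n) [ + n ]
  %ℕ-mod a n = ∣⇒≡ (divides (a /ℕ n)
    (trans (cong (_- r) (a≡a%ℕn+[a/ℕn]*n a n)) (lemma r (a /ℕ n * + n))))
    where
    r = + (a %ℕ n)
    lemma : ∀ r s → (r + s) - r ≡ s
    lemma = solve-∀

  small-unique : ∀ {m i j} → i ℕ.< m → j ℕ.< m → + i ≡ + j [ + m ] → i ≡ j
  small-unique {m} {i} {j} i<m j<m (∣⇒≡ d) = ∣-∣≡0⇒≡ (∣⇒∣ᵤ d)
    where
    bound : ∣ + i - + j ∣ ℕ.< m
    bound = subst (λ z → ∣ z ∣ ℕ.< m) (sym ([+m]-[+n]≡m⊖n i j))
      (ℕ.≤-<-trans (∣m⊝n∣≤m⊔n i j) (ℕ.⊔-lub i<m j<m))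
    ∣-∣≡0⇒≡ : m ℕ.∣ ∣ + i - + j ∣ → i ≡ j
    ∣-∣≡0⇒≡ m∣ with ∣ + i - + j ∣ in eq
    ... | zero  = +-injective (i-j≡0⇒i≡j (+ i) (+ j) (∣i∣≡0⇒i≡0 eq))
    ... | suc k = contradiction m∣ (ℕ.>⇒∤ (subst (ℕ._< m) eq bound))

  module PrimeModulus {q : ℕ} (q-prime : Prime q) where

    private instance q≢0 = prime⇒nonZero q-prime

    euclid : ∀ a b → + q ∣ a * b → (+ q ∣ a) ⊎ (+ q ∣ b)
    euclid a b d = map-⊎ ∣ᵤ⇒∣ ∣ᵤ⇒∣
      (euclidsLemma ∣ a ∣ ∣ b ∣ q-prime (subst (q ℕ.∣_) (abs-* a b) (∣⇒∣ᵤ d)))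

    ∤1 : ¬ + q ∣ 1ℤ
    ∤1 d with refl ← ℕ.∣1⇒≡1 (∣⇒∣ℕ d) = ¬prime[1] q-prime

    cancel : ∀ {a b} c → ¬ + q ∣ c → c * a ≡ c * b [ + q ] → a ≡ b [ + q ]
    cancel {a} {b} c q∤c (∣⇒≡ d) =
      [ (λ q∣c → contradiction q∣c q∤c) , ∣⇒≡ {a} {b} ]′ (euclid c (a - b) (∣-resp (lemma c a b) d))
      where
      lemma : ∀ c a b → c * a - c * b ≡ c * (a - b)
      lemma = solve-∀

    ∤-* : ∀ {a b} → ¬ + q ∣ a → ¬ + q ∣ b → ¬ + q ∣ a * b
    ∤-* {a} {b} q∤a q∤b d = [ q∤a , q∤b ]′ (euclid a b d)

    private
      open import Algebra.Properties.Semiring.Exp (mod-semiring (+ q)) using () renaming (_^_ to _^ˢ_)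
      open import Algebra.Properties.Semiring.Mult (mod-semiring (+ q)) using () renaming (_×_ to _×ˢ_)

      ×≡* : ∀ n x → n ×ˢ x ≡ + n * x
      ×≡* zero    x = refl
      ×≡* (suc n) x = trans (cong (_+_ x) (×≡* n x)) (sym (suc-* (+ n) x))

      ^≡^ : ∀ x n → x ^ˢ n ≡ x ^ n
      ^≡^ x zero    = refl
      ^≡^ x (suc n) = cong (x *_) (^≡^ x n)

    char-q : ∀ x → q ×ˢ x ≡ 0ℤ [ + q ]
    char-q x = ∣⇒≡0 (divides x (trans (×≡* q x) (*-comm (+ q) x)))

    private
      1^≡1 : ∀ n → 1ℤ ^ n ≡ 1ℤ
      1^≡1 zero    = refl
      1^≡1 (suc n) = trans (*-identityˡ (1ℤ ^ n)) (1^≡1 n)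

      -- Induction on `n` through Frobenius: (1 + n)^q ≡ 1 + n^q.
      fermat-ℕ : ∀ n → (+ n) ^ q ≡ + n [ + q ]
      fermat-ℕ zero    = 0^q q-prime
        where
        0^q : ∀ {q} → Prime q → 0ℤ ^ q ≡ 0ℤ [ + q ]
        0^q {zero}  pr = contradiction pr ¬prime[0]
        0^q {suc _} pr = mod-refl
      fermat-ℕ (suc n) = mod-trans
        (subst (_≡ 1ℤ ^ˢ q + (+ n) ^ˢ q [ + q ]) (^≡^ (+ suc n) q)
          (frobenius-+ (mod-semiring (+ q)) q-prime char-q (mod-reflexive (*-comm 1ℤ (+ n)))))
        (mod-+ (mod-reflexive (trans (^≡^ 1ℤ q) (1^≡1 q)))
          (mod-trans (mod-reflexive (^≡^ (+ n) q)) (fermat-ℕ n)))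

    fermat : ∀ a → a ^ q ≡ a [ + q ]
    fermat a = mod-trans (mod-^ q (%ℕ-mod a q))
      (mod-trans (fermat-ℕ (a %ℕ q)) (mod-sym (%ℕ-mod a q)))

    private
      q-1 = ℕ.pred q
      1+q-1 : suc q-1 ≡ q
      1+q-1 = ℕ.suc-pred q

    fermat-unit : ∀ {a} → ¬ + q ∣ a → a ^ ℕ.pred q ≡ 1ℤ [ + q ]
    fermat-unit {a} q∤a = cancel a q∤a (mod-trans
      (subst (λ n → a ^ n ≡ a [ + q ]) (sym 1+q-1) (fermat a))
      (mod-reflexive (sym (*-identityʳ a))))

    -- The inverse is a^(q - 2), by Fermat.
    inverse : ∀ {a} → ¬ + q ∣ a → ∃[ b ] a * b ≡ 1ℤ [ + q ]
    inverse {a} q∤a = from-power (ℕ.pred q) 1+q-1 (fermat-unit q∤a)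
      where
      from-power : ∀ k → suc k ≡ q → a ^ k ≡ 1ℤ [ + q ] → ∃[ b ] a * b ≡ 1ℤ [ + q ]
      from-power zero    1≡q _ = contradiction (subst Prime (sym 1≡q) q-prime) ¬prime[1]
      from-power (suc k) _   e = a ^ k , e

-- Roots of polynomials modulo a prime, and counting by fibres.

module Lagrange where

  open Congruence
  open import Data.Integer.Base hiding (suc; pred)
  open import Data.Integer.Divisibility.Signed
  open import Data.Integer.Properties
  open import Data.Integer.Tactic.RingSolver using (solve-∀)
  open import Data.List.Base using (List; []; _∷_; length; take; replicate; _++_; filter)
  open import Data.Sum.Base using ([_,_]; fromInj₂)

  eval : List ℤ → ℤ → ℤ
  eval []       x = 0ℤ
  eval (a ∷ as) x = a + x * eval as x

  -- The quotient of a ∷ as by x - r, for any a.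
  quotientBy : ℤ → List ℤ → List ℤ
  quotientBy r []           = []
  quotientBy r as@(_ ∷ as′) = eval as r ∷ quotientBy r as′

  length-quotientBy : ∀ r as → length (quotientBy r as) ≡ length as
  length-quotientBy r []       = refl
  length-quotientBy r (_ ∷ as) = cong suc (length-quotientBy r as)

  factor : ∀ r x a as →
    eval (a ∷ as) x - eval (a ∷ as) r ≡ (x - r) * eval (quotientBy r as) x
  factor r x a [] = lemma r x a
    where
    lemma : ∀ r x a → (a + x * 0ℤ) - (a + r * 0ℤ) ≡ (x - r) * 0ℤ
    lemma = solve-∀
  factor r x a (b ∷ as) = trans (lemma₁ r x a (eval (b ∷ as) r) (eval (b ∷ as) x))
    (trans (cong (λ z → (x - r) * eval (b ∷ as) r + x * z) (factor r x b as))
      (lemma₂ r x (eval (b ∷ as) r) (eval (quotientBy r as) x)))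
    where
    lemma₁ : ∀ r x a R X → (a + x * X) - (a + r * R) ≡ (x - r) * R + x * (X - R)
    lemma₁ = solve-∀
    lemma₂ : ∀ r x R Q → (x - r) * R + x * ((x - r) * Q) ≡ (x - r) * (R + x * Q)
    lemma₂ = solve-∀

  module _ {m : ℤ} where

    ∣-eval : ∀ {as} → All (m ∣_) as → ∀ x → m ∣ eval as x
    ∣-eval []           x = divides 0ℤ refl
    ∣-eval (m∣a ∷ m∣as) x = ∣m∣n⇒∣m+n m∣a (∣n⇒∣m*n x (∣-eval m∣as x))

    ∣-head : ∀ {a as} r → m ∣ eval (a ∷ as) r → All (m ∣_) as → m ∣ a
    ∣-head r m∣P m∣as = ∣m+n∣n⇒∣m m∣P (∣n⇒∣m*n r (∣-eval m∣as r))

    -- The coefficients of the quotient are the values at `r` of the successive tails of `as`, a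
    -- triangular system that is solved from the last coefficient upwards.
    ∣-quotientBy : ∀ r as → All (m ∣_) (quotientBy r as) → All (m ∣_) as
    ∣-quotientBy r []       []           = []
    ∣-quotientBy r (a ∷ as) (m∣P ∷ m∣qs) = ∣-head r m∣P m∣as ∷ m∣as
      where m∣as = ∣-quotientBy r as m∣qs

  -- Counting roots against coefficients, instead of a degree, needs no assumption on the leading
  -- coefficient. Division by x - r leaves a quotient with one coefficient fewer and the remaining
  -- roots; `∣-quotientBy` carries its vanishing back to the tail, and the root `r` settles the
  -- constant term.
  lagrange : ∀ {q} → Prime q → ∀ P rs → length rs ≡ length P →
    AllPairs (λ r s → ¬ s ≡ r [ + q ]) rs → All (λ r → + q ∣ eval P r) rs →
    All (+ q ∣_) P
  lagrange _ [] _ _ _ _ = []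
  lagrange {q} q-prime (a ∷ as) (r ∷ rs) len (r≢rs ∷ distinct) (q∣Pr ∷ q∣Prs) =
    ∣-head r q∣Pr q∣as ∷ q∣as
    where
    open PrimeModulus q-prime
    q∣Q : ∀ {s} → ¬ s ≡ r [ + q ] → + q ∣ eval (a ∷ as) s → + q ∣ eval (quotientBy r as) s
    q∣Q {s} s≢r q∣Ps = fromInj₂ (λ q∣s-r → contradiction (∣⇒≡ q∣s-r) s≢r)
      (euclid (s - r) _ (∣-resp (factor r s a as) (∣m∣n⇒∣m-n q∣Ps q∣Pr)))
    q∣as : All (+ q ∣_) as
    q∣as = ∣-quotientBy r as (lagrange q-prime (quotientBy r as) rs
      (trans (ℕ.suc-injective len) (sym (length-quotientBy r as)))
      distinct (All.zipWith (λ (s≢r , q∣Ps) → q∣Q s≢r q∣Ps) (r≢rs , q∣Prs)))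
      where open import Data.Product.Base using (_,_)

  lagrange-< : ∀ {q} → Prime q → ∀ P → ¬ All (+ q ∣_) P → ∀ rs →
    AllPairs (λ r s → ¬ s ≡ r [ + q ]) rs → All (λ r → + q ∣ eval P r) rs →
    length rs ℕ.< length P
  lagrange-< q-prime P ¬q∣P rs distinct roots = ℕ.≰⇒> λ n≤rs → ¬q∣P
    (lagrange q-prime P (take (length P) rs)
      (trans (List.length-take (length P) rs) (ℕ.m≤n⇒m⊓n≡m n≤rs))
      (AllPairs.take⁺ (length P) distinct) (All.take⁺ (length P) roots))

  X^_ : ℕ → List ℤ
  X^ n = replicate n 0ℤ ++ 1ℤ ∷ []

  eval-X^ : ∀ n x → eval (X^ n) x ≡ x ^ n
  eval-X^ zero    x = cong (λ z → 1ℤ + z) (*-zeroʳ x)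
  eval-X^ (suc n) x = trans (+-identityˡ _) (cong (x *_) (eval-X^ n x))

  length-X^ : ∀ n → length (X^ n) ≡ suc n
  length-X^ zero    = refl
  length-X^ (suc n) = cong suc (length-X^ n)

  roots-of-power : ∀ {q} → Prime q → ∀ n .{{_ : ℕ.NonZero n}} a rs →
    AllPairs (λ r s → ¬ s ≡ r [ + q ]) rs → All (λ r → r ^ n ≡ a [ + q ]) rs →
    length rs ℕ.≤ n
  roots-of-power {q} q-prime (suc n) a rs distinct roots = ℕ.≤-pred
    (ℕ.≤-trans (lagrange-< q-prime P ¬q∣P rs distinct (All.map (λ {r} → root {r}) roots))
      (ℕ.≤-reflexive (cong suc (length-X^ n))))
    where
    P = - a ∷ X^ n
    root : ∀ {r} → r ^ suc n ≡ a [ + q ] → + q ∣ eval P r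
    root {r} (∣⇒≡ d) = ∣-resp (trans (+-comm _ (- a))
      (cong (λ z → - a + r * z) (sym (eval-X^ n r)))) d
    ¬∣X^ : ∀ n → ¬ All (+ q ∣_) (X^ n)
    ¬∣X^ zero    (q∣1 ∷ _)   = PrimeModulus.∤1 q-prime q∣1
    ¬∣X^ (suc n) (_ ∷ q∣X^n) = ¬∣X^ n q∣X^n
    ¬q∣P : ¬ All (+ q ∣_) P
    ¬q∣P (_ ∷ q∣X^n) = ¬∣X^ n q∣X^n

  -- One fibre is removed for each `y`. Distinctness is an arbitrary relation `D` because it will be
  -- incongruence, not inequality of integers.
  fibre-count : ∀ {A B : Set} {D : A → A → Set} {R : A → B → Set} →
    (∀ y → Decidable (λ x → R x y)) → ∀ k →
    (∀ y zs → AllPairs D zs → All (λ x → R x y) zs → length zs ℕ.≤ k) →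
    ∀ ys xs → AllPairs D xs → All (λ x → Any (R x) ys) xs →
    length xs ℕ.≤ k ℕ.* length ys
  fibre-count R? k fibre≤k [] [] _ [] = ℕ.z≤n
  fibre-count {D = D} {R} R? k fibre≤k (y ∷ ys) xs distinct related = begin
    length xs                      ≡⟨ length-filter-split xs ⟩
    length (filter (R? y) xs) ℕ.+ length (filter (λ x → ¬? (R? y x)) xs)
      ≤⟨ ℕ.+-mono-≤
           (fibre≤k y _ (AllPairs.filter⁺ (R? y) distinct) (All.all-filter (R? y) xs))
           (fibre-count R? k fibre≤k ys _ (AllPairs.filter⁺ _ distinct) (rest xs related)) ⟩
    k ℕ.+ k ℕ.* length ys          ≡⟨ ℕ.*-suc k (length ys) ⟨
    k ℕ.* suc (length ys)          ∎
    where
    open ℕ.≤-Reasoning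
    length-filter-split : ∀ xs → length xs ≡
      length (filter (R? y) xs) ℕ.+ length (filter (λ x → ¬? (R? y x)) xs)
    length-filter-split [] = refl
    length-filter-split (x ∷ xs) with R? y x
    ... | yes _ = cong suc (length-filter-split xs)
    ... | no _  = trans (cong suc (length-filter-split xs)) (sym (ℕ.+-suc _ _))
    rest : ∀ xs → All (λ x → Any (R x) (y ∷ ys)) xs →
      All (λ x → Any (R x) ys) (filter (λ x → ¬? (R? y x)) xs)
    rest [] [] = []
    rest (x ∷ xs) (r ∷ rs) with R? y x
    ... | yes _ = rest xs rs
    ... | no ¬r = Any.tail ¬r r ∷ rest xs rs

-- Functions on ℤ/p and their sums.

module Residues where

  open Congruence
  open import Data.Fin.Base using (Fin; toℕ; fromℕ<)
  open import Data.Fin.Permutation using (Permutation; permutation)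
  open import Data.Fin.Properties using (toℕ-fromℕ<; toℕ<n; toℕ-injective)
  open import Data.Integer.Base hiding (suc; pred)
  open import Data.Integer.Divisibility.Signed
  open import Data.Integer.DivMod using (n%ℕd<d)
  open import Data.Integer.Properties
  open import Data.Integer.Tactic.RingSolver using (solve-∀)
  open import Algebra.Properties.Semiring.Sum +-*-semiring public
    using (sum; sum-cong-≗; ∑-comm; ∑-distrib-+; sum-permute; *-distribˡ-sum)

  -- Functions on ℤ/p are represented by p-periodic functions on ℤ, and summed over 0, ..., p - 1;
  -- this avoids a quotient type.
  Periodic : ℕ → (ℤ → ℤ) → Set
  Periodic p h = ∀ {x y} → x ≡ y [ + p ] → h x ≡ h y

  ∑ : ℕ → (ℤ → ℤ) → ℤ
  ∑ p h = sum {p} (λ i → h (+ toℕ i))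

  ⟦_⟧ : ∀ {A : Set} → Dec A → ℤ
  ⟦ yes _ ⟧ = 1ℤ
  ⟦ no _ ⟧  = 0ℤ

  ⟦⟧-yes : ∀ {A : Set} {d : Dec A} → A → ⟦ d ⟧ ≡ 1ℤ
  ⟦⟧-yes {d = yes _} a = refl
  ⟦⟧-yes {d = no ¬a} a = contradiction a ¬a

  ⟦⟧-no : ∀ {A : Set} {d : Dec A} → ¬ A → ⟦ d ⟧ ≡ 0ℤ
  ⟦⟧-no {d = yes a} ¬a = contradiction a ¬a
  ⟦⟧-no {d = no _}  ¬a = refl

  ⟦⟧-cong : ∀ {A B : Set} {d : Dec A} {e : Dec B} → (A → B) → (B → A) → ⟦ d ⟧ ≡ ⟦ e ⟧
  ⟦⟧-cong {d = yes a} {e} f g = sym (⟦⟧-yes {d = e} (f a))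
  ⟦⟧-cong {d = no ¬a} {e} f g = sym (⟦⟧-no {d = e} (λ b → ¬a (g b)))

  ∑-cong : ∀ p {g h : ℤ → ℤ} → (∀ x → g x ≡ h x) → ∑ p g ≡ ∑ p h
  ∑-cong p g≡h = sum-cong-≗ {p} (λ i → g≡h (+ toℕ i))

  ∑-+ : ∀ p (g h : ℤ → ℤ) → ∑ p (λ x → g x + h x) ≡ ∑ p g + ∑ p h
  ∑-+ p g h = ∑-distrib-+ {p} (λ i → g (+ toℕ i)) (λ i → h (+ toℕ i))

  ∑-swap : ∀ p (h : ℤ → ℤ → ℤ) → ∑ p (λ x → ∑ p (λ y → h x y)) ≡ ∑ p (λ y → ∑ p (λ x → h x y))
  ∑-swap p h = ∑-comm {p} {p} (λ i j → h (+ toℕ i) (+ toℕ j))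

  ∑-*ˡ : ∀ p c (h : ℤ → ℤ) → ∑ p (λ x → c * h x) ≡ c * ∑ p h
  ∑-*ˡ p c h = sym (*-distribˡ-sum {p} c (λ i → h (+ toℕ i)))

  ∑-0 : ∀ n → sum {n} (λ _ → 0ℤ) ≡ 0ℤ
  ∑-0 zero    = refl
  ∑-0 (suc n) = trans (+-identityˡ _) (∑-0 n)

  ∑-1 : ∀ n → sum {n} (λ _ → 1ℤ) ≡ + n
  ∑-1 zero    = refl
  ∑-1 (suc n) = cong (λ z → 1ℤ + z) (∑-1 n)

  δ : ℕ → ℤ → ℤ
  δ p x = ⟦ + p ∣? x ⟧

  ∑-δ : ∀ p .{{_ : ℕ.NonZero p}} (h : ℤ → ℤ) → ∑ p (λ x → h x * δ p x) ≡ h 0ℤ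
  ∑-δ (suc n) h = begin
    h 0ℤ * δ (suc n) 0ℤ + sum {n} (λ i → h (+ suc (toℕ i)) * δ (suc n) (+ suc (toℕ i)))
      ≡⟨ cong₂ _+_ (cong (h 0ℤ *_) (⟦⟧-yes {d = + suc n ∣? 0ℤ} (divides 0ℤ refl)))
           (sum-cong-≗ {n} (λ i → trans
             (cong (h (+ suc (toℕ i)) *_) (⟦⟧-no {d = + suc n ∣? + suc (toℕ i)} (small i)))
             (*-zeroʳ (h (+ suc (toℕ i)))))) ⟩
    h 0ℤ * 1ℤ + sum {n} (λ _ → 0ℤ) ≡⟨ cong₂ _+_ (*-identityʳ (h 0ℤ)) (∑-0 n) ⟩
    h 0ℤ + 0ℤ                      ≡⟨ +-identityʳ (h 0ℤ) ⟩
    h 0ℤ                           ∎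
    where
    open ≡-Reasoning
    small : (i : Fin n) → ¬ + suc n ∣ + suc (toℕ i)
    small i d with () ← small-unique (ℕ.s≤s (toℕ<n i)) (ℕ.s≤s ℕ.z≤n) (∣⇒≡0 d)

  module _ {p : ℕ} (p-prime : Prime p) where

    open PrimeModulus p-prime
    private instance _ = prime⇒nonZero p-prime

    residue : ℤ → Fin p
    residue x = fromℕ< (n%ℕd<d x p)

    residue-mod : ∀ x → + toℕ (residue x) ≡ x [ + p ]
    residue-mod x = mod-sym (subst (λ r → x ≡ + r [ + p ])
      (sym (toℕ-fromℕ< (n%ℕd<d x p))) (%ℕ-mod x p))

    residue-unique : ∀ {x} (i : Fin p) → x ≡ + toℕ i [ + p ] → residue x ≡ i
    residue-unique {x} i x≡i = toℕ-injective
      (small-unique (toℕ<n _) (toℕ<n i) (mod-trans (residue-mod x) x≡i))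

    -- The map x ↦ ux + v permutes the residues, with inverse x ↦ u⁻¹(x - v).
    ∑-affine : ∀ {h} → Periodic p h → ∀ {u} → ¬ + p ∣ u → ∀ v →
      ∑ p (λ x → h (u * x + v)) ≡ ∑ p h
    ∑-affine {h} periodic {u} p∤u v =
      trans (sum-cong-≗ {p} (λ i → periodic (mod-sym (residue-mod (to i)))))
        (sym (sum-permute (λ i → h (+ toℕ i)) π))
      where
      u⁻¹ = proj₁ (inverse p∤u)
      uu⁻¹≡1 : u * u⁻¹ ≡ 1ℤ [ + p ]
      uu⁻¹≡1 = proj₂ (inverse p∤u)
      to from : Fin p → ℤ
      to   i = u * + toℕ i + v
      from i = u⁻¹ * (+ toℕ i - v)
      to∘from : ∀ x → u * (u⁻¹ * (x - v)) + v ≡ x [ + p ]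
      to∘from x = mod-trans (mod-reflexive (lemma u u⁻¹ x v))
        (mod-trans (mod-+ (mod-* uu⁻¹≡1 (mod-refl {a = x - v})) mod-refl) (mod-reflexive (lemma′ x v)))
        where
        lemma : ∀ u w x v → u * (w * (x - v)) + v ≡ u * w * (x - v) + v
        lemma = solve-∀
        lemma′ : ∀ x v → 1ℤ * (x - v) + v ≡ x
        lemma′ = solve-∀
      from∘to : ∀ x → u⁻¹ * ((u * x + v) - v) ≡ x [ + p ]
      from∘to x = mod-trans (mod-reflexive (lemma u u⁻¹ x v))
        (mod-trans (mod-* uu⁻¹≡1 mod-refl) (mod-reflexive (*-identityˡ x)))
        where
        lemma : ∀ u w x v → w * ((u * x + v) - v) ≡ u * w * x
        lemma = solve-∀
      π : Permutation p p
      π = permutation (λ i → residue (to i)) (λ i → residue (from i))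
        (λ i → residue-unique i (mod-trans
          (mod-+ (mod-* (mod-refl {a = u}) (residue-mod (from i))) mod-refl) (to∘from (+ toℕ i))))
        (λ i → residue-unique i (mod-trans
          (mod-* (mod-refl {a = u⁻¹}) (mod-minus (residue-mod (to i)) (mod-refl {a = v}))) (from∘to (+ toℕ i))))

    ∑-shift : ∀ {h} → Periodic p h → ∀ v → ∑ p (λ x → h (x + v)) ≡ ∑ p h
    ∑-shift {h} periodic v = trans
      (∑-cong p (λ x → cong (λ z → h (z + v)) (sym (*-identityˡ x))))
      (∑-affine periodic ∤1 v)

    ∑-scale : ∀ {h} → Periodic p h → ∀ {u} → ¬ + p ∣ u → ∑ p (λ x → h (u * x)) ≡ ∑ p h
    ∑-scale {h} periodic {u} p∤u = trans
      (∑-cong p (λ x → cong h (sym (+-identityʳ (u * x)))))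
      (∑-affine periodic p∤u 0ℤ)

-- The cubic residue character modulo p = 3f + 1.

module CubicCharacter where

  open Congruence
  open Lagrange
  open import Data.Integer.Base hiding (suc; pred)
  open import Data.Integer.Divisibility.Signed
  open import Data.Integer.DivMod using (_%ℕ_; n%ℕd<d)
  open import Data.Integer.Properties
  open import Data.Integer.Tactic.RingSolver using (solve-∀)
  import Data.List.Relation.Unary.Any.Properties as Any
  open import Data.List.Membership.Propositional.Properties using (∈-filter⁺; ∈-applyUpTo⁺)

  ^-distribʳ-* : ∀ a b n → (a * b) ^ n ≡ a ^ n * b ^ n
  ^-distribʳ-* a b zero    = refl
  ^-distribʳ-* a b (suc n) =
    trans (cong (a * b *_) (^-distribʳ-* a b n)) (lemma a b (a ^ n) (b ^ n))
    where
    lemma : ∀ a b x y → a * b * (x * y) ≡ a * x * (b * y)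
    lemma = solve-∀

  data ℤ₃ : Set where
    𝟘 𝟙 𝟚 : ℤ₃

  infix 8 ⊖_
  infixl 6 _⊕_

  _⊕_ : ℤ₃ → ℤ₃ → ℤ₃
  𝟘 ⊕ j = j
  𝟙 ⊕ 𝟘 = 𝟙
  𝟙 ⊕ 𝟙 = 𝟚
  𝟙 ⊕ 𝟚 = 𝟘
  𝟚 ⊕ 𝟘 = 𝟚
  𝟚 ⊕ 𝟙 = 𝟘
  𝟚 ⊕ 𝟚 = 𝟙

  ⊖_ : ℤ₃ → ℤ₃
  ⊖ 𝟘 = 𝟘
  ⊖ 𝟙 = 𝟚
  ⊖ 𝟚 = 𝟙

  module Character (f : ℕ) (p-prime : Prime (suc (3 ℕ.* f))) where

    p = suc (3 ℕ.* f)

    open PrimeModulus p-prime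

    instance
      f≢0 : ℕ.NonZero f
      f≢0 = ℕ.≢-nonZero λ { refl → ¬prime[1] p-prime }

    units : ℕ → List ℤ
    units = applyUpTo (λ i → + suc i)

    Incongruent : ℤ → ℤ → Set
    Incongruent r s = ¬ s ≡ r [ + p ]

    units-distinct : ∀ {n} → n ℕ.≤ 3 ℕ.* f → AllPairs Incongruent (units n)
    units-distinct {n} n≤3f = AllPairs.applyUpTo⁺₁ _ n λ i<j j<n j≡i →
      ℕ.<⇒≢ i<j (ℕ.suc-injective (sym (small-unique
        (ℕ.s≤s (ℕ.<-≤-trans j<n n≤3f)) (ℕ.s≤s (ℕ.<-≤-trans (ℕ.<-trans i<j j<n) n≤3f)) j≡i)))

    unit⇒∤ : ∀ {i} → i ℕ.< 3 ℕ.* f → ¬ + p ∣ + suc i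
    unit⇒∤ i<3f d with () ← small-unique (ℕ.s≤s i<3f) (ℕ.s≤s ℕ.z≤n) (∣⇒≡0 d)

    representative : ∀ {x} → ¬ + p ∣ x → ∃[ i ] (i ℕ.< 3 ℕ.* f × x ≡ + suc i [ + p ])
    representative {x} p∤x = from-remainder (x %ℕ p) (n%ℕd<d x p) (%ℕ-mod x p)
      where
      from-remainder : ∀ r → r ℕ.< p → x ≡ + r [ + p ] →
        ∃[ i ] (i ℕ.< 3 ℕ.* f × x ≡ + suc i [ + p ])
      from-remainder zero    _   x≡0 = contradiction (≡0⇒∣ x≡0) p∤x
      from-remainder (suc i) r<p x≡r = i , ℕ.≤-pred r<p , x≡r

    private
      power? : ∀ x → Dec (x ^ f ≡ 1ℤ [ + p ])
      power? x = x ^ f ≡? 1ℤ [ + p ]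

      -- The congruence x^f ≡ 1 has at most f incongruent roots, so one of the first f + 1 units
      -- escapes it.
      ∃-nontrivial : Any (λ x → ¬ x ^ f ≡ 1ℤ [ + p ]) (units (suc f))
      ∃-nontrivial = All.¬All⇒Any¬ power? (units (suc f)) λ all → ℕ.1+n≰n
        (subst (ℕ._≤ f) (List.length-applyUpTo (λ i → + suc i) (suc f))
          (roots-of-power p-prime f 1ℤ _ (units-distinct 1+f≤3f) all))
        where
        1+f≤3f : suc f ℕ.≤ 3 ℕ.* f
        1+f≤3f = ℕ.≤-trans (ℕ.+-monoˡ-≤ f (ℕ.>-nonZero⁻¹ f))
          (ℕ.+-monoʳ-≤ f (ℕ.m≤m+n f (f ℕ.+ 0)))

      nontrivial = Any.applyUpTo⁻ (λ i → + suc i) ∃-nontrivial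

    γ : ℤ
    γ = + suc (proj₁ nontrivial)

    w : ℤ
    w = γ ^ f

    w≢1 : ¬ w ≡ 1ℤ [ + p ]
    w≢1 = proj₂ (proj₂ nontrivial)

    γ-unit : ¬ + p ∣ γ
    γ-unit = unit⇒∤ (ℕ.<-≤-trans (proj₁ (proj₂ nontrivial))
      (ℕ.≤-trans (ℕ.+-monoˡ-≤ f (ℕ.>-nonZero⁻¹ f)) (ℕ.+-monoʳ-≤ f (ℕ.m≤m+n f (f ℕ.+ 0)))))

    cube-of-power : ∀ {x} → ¬ + p ∣ x → (x ^ f) ^ 3 ≡ 1ℤ [ + p ]
    cube-of-power {x} p∤x = mod-trans
      (mod-reflexive (trans (^-*-assoc x f 3) (cong (x ^_) (ℕ.*-comm f 3))))
      (fermat-unit p∤x)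

    w²+w+1 : + p ∣ 1ℤ + w + w * w
    w²+w+1 = [ (λ d → contradiction (∣⇒≡ {w} {1ℤ} d) w≢1) , (λ d → d) ]′
      (euclid (w - 1ℤ) (1ℤ + w + w * w) (∣-resp (lemma w) (≡⇒∣ (cube-of-power γ-unit))))
      where
      lemma : ∀ w → w * (w * (w * 1ℤ)) - 1ℤ ≡ (w - 1ℤ) * (1ℤ + w + w * w)
      lemma = solve-∀

    ω : ℤ₃ → ℤ
    ω 𝟘 = 1ℤ
    ω 𝟙 = w
    ω 𝟚 = w * w

    w³≡1 : w * (w * w) ≡ 1ℤ [ + p ]
    w³≡1 = mod-trans (mod-reflexive (cong (λ z → w * (w * z)) (sym (*-identityʳ w))))
      (cube-of-power γ-unit)

    ω-⊕ : ∀ i j → ω i * ω j ≡ ω (i ⊕ j) [ + p ]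
    ω-⊕ 𝟘 j = mod-reflexive (*-identityˡ (ω j))
    ω-⊕ 𝟙 𝟘 = mod-reflexive (*-identityʳ w)
    ω-⊕ 𝟙 𝟙 = mod-refl
    ω-⊕ 𝟙 𝟚 = w³≡1
    ω-⊕ 𝟚 𝟘 = mod-reflexive (*-identityʳ (w * w))
    ω-⊕ 𝟚 𝟙 = mod-trans (mod-reflexive (*-assoc w w w)) w³≡1
    ω-⊕ 𝟚 𝟚 = mod-trans (mod-reflexive (lemma w))
      (mod-trans (mod-* (mod-refl {a = w}) w³≡1) (mod-reflexive (*-identityʳ w)))
      where
      lemma : ∀ w → w * w * (w * w) ≡ w * (w * (w * w))
      lemma = solve-∀

    private
      w²≢1 : ¬ w * w ≡ 1ℤ [ + p ]
      w²≢1 e = w≢1 (mod-trans (mod-reflexive (sym (*-identityʳ w)))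
        (mod-trans (mod-* (mod-refl {a = w}) (mod-sym e)) w³≡1))

      w∤ : ¬ + p ∣ w
      w∤ d = ∤1 (mod-∣ w³≡1 (∣m⇒∣m*n (w * w) d))

      w²≢w : ¬ w * w ≡ w [ + p ]
      w²≢w e = w≢1 (cancel w w∤ (mod-trans e (mod-reflexive (sym (*-identityʳ w)))))

    ω-injective : ∀ i j → ω i ≡ ω j [ + p ] → i ≡ j
    ω-injective 𝟘 𝟘 _ = refl
    ω-injective 𝟘 𝟙 e = contradiction (mod-sym e) w≢1
    ω-injective 𝟘 𝟚 e = contradiction (mod-sym e) w²≢1
    ω-injective 𝟙 𝟘 e = contradiction e w≢1
    ω-injective 𝟙 𝟙 _ = refl
    ω-injective 𝟙 𝟚 e = contradiction (mod-sym e) w²≢w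
    ω-injective 𝟚 𝟘 e = contradiction e w²≢1
    ω-injective 𝟚 𝟙 e = contradiction e w²≢w
    ω-injective 𝟚 𝟚 _ = refl

    infix 4 _∈C_ _∈C?_

    -- Euler's criterion taken as the definition: the class is read off x^f, a cube root of unity,
    -- so no primitive root or discrete logarithm is involved. That class `𝟘` consists of cubes is
    -- then a theorem, `∈C𝟘⇒cube`.
    record _∈C_ (x : ℤ) (k : ℤ₃) : Set where
      constructor classOf
      field power : x ^ f ≡ ω k [ + p ]

    open _∈C_ public

    _∈C?_ : ∀ x k → Dec (x ∈C k)
    x ∈C? k = map′ classOf power (x ^ f ≡? ω k [ + p ])

    ∈C-resp : ∀ {x y k} → x ≡ y [ + p ] → x ∈C k → y ∈C k
    ∈C-resp x≡y (classOf e) = classOf (mod-trans (mod-^ f (mod-sym x≡y)) e)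

    ∈C-unique : ∀ {x i j} → x ∈C i → x ∈C j → i ≡ j
    ∈C-unique {i = i} {j} (classOf d) (classOf e) = ω-injective i j (mod-trans (mod-sym d) e)

    ∈C-* : ∀ {x y i j} → x ∈C i → y ∈C j → x * y ∈C i ⊕ j
    ∈C-* {x} {y} {i} {j} (classOf d) (classOf e) =
      classOf (mod-trans (mod-reflexive (^-distribʳ-* x y f)) (mod-trans (mod-* d e) (ω-⊕ i j)))

    1∈C : 1ℤ ∈C 𝟘
    1∈C = classOf (mod-reflexive (^-zeroˡ f))

    γ∈C : γ ∈C 𝟙
    γ∈C = classOf mod-refl

    ∈C⇒∤ : ∀ {x k} → x ∈C k → ¬ + p ∣ x
    ∈C⇒∤ {x} {k} (classOf e) d = ω∤ k (mod-∣ e (∣-resp (cong (x ^_) (ℕ.suc-pred f)) (∣m⇒∣m*n (x ^ ℕ.pred f) d)))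
      where
      ω∤ : ∀ k → ¬ + p ∣ ω k
      ω∤ 𝟘 = ∤1
      ω∤ 𝟙 = w∤
      ω∤ 𝟚 = ∤-* w∤ w∤

    -- With y = x^f, modulo p the product (y - 1)(y - w)(y - w²) equals y³ - 1, because 1 + w + w² ≡
    -- 0; and y³ ≡ 1 by Fermat.
    classify : ∀ {x} → ¬ + p ∣ x → ∃[ k ] x ∈C k
    classify {x} p∤x = [ (λ d → 𝟘 , classOf (∣⇒≡ {x ^ f} {1ℤ} d)) ,
      (λ d → [ (λ e → 𝟙 , classOf (∣⇒≡ {x ^ f} {w} e)) , (λ e → 𝟚 , classOf (∣⇒≡ {x ^ f} {w * w} e)) ]′
        (euclid (x ^ f - w) (x ^ f - w * w) d)) ]′
      (euclid (x ^ f - 1ℤ) ((x ^ f - w) * (x ^ f - w * w)) (∣-resp (sym (lemma (x ^ f) w))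
        (∣m∣n⇒∣m+n (≡⇒∣ (cube-of-power p∤x))
          (∣m⇒∣m*n (w * x ^ f - x ^ f * x ^ f - (w - 1ℤ)) w²+w+1))))
      where
      lemma : ∀ y w → (y - 1ℤ) * ((y - w) * (y - w * w)) ≡
        (y * (y * (y * 1ℤ)) - 1ℤ) + (1ℤ + w + w * w) * (w * y - y * y - (w - 1ℤ))
      lemma = solve-∀

    cube∈C : ∀ {x} → ¬ + p ∣ x → x ^ 3 ∈C 𝟘
    cube∈C {x} p∤x = classOf (mod-trans (mod-reflexive
      (trans (^-*-assoc x 3 f) (trans (cong (x ^_) (ℕ.*-comm 3 f)) (sym (^-*-assoc x f 3)))))
      (cube-of-power p∤x))

    -1∈C : -1ℤ ∈C 𝟘
    -1∈C = cube∈C { -1ℤ } λ d → ∤1 (∣m⇒∣-m d)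

    -- Otherwise cubing would be a map with fibres of at most 3 elements from the
    -- 3f units to the at most f - 1 elements of class 𝟘 other than y.
    ∈C𝟘⇒cube : ∀ {y} → y ∈C 𝟘 → ∃[ x ] y ≡ x ^ 3 [ + p ]
    ∈C𝟘⇒cube {y} y∈C with any? (λ x → y ≡? x ^ 3 [ + p ]) (units (3 ℕ.* f))
    ... | yes found = let x , _ , y≡x³ = find found in x , y≡x³
    ... | no ¬cube  = contradiction targets<f (ℕ.≤⇒≯ (ℕ.*-cancelˡ-≤ 3 3f≤3targets))
      where
      target? : ∀ x → Dec (x ^ f ≡ 1ℤ [ + p ] × ¬ x ≡ y [ + p ])
      target? x = (x ^ f ≡? 1ℤ [ + p ]) ×-dec ¬? (x ≡? y [ + p ])
      targets = filter target? (units (3 ℕ.* f))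
      are-targets = All.all-filter target? (units (3 ℕ.* f))
      targets<f : suc (length targets) ℕ.≤ f
      targets<f = roots-of-power p-prime f 1ℤ (y ∷ targets)
        (All.map proj₂ are-targets ∷ AllPairs.filter⁺ target? (units-distinct ℕ.≤-refl))
        (power y∈C ∷ All.map proj₁ are-targets)
      cube-root : ∀ {i} → i ℕ.< 3 ℕ.* f → Any (λ z → (+ suc i) ^ 3 ≡ z [ + p ]) targets
      cube-root {i} i<3f = lose
        (∈-filter⁺ target? (∈-applyUpTo⁺ (λ i → + suc i) j<3f)
          ( power (∈C-resp x³≡z (cube∈C (unit⇒∤ i<3f)))
          , λ z≡y → ¬cube (lose (∈-applyUpTo⁺ (λ i → + suc i) i<3f)
              (mod-sym (mod-trans x³≡z z≡y)))))
        x³≡z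
        where
        target = representative (∈C⇒∤ (cube∈C (unit⇒∤ i<3f)))
        j = proj₁ target
        j<3f = proj₁ (proj₂ target)
        x³≡z : (+ suc i) ^ 3 ≡ + suc j [ + p ]
        x³≡z = proj₂ (proj₂ target)
      3f≤3targets : 3 ℕ.* f ℕ.≤ 3 ℕ.* length targets
      3f≤3targets = subst (ℕ._≤ 3 ℕ.* length targets) (List.length-applyUpTo _ (3 ℕ.* f))
        (fibre-count {R = λ x z → x ^ 3 ≡ z [ + p ]} (λ z x → x ^ 3 ≡? z [ + p ]) 3
          (λ z zs → roots-of-power p-prime 3 z zs)
          targets (units (3 ℕ.* f)) (units-distinct ℕ.≤-refl)
          (All.applyUpTo⁺₁ _ (3 ℕ.* f) cube-root))

-- Cyclotomic numbers of order three and their relations.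

module Cyclotomic where

  open Congruence
  open Residues
  open CubicCharacter
  open import Data.Integer.Base hiding (suc; pred)
  open import Data.Integer.Divisibility.Signed
  open import Data.Integer.Properties
  open import Algebra.Properties.AbelianGroup +-0-abelianGroup using (∙-cancelˡ)
  open import Data.Integer.Tactic.RingSolver using (solve-∀)

  ∑₃ : (ℤ₃ → ℤ) → ℤ
  ∑₃ t = t 𝟘 + t 𝟙 + t 𝟚

  ∑₃-cong : ∀ {s t : ℤ₃ → ℤ} → (∀ k → s k ≡ t k) → ∑₃ s ≡ ∑₃ t
  ∑₃-cong s≡t = cong₂ _+_ (cong₂ _+_ (s≡t 𝟘) (s≡t 𝟙)) (s≡t 𝟚)

  ⊕-⊖ : ∀ j i → j ⊕ (⊖ j ⊕ i) ≡ i
  ⊕-⊖ 𝟘 𝟘 = refl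
  ⊕-⊖ 𝟘 𝟙 = refl
  ⊕-⊖ 𝟘 𝟚 = refl
  ⊕-⊖ 𝟙 𝟘 = refl
  ⊕-⊖ 𝟙 𝟙 = refl
  ⊕-⊖ 𝟙 𝟚 = refl
  ⊕-⊖ 𝟚 𝟘 = refl
  ⊕-⊖ 𝟚 𝟙 = refl
  ⊕-⊖ 𝟚 𝟚 = refl

  ⊖-⊕ : ∀ j i → ⊖ j ⊕ (j ⊕ i) ≡ i
  ⊖-⊕ 𝟘 i = refl
  ⊖-⊕ 𝟙 i = ⊕-⊖ 𝟚 i
  ⊖-⊕ 𝟚 i = ⊕-⊖ 𝟙 i

  ⊕-𝟘 : ∀ i → i ⊕ 𝟘 ≡ i
  ⊕-𝟘 𝟘 = refl
  ⊕-𝟘 𝟙 = refl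
  ⊕-𝟘 𝟚 = refl

  module CyclotomicNumbers (f : ℕ) (p-prime : Prime (suc (3 ℕ.* f))) where

    open Character f p-prime public
    open PrimeModulus p-prime
    open ≡-Reasoning

    I : ℤ₃ → ℤ → ℤ
    I k x = ⟦ x ∈C? k ⟧

    I-periodic : ∀ k → Periodic p (I k)
    I-periodic k {x} {y} x≡y = ⟦⟧-cong {d = x ∈C? k} {y ∈C? k} (∈C-resp x≡y) (∈C-resp (mod-sym x≡y))

    I-member : ∀ {k x} → x ∈C k → I k x ≡ 1ℤ
    I-member {k} {x} = ⟦⟧-yes {d = x ∈C? k}

    I-nonmember : ∀ {k x} → ¬ x ∈C k → I k x ≡ 0ℤ
    I-nonmember {k} {x} = ⟦⟧-no {d = x ∈C? k}

    δ-no : ∀ {x k} → x ∈C k → δ p x ≡ 0ℤ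
    δ-no {x} x∈C = ⟦⟧-no {d = + p ∣? x} (∈C⇒∤ x∈C)

    δ-yes : ∀ {x} → + p ∣ x → δ p x ≡ 1ℤ
    δ-yes {x} = ⟦⟧-yes {d = + p ∣? x}

    δ-periodic : Periodic p (δ p)
    δ-periodic {x} {y} x≡y = ⟦⟧-cong {d = + p ∣? x} {+ p ∣? y} (mod-∣ x≡y) (mod-∣ (mod-sym x≡y))

    ∈C-/ : ∀ {u j i x} → u ∈C j → u * x ∈C j ⊕ i → x ∈C i
    ∈C-/ {u} {j} {i} {x} u∈C ux∈C =
      let k , x∈C = classify {x} λ d → ∈C⇒∤ ux∈C (∣n⇒∣m*n u d)
      in subst (x ∈C_) (trans (sym (⊖-⊕ j k))
           (trans (cong (⊖ j ⊕_) (∈C-unique (∈C-* u∈C x∈C) ux∈C)) (⊖-⊕ j i))) x∈C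

    I-scale : ∀ {u j} → u ∈C j → ∀ i x → I (j ⊕ i) (u * x) ≡ I i x
    I-scale {u} {j} u∈C i x =
      ⟦⟧-cong {d = u * x ∈C? j ⊕ i} {x ∈C? i} (∈C-/ u∈C) (∈C-* u∈C)

    I-neg : ∀ i x → I i (- x) ≡ I i x
    I-neg i x = trans (cong (I i) (sym (-1*i≡-i x))) (I-scale -1∈C i x)

    classFunction : ℤ → (ℤ₃ → ℤ) → ℤ → ℤ
    classFunction h₀ t x = h₀ * δ p x + ∑₃ (λ k → t k * I k x)

    ind : ℤ₃ → ℤ₃ → ℤ
    ind 𝟘 𝟘 = 1ℤ
    ind 𝟙 𝟙 = 1ℤ
    ind 𝟚 𝟚 = 1ℤ
    ind _ _ = 0ℤ

    I-ind : ∀ {x} j k → x ∈C j → I k x ≡ ind j k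
    I-ind 𝟘 𝟘 m = I-member m
    I-ind 𝟙 𝟙 m = I-member m
    I-ind 𝟚 𝟚 m = I-member m
    I-ind 𝟘 𝟙 m = I-nonmember (λ n → contradiction (∈C-unique m n) λ ())
    I-ind 𝟘 𝟚 m = I-nonmember (λ n → contradiction (∈C-unique m n) λ ())
    I-ind 𝟙 𝟘 m = I-nonmember (λ n → contradiction (∈C-unique m n) λ ())
    I-ind 𝟙 𝟚 m = I-nonmember (λ n → contradiction (∈C-unique m n) λ ())
    I-ind 𝟚 𝟘 m = I-nonmember (λ n → contradiction (∈C-unique m n) λ ())
    I-ind 𝟚 𝟙 m = I-nonmember (λ n → contradiction (∈C-unique m n) λ ())

    ∑₃-I : ∀ {j x} (t : ℤ₃ → ℤ) → x ∈C j → ∑₃ (λ k → t k * I k x) ≡ t j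
    ∑₃-I {j} {x} t x∈C = trans (∑₃-cong (λ k → cong (t k *_) (I-ind j k x∈C))) (pick j)
      where
      pick : ∀ j → ∑₃ (λ k → t k * ind j k) ≡ t j
      pick 𝟘 = lemma (t 𝟘) (t 𝟙) (t 𝟚)
        where
        lemma : ∀ x y z → x * 1ℤ + y * 0ℤ + z * 0ℤ ≡ x
        lemma = solve-∀
      pick 𝟙 = lemma (t 𝟘) (t 𝟙) (t 𝟚)
        where
        lemma : ∀ x y z → x * 0ℤ + y * 1ℤ + z * 0ℤ ≡ y
        lemma = solve-∀
      pick 𝟚 = lemma (t 𝟘) (t 𝟙) (t 𝟚)
        where
        lemma : ∀ x y z → x * 0ℤ + y * 0ℤ + z * 1ℤ ≡ z
        lemma = solve-∀

    classFunction-∈C : ∀ {j x} (h₀ : ℤ) (t : ℤ₃ → ℤ) → x ∈C j → classFunction h₀ t x ≡ t j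
    classFunction-∈C h₀ t x∈C = trans (cong₂ _+_ (trans (cong (h₀ *_) (δ-no x∈C)) (*-zeroʳ h₀)) (∑₃-I t x∈C)) (+-identityˡ _)

    classFunction-∣ : ∀ {x} (h₀ : ℤ) (t : ℤ₃ → ℤ) → + p ∣ x → classFunction h₀ t x ≡ h₀
    classFunction-∣ {x} h₀ t p∣x = trans (cong₂ _+_ (cong (h₀ *_) (δ-yes p∣x))
      (∑₃-cong (λ k → cong (t k *_) (I-nonmember {k} (λ x∈C → ∈C⇒∤ x∈C p∣x)))))
      (lemma h₀ (t 𝟘) (t 𝟙) (t 𝟚))
      where
      lemma : ∀ h x y z → h * 1ℤ + (x * 0ℤ + y * 0ℤ + z * 0ℤ) ≡ h
      lemma = solve-∀

    ≡classFunction : ∀ (h : ℤ → ℤ) (h₀ : ℤ) (t : ℤ₃ → ℤ) → (∀ {x} → + p ∣ x → h x ≡ h₀) →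
      (∀ {k x} → x ∈C k → h x ≡ t k) → ∀ x → h x ≡ classFunction h₀ t x
    ≡classFunction h h₀ t h-∣ h-∈C x = by-cases (+ p ∣? x)
      where
      by-cases : Dec (+ p ∣ x) → h x ≡ classFunction h₀ t x
      by-cases (yes p∣x) = trans (h-∣ p∣x) (sym (classFunction-∣ h₀ t p∣x))
      by-cases (no p∤x)  = let k , x∈C = classify p∤x in
        trans (h-∈C x∈C) (sym (classFunction-∈C h₀ t x∈C))

    classFunction-periodic : ∀ (h₀ : ℤ) (t : ℤ₃ → ℤ) → Periodic p (classFunction h₀ t)
    classFunction-periodic h₀ t x≡y = cong₂ _+_ (cong (h₀ *_) (δ-periodic x≡y))
      (∑₃-cong (λ k → cong (t k *_) (I-periodic k x≡y)))

    -- Since -1 is a cube, this is also the coefficient at `y` of the product of the periods `i` and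
    -- `k`. At `y` = 1 it is the cyclotomic number (i, k).
    correlation : ℤ₃ → ℤ₃ → ℤ → ℤ
    correlation i k y = ∑ p (λ x → I i x * I k (x + y))

    cyc : ℤ₃ → ℤ₃ → ℤ
    cyc i k = correlation i k 1ℤ

    private
      I*I-periodic : ∀ i k y → Periodic p (λ x → I i x * I k (x + y))
      I*I-periodic i k y e = cong₂ _*_ (I-periodic i e) (I-periodic k (mod-+ e mod-refl))

    correlation-scale : ∀ {u j} → u ∈C j → ∀ i k y →
      correlation (j ⊕ i) (j ⊕ k) (u * y) ≡ correlation i k y
    correlation-scale {u} {j} u∈C i k y = begin
      ∑ p (λ x → I (j ⊕ i) x * I (j ⊕ k) (x + u * y))
        ≡⟨ ∑-scale p-prime (I*I-periodic (j ⊕ i) (j ⊕ k) (u * y)) (∈C⇒∤ u∈C) ⟨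
      ∑ p (λ x → I (j ⊕ i) (u * x) * I (j ⊕ k) (u * x + u * y))
        ≡⟨ ∑-cong p (λ x → cong₂ _*_ (I-scale u∈C i x)
             (trans (cong (I (j ⊕ k)) (sym (*-distribˡ-+ u x y))) (I-scale u∈C k (x + y)))) ⟩
      ∑ p (λ x → I i x * I k (x + y)) ∎

    correlation-∈C : ∀ {y j} → y ∈C j → ∀ i k → correlation i k y ≡ cyc (⊖ j ⊕ i) (⊖ j ⊕ k)
    correlation-∈C {y} {j} y∈C i k = begin
      correlation i k y
        ≡⟨ cong₂ (λ i k → correlation i k y) (⊕-⊖ j i) (⊕-⊖ j k) ⟨
      correlation (j ⊕ (⊖ j ⊕ i)) (j ⊕ (⊖ j ⊕ k)) y
        ≡⟨ cong (correlation (j ⊕ (⊖ j ⊕ i)) (j ⊕ (⊖ j ⊕ k))) (*-identityʳ y) ⟨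
      correlation (j ⊕ (⊖ j ⊕ i)) (j ⊕ (⊖ j ⊕ k)) (y * 1ℤ)
        ≡⟨ correlation-scale y∈C (⊖ j ⊕ i) (⊖ j ⊕ k) 1ℤ ⟩
      cyc (⊖ j ⊕ i) (⊖ j ⊕ k) ∎

    -- By the substitution x ↦ - (x + y).
    correlation-sym : ∀ i k y → correlation i k y ≡ correlation k i y
    correlation-sym i k y = begin
      ∑ p (λ x → I i x * I k (x + y))
        ≡⟨ ∑-affine p-prime (I*I-periodic i k y) (∈C⇒∤ -1∈C) (- y) ⟨
      ∑ p (λ x → I i (-1ℤ * x + - y) * I k ((-1ℤ * x + - y) + y))
        ≡⟨ ∑-cong p (λ x → trans (cong₂ _*_
             (trans (cong (I i) (lemma₁ x y)) (I-neg i (x + y)))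
             (trans (cong (I k) (lemma₂ x y)) (I-neg k x))) (*-comm (I i (x + y)) (I k x))) ⟩
      ∑ p (λ x → I k x * I i (x + y)) ∎
      where
      lemma₁ : ∀ x y → -1ℤ * x + - y ≡ - (x + y)
      lemma₁ = solve-∀
      lemma₂ : ∀ x y → (-1ℤ * x + - y) + y ≡ - x
      lemma₂ = solve-∀

    element : ∀ k → ∃[ x ] x ∈C k
    element 𝟘 = 1ℤ , 1∈C
    element 𝟙 = γ , γ∈C
    element 𝟚 = γ * γ , ∈C-* γ∈C γ∈C

    private
      ∑-I-scale : ∀ {u k} → u ∈C k → ∑ p (I k) ≡ ∑ p (I 𝟘)
      ∑-I-scale {u} {k} u∈C = begin
        ∑ p (I k)                         ≡⟨ ∑-scale p-prime (I-periodic k) (∈C⇒∤ u∈C) ⟨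
        ∑ p (λ x → I k (u * x))           ≡⟨ cong (λ k → ∑ p (λ x → I k (u * x))) (⊕-𝟘 k) ⟨
        ∑ p (λ x → I (k ⊕ 𝟘) (u * x))     ≡⟨ ∑-cong p (I-scale u∈C 𝟘) ⟩
        ∑ p (I 𝟘)                         ∎

      ∑-I-𝟘 : ∀ k → ∑ p (I k) ≡ ∑ p (I 𝟘)
      ∑-I-𝟘 k = ∑-I-scale (proj₂ (element k))

    ∑-∑₃ : ∀ (h : ℤ₃ → ℤ → ℤ) → ∑ p (λ x → ∑₃ (λ k → h k x)) ≡ ∑₃ (λ k → ∑ p (h k))
    ∑-∑₃ h = trans (∑-+ p (λ x → h 𝟘 x + h 𝟙 x) (h 𝟚))
      (cong (_+ ∑ p (h 𝟚)) (∑-+ p (h 𝟘) (h 𝟙)))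

    -- Multiplication by an element of class `k` carries class `𝟘` to class `k`, so the three
    -- classes have equal size, and with the residue 0 they make up p = 1 + 3f.
    ∑-I : ∀ k → ∑ p (I k) ≡ + f
    ∑-I k = trans (∑-I-𝟘 k) (sym (*-cancelˡ-≡ (+ 3) (+ f) (∑ p (I 𝟘)) (∙-cancelˡ 1ℤ _ _ (begin
      1ℤ + + 3 * + f       ≡⟨ cong (λ z → 1ℤ + z) (pos-* 3 f) ⟨
      + p                  ≡⟨ ∑-1 p ⟨
      ∑ p (λ _ → 1ℤ)
        ≡⟨ ∑-cong p (≡classFunction (λ _ → 1ℤ) 1ℤ (λ _ → 1ℤ) (λ _ → refl) (λ _ → refl)) ⟩
      ∑ p (λ x → 1ℤ * δ p x + ∑₃ (λ k → 1ℤ * I k x))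
        ≡⟨ ∑-+ p (λ x → 1ℤ * δ p x) (λ x → ∑₃ (λ k → 1ℤ * I k x)) ⟩
      ∑ p (λ x → 1ℤ * δ p x) + ∑ p (λ x → ∑₃ (λ k → 1ℤ * I k x))
        ≡⟨ cong₂ _+_ (∑-δ p (λ _ → 1ℤ)) (trans (∑-∑₃ (λ k x → 1ℤ * I k x))
             (∑₃-cong (λ k → trans (∑-cong p (λ x → *-identityˡ (I k x))) (∑-I-𝟘 k)))) ⟩
      1ℤ + (∑ p (I 𝟘) + ∑ p (I 𝟘) + ∑ p (I 𝟘)) ≡⟨ cong (λ z → 1ℤ + z) (lemma (∑ p (I 𝟘))) ⟩
      1ℤ + + 3 * ∑ p (I 𝟘) ∎))))
      where
      lemma : ∀ x → x + x + x ≡ + 3 * x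
      lemma = solve-∀

    cyc-swap : ∀ i k → cyc i k ≡ cyc k i
    cyc-swap i k = correlation-sym i k 1ℤ

    private
      -- Counts pairs with x in class `i`, y in class `j` and x + y in class `k`. Exchanging x and y
      -- swaps `i` and `j`, while fixing y evaluates the count as a cyclotomic number; comparing the
      -- two is the source of `cyc-rotate`.
      triple : ℤ₃ → ℤ₃ → ℤ₃ → ℤ
      triple i j k = ∑ p (λ y → ∑ p (λ x → I j y * (I i x * I k (x + y))))

      triple-eq : ∀ i j k → triple i j k ≡ + f * cyc (⊖ j ⊕ i) (⊖ j ⊕ k)
      triple-eq i j k = begin
        ∑ p (λ y → ∑ p (λ x → I j y * (I i x * I k (x + y))))
          ≡⟨ ∑-cong p (λ y → trans (∑-*ˡ p (I j y) (λ x → I i x * I k (x + y))) (on-class y (y ∈C? j))) ⟩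
        ∑ p (λ y → c * I j y) ≡⟨ ∑-*ˡ p c (I j) ⟩
        c * ∑ p (I j)         ≡⟨ cong (c *_) (∑-I j) ⟩
        c * + f               ≡⟨ *-comm c (+ f) ⟩
        + f * c               ∎
        where
        c = cyc (⊖ j ⊕ i) (⊖ j ⊕ k)
        on-class : ∀ y (d : Dec (y ∈C j)) → ⟦ d ⟧ * correlation i k y ≡ c * ⟦ d ⟧
        on-class y (yes y∈C) = trans (cong (1ℤ *_) (correlation-∈C y∈C i k)) (*-comm 1ℤ c)
        on-class y (no _)    = trans (*-zeroˡ (correlation i k y)) (sym (*-zeroʳ c))

      triple-swap : ∀ i j k → triple i j k ≡ triple j i k
      triple-swap i j k = trans (∑-swap p (λ y x → I j y * (I i x * I k (x + y))))
        (∑-cong p (λ x → ∑-cong p (λ y → trans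
          (lemma (I j y) (I i x) (I k (x + y)))
          (cong (λ z → I i x * (I j y * I k z)) (+-comm x y)))))
        where
        lemma : ∀ a b c → a * (b * c) ≡ b * (a * c)
        lemma = solve-∀

    cyc-rotate : ∀ i k → cyc i k ≡ cyc (⊖ i) (⊖ i ⊕ k)
    cyc-rotate i k = trans (*-cancelˡ-≡ (+ f) (cyc i k) _ (begin
      + f * cyc i k                   ≡⟨ triple-eq i 𝟘 k ⟨
      triple i 𝟘 k                    ≡⟨ triple-swap i 𝟘 k ⟩
      triple 𝟘 i k                    ≡⟨ triple-eq 𝟘 i k ⟩
      + f * cyc (⊖ i ⊕ 𝟘) (⊖ i ⊕ k)   ∎))
      (cong (λ z → cyc z (⊖ i ⊕ k)) (⊕-𝟘 (⊖ i)))

    a b c d : ℤ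
    a = cyc 𝟘 𝟘
    b = cyc 𝟘 𝟙
    c = cyc 𝟘 𝟚
    d = cyc 𝟙 𝟚

    -- The cyclotomic numbers (i, k), by the symmetries (i, k) = (k, i) = (-i, k - i).
    table : ℤ₃ → ℤ₃ → ℤ
    table 𝟘 𝟘 = a
    table 𝟘 𝟙 = b
    table 𝟘 𝟚 = c
    table 𝟙 𝟘 = b
    table 𝟙 𝟙 = c
    table 𝟙 𝟚 = d
    table 𝟚 𝟘 = c
    table 𝟚 𝟙 = d
    table 𝟚 𝟚 = b

    cyc≡table : ∀ i k → cyc i k ≡ table i k
    cyc≡table 𝟘 𝟘 = refl
    cyc≡table 𝟘 𝟙 = refl
    cyc≡table 𝟘 𝟚 = refl
    cyc≡table 𝟙 𝟘 = cyc-swap 𝟙 𝟘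
    cyc≡table 𝟙 𝟙 = trans (sym (cyc-rotate 𝟚 𝟘)) (cyc-swap 𝟚 𝟘)
    cyc≡table 𝟙 𝟚 = refl
    cyc≡table 𝟚 𝟘 = cyc-swap 𝟚 𝟘
    cyc≡table 𝟚 𝟙 = cyc-swap 𝟚 𝟙
    cyc≡table 𝟚 𝟚 = trans (sym (cyc-rotate 𝟙 𝟘)) (cyc-swap 𝟙 𝟘)

    -- The action of the i-th Gaussian period on class functions.
    ∑-I-classFunction : ∀ {j y} → y ∈C j → ∀ i (h₀ : ℤ) (t : ℤ₃ → ℤ) →
      ∑ p (λ x → I i x * classFunction h₀ t (x + y)) ≡
      h₀ * I i y + ∑₃ (λ k → t k * table (⊖ j ⊕ i) (⊖ j ⊕ k))
    ∑-I-classFunction {j} {y} y∈C i h₀ t = begin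
      ∑ p (λ x → I i x * (h₀ * δ p (x + y) + ∑₃ (λ k → t k * I k (x + y))))
        ≡⟨ ∑-cong p (λ x → lemma (I i x) h₀ (δ p (x + y)) (t 𝟘) (t 𝟙) (t 𝟚) (I 𝟘 (x + y)) (I 𝟙 (x + y)) (I 𝟚 (x + y))) ⟩
      ∑ p (λ x → h₀ * (I i x * δ p (x + y)) + ∑₃ (λ k → t k * (I i x * I k (x + y))))
        ≡⟨ ∑-+ p (λ x → h₀ * (I i x * δ p (x + y))) (λ x → ∑₃ (λ k → t k * (I i x * I k (x + y)))) ⟩
      ∑ p (λ x → h₀ * (I i x * δ p (x + y))) + ∑ p (λ x → ∑₃ (λ k → t k * (I i x * I k (x + y))))
        ≡⟨ cong₂ _+_ (trans (∑-*ˡ p h₀ (λ x → I i x * δ p (x + y))) (cong (h₀ *_) at-zero))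
             (trans (∑-∑₃ (λ k x → t k * (I i x * I k (x + y)))) (∑₃-cong on-class)) ⟩
      h₀ * I i y + ∑₃ (λ k → t k * table (⊖ j ⊕ i) (⊖ j ⊕ k)) ∎
      where
      lemma : ∀ i h e r s t x y z → i * (h * e + (r * x + s * y + t * z)) ≡
        h * (i * e) + (r * (i * x) + s * (i * y) + t * (i * z))
      lemma = solve-∀
      shift-back : ∀ x → x - y + y ≡ x
      shift-back x = trans (+-assoc x (- y) y) (trans (cong (λ z → x + z) (+-inverseˡ y)) (+-identityʳ x))
      at-zero : ∑ p (λ x → I i x * δ p (x + y)) ≡ I i y
      at-zero = begin
        ∑ p (λ x → I i x * δ p (x + y))
          ≡⟨ ∑-shift p-prime (λ e → cong₂ _*_ (I-periodic i e) (δ-periodic (mod-+ e mod-refl))) (- y) ⟨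
        ∑ p (λ x → I i (x - y) * δ p (x - y + y))
          ≡⟨ ∑-cong p (λ x → cong (λ z → I i (x - y) * δ p z) (shift-back x)) ⟩
        ∑ p (λ x → I i (x - y) * δ p x) ≡⟨ ∑-δ p (λ x → I i (x - y)) ⟩
        I i (0ℤ - y)                    ≡⟨ cong (I i) (+-identityˡ (- y)) ⟩
        I i (- y)                       ≡⟨ I-neg i y ⟩
        I i y                           ∎
      on-class : ∀ k → ∑ p (λ x → t k * (I i x * I k (x + y))) ≡ t k * table (⊖ j ⊕ i) (⊖ j ⊕ k)
      on-class k = trans (∑-*ˡ p (t k) (λ x → I i x * I k (x + y)))
        (cong (t k *_) (trans (correlation-∈C y∈C i k) (cyc≡table (⊖ j ⊕ i) (⊖ j ⊕ k))))

    ∑-I-classFunction-∣ : ∀ {y} → + p ∣ y → ∀ i (h₀ : ℤ) (t : ℤ₃ → ℤ) →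
      ∑ p (λ x → I i x * classFunction h₀ t (x + y)) ≡ t i * + f
    ∑-I-classFunction-∣ {y} p∣y i h₀ t = begin
      ∑ p (λ x → I i x * classFunction h₀ t (x + y))
        ≡⟨ ∑-cong p (λ x → trans (cong (I i x *_) (classFunction-periodic h₀ t
             (mod-trans (mod-+ (mod-refl {a = x}) (∣⇒≡0 p∣y)) (mod-reflexive (+-identityʳ x)))))
             (on-class x (x ∈C? i))) ⟩
      ∑ p (λ x → t i * I i x) ≡⟨ ∑-*ˡ p (t i) (I i) ⟩
      t i * ∑ p (I i)         ≡⟨ cong (t i *_) (∑-I i) ⟩
      t i * + f               ∎
      where
      on-class : ∀ x (d : Dec (x ∈C i)) → ⟦ d ⟧ * classFunction h₀ t x ≡ t i * ⟦ d ⟧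
      on-class x (yes x∈C) = trans (cong (1ℤ *_) (classFunction-∈C h₀ t x∈C)) (*-comm 1ℤ (t i))
      on-class x (no _)    = trans (*-zeroˡ (classFunction h₀ t x)) (sym (*-zeroʳ (t i)))

    private
      I-idem : ∀ k x → I k x * I k x ≡ I k x
      I-idem k x with x ∈C? k
      ... | yes _ = refl
      ... | no _  = refl

      I-disjoint : ∀ {i k} → ¬ i ≡ k → ∀ x → I i x * I k x ≡ 0ℤ
      I-disjoint {i} {k} i≢k x with x ∈C? i | x ∈C? k
      ... | yes m | yes n = contradiction (∈C-unique m n) i≢k
      ... | yes _ | no _  = refl
      ... | no _  | _     = refl

      correlation-∣ : ∀ i k {y} → + p ∣ y → correlation i k y ≡ ∑ p (λ x → I i x * I k x)
      correlation-∣ i k {y} p∣y = ∑-cong p (λ x → cong (I i x *_) (I-periodic k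
        (mod-trans (mod-+ (mod-refl {a = x}) (∣⇒≡0 p∣y)) (mod-reflexive (+-identityʳ x)))))

    -- The `i`-th period is applied to the constant function 1. The term `I i 1ℤ` accounts for x ≡
    -- -1, the one x for which x + 1 lies in no class.
    row-sum : ∀ i → + f ≡ I i 1ℤ + ∑₃ (table i)
    row-sum i = begin
      + f                      ≡⟨ ∑-I i ⟨
      ∑ p (I i)                ≡⟨ ∑-cong p (λ x → trans (sym (*-identityʳ (I i x))) (cong (I i x *_)
                                    (≡classFunction (λ _ → 1ℤ) 1ℤ (λ _ → 1ℤ) (λ _ → refl) (λ _ → refl) (x + 1ℤ)))) ⟩
      ∑ p (λ x → I i x * classFunction 1ℤ (λ _ → 1ℤ) (x + 1ℤ)) ≡⟨ ∑-I-classFunction 1∈C i 1ℤ (λ _ → 1ℤ) ⟩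
      1ℤ * I i 1ℤ + ∑₃ (λ k → 1ℤ * table i k)
        ≡⟨ cong₂ _+_ (*-identityˡ (I i 1ℤ)) (∑₃-cong (λ k → *-identityˡ (table i k))) ⟩
      I i 1ℤ + ∑₃ (table i)    ∎

    f≡1+a+b+c : + f ≡ 1ℤ + (a + b + c)
    f≡1+a+b+c = trans (row-sum 𝟘) (cong (_+ (a + b + c)) (I-member 1∈C))

    f≡b+c+d : + f ≡ b + c + d
    f≡b+c+d = trans (row-sum 𝟙) (trans
      (cong (_+ (b + c + d)) (I-nonmember {𝟙} λ m → contradiction (∈C-unique m 1∈C) λ ()))
      (+-identityˡ (b + c + d)))

    -- The periods η₀ and η₁ commute as operators; compare the two orders on I 𝟙 at 1.
    commutation : + f + (c * a + a * b + b * c) ≡ b * b + c * c + d * d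
    commutation = begin
      + f + (c * a + a * b + b * c)
        ≡⟨ cong (_+ (c * a + a * b + b * c)) (trans (sym (*-identityʳ (+ f))) (cong (+ f *_) (sym (I-member 1∈C)))) ⟩
      + f * I 𝟘 1ℤ + ∑₃ (λ k → t₁ k * table 𝟘 k) ≡⟨ ∑-I-classFunction 1∈C 𝟘 (+ f) t₁ ⟨
      ∑ p (λ x → I 𝟘 x * classFunction (+ f) t₁ (x + 1ℤ))
        ≡⟨ ∑-cong p (λ x → cong (I 𝟘 x *_) (≡classFunction (correlation 𝟙 𝟙) (+ f) t₁
             (λ p∣x → trans (correlation-∣ 𝟙 𝟙 p∣x) (trans (∑-cong p (I-idem 𝟙)) (∑-I 𝟙)))
             (λ {k} x∈C → trans (correlation-∈C x∈C 𝟙 𝟙) (cyc≡table (⊖ k ⊕ 𝟙) (⊖ k ⊕ 𝟙))) (x + 1ℤ))) ⟨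
      ∑ p (λ x → I 𝟘 x * ∑ p (λ y → I 𝟙 y * I 𝟙 (y + (x + 1ℤ))))
        ≡⟨ ∑-cong p (λ x → ∑-*ˡ p (I 𝟘 x) (λ y → I 𝟙 y * I 𝟙 (y + (x + 1ℤ)))) ⟨
      ∑ p (λ x → ∑ p (λ y → I 𝟘 x * (I 𝟙 y * I 𝟙 (y + (x + 1ℤ)))))
        ≡⟨ ∑-swap p (λ x y → I 𝟘 x * (I 𝟙 y * I 𝟙 (y + (x + 1ℤ)))) ⟩
      ∑ p (λ y → ∑ p (λ x → I 𝟘 x * (I 𝟙 y * I 𝟙 (y + (x + 1ℤ)))))
        ≡⟨ ∑-cong p (λ y → trans (∑-cong p (λ x → exchange x y)) (∑-*ˡ p (I 𝟙 y) (λ x → I 𝟘 x * I 𝟙 (x + (y + 1ℤ))))) ⟩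
      ∑ p (λ y → I 𝟙 y * ∑ p (λ x → I 𝟘 x * I 𝟙 (x + (y + 1ℤ))))
        ≡⟨ ∑-cong p (λ y → cong (I 𝟙 y *_) (≡classFunction (correlation 𝟘 𝟙) 0ℤ t₂
             (λ p∣x → trans (correlation-∣ 𝟘 𝟙 p∣x) (trans (∑-cong p (I-disjoint (λ ()))) (∑-0 p)))
             (λ {k} x∈C → trans (correlation-∈C x∈C 𝟘 𝟙) (cyc≡table (⊖ k ⊕ 𝟘) (⊖ k ⊕ 𝟙))) (y + 1ℤ))) ⟩
      ∑ p (λ y → I 𝟙 y * classFunction 0ℤ t₂ (y + 1ℤ)) ≡⟨ ∑-I-classFunction 1∈C 𝟙 0ℤ t₂ ⟩
      0ℤ * I 𝟙 1ℤ + ∑₃ (λ k → t₂ k * table 𝟙 k) ≡⟨ cong (_+ (b * b + c * c + d * d)) (*-zeroˡ (I 𝟙 1ℤ)) ⟩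
      0ℤ + (b * b + c * c + d * d) ≡⟨ +-identityˡ (b * b + c * c + d * d) ⟩
      b * b + c * c + d * d ∎
      where
      t₁ t₂ : ℤ₃ → ℤ
      t₁ k = table (⊖ k ⊕ 𝟙) (⊖ k ⊕ 𝟙)
      t₂ k = table (⊖ k ⊕ 𝟘) (⊖ k ⊕ 𝟙)
      exchange : ∀ x y → I 𝟘 x * (I 𝟙 y * I 𝟙 (y + (x + 1ℤ))) ≡ I 𝟙 y * (I 𝟘 x * I 𝟙 (x + (y + 1ℤ)))
      exchange x y = trans (lemma (I 𝟘 x) (I 𝟙 y) (I 𝟙 (y + (x + 1ℤ))))
        (cong (λ z → I 𝟙 y * (I 𝟘 x * I 𝟙 z)) (lemma′ x y))
        where
        lemma : ∀ u v w → u * (v * w) ≡ v * (u * w)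
        lemma = solve-∀
        lemma′ : ∀ x y → y + (x + 1ℤ) ≡ x + (y + 1ℤ)
        lemma′ = solve-∀

-- Frobenius in the ring generated by shifts.

module ShiftOperators where

  open Frobenius using (frobenius-sum)
  open Congruence
  open Residues
  open import Algebra.Bundles using (Semiring)
  open import Data.Fin.Base using (Fin; zero; suc; toℕ)
  open import Data.Integer.Base hiding (suc; pred)
  open import Data.Integer.Divisibility.Signed
  open import Data.Integer.Properties
  open import Data.Integer.Tactic.RingSolver using (solve-∀)

  module _ {q : ℕ} (q-prime : Prime q) where

    open PrimeModulus q-prime using (fermat)

    Function : Set
    Function = ℤ → ℤ

    -- Additive maps on functions modulo q. Compatibility with pointwise congruence makes
    -- composition well defined; additivity and the value at zero give left distributivity and the
    -- right annihilator law.
    record Operator : Set where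
      no-eta-equality
      field
        apply : Function → Function
        apply-cong : ∀ {g h} → (∀ y → g y ≡ h y [ + q ]) → ∀ y → apply g y ≡ apply h y [ + q ]
        apply-+ : ∀ g h y → apply (λ z → g z + h z) y ≡ apply g y + apply h y [ + q ]
        apply-0 : ∀ y → apply (λ _ → 0ℤ) y ≡ 0ℤ [ + q ]

    open Operator

    infix 4 _≈_
    record _≈_ (A B : Operator) : Set where
      constructor pointwise
      field at : ∀ g y → apply A g y ≡ apply B g y [ + q ]

    open _≈_

    operators : Semiring 0ℓ 0ℓ
    operators = record
      { Carrier = Operator
      ; _≈_ = _≈_
      ; _+_ = λ A B → record
        { apply = λ g y → apply A g y + apply B g y
        ; apply-cong = λ e y → mod-+ (apply-cong A e y) (apply-cong B e y)
        ; apply-+ = λ g h y → mod-trans (mod-+ (apply-+ A g h y) (apply-+ B g h y))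
            (mod-reflexive (interchange (apply A g y) (apply A h y) (apply B g y) (apply B h y)))
        ; apply-0 = λ y → mod-+ (apply-0 A y) (apply-0 B y)
        }
      ; _*_ = λ A B → record
        { apply = λ g → apply A (apply B g)
        ; apply-cong = λ e → apply-cong A (apply-cong B e)
        ; apply-+ = λ g h y → mod-trans (apply-cong A (apply-+ B g h) y)
            (apply-+ A (apply B g) (apply B h) y)
        ; apply-0 = λ y → mod-trans (apply-cong A (apply-0 B) y) (apply-0 A y)
        }
      ; 0# = record
        { apply = λ _ _ → 0ℤ
        ; apply-cong = λ _ _ → mod-refl
        ; apply-+ = λ _ _ _ → mod-refl
        ; apply-0 = λ _ → mod-refl
        }
      ; 1# = record
        { apply = λ g → g
        ; apply-cong = λ e → e
        ; apply-+ = λ _ _ _ → mod-refl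
        ; apply-0 = λ _ → mod-refl
        }
      ; isSemiring = record
        { isSemiringWithoutAnnihilatingZero = record
          { +-isCommutativeMonoid = record
            { isMonoid = record
              { isSemigroup = record
                { isMagma = record
                  { isEquivalence = record
                    { refl = pointwise λ _ _ → mod-refl
                    ; sym = λ e → pointwise λ g y → mod-sym (at e g y)
                    ; trans = λ d e → pointwise λ g y → mod-trans (at d g y) (at e g y)
                    }
                  ; ∙-cong = λ d e → pointwise λ g y → mod-+ (at d g y) (at e g y)
                  }
                ; assoc = λ A B C → pointwise λ g y → mod-reflexive (+-assoc (apply A g y) _ _)
                }
              ; identity = (λ A → pointwise λ g y → mod-reflexive (+-identityˡ _))
                         , (λ A → pointwise λ g y → mod-reflexive (+-identityʳ _))
              }
            ; comm = λ A B → pointwise λ g y → mod-reflexive (+-comm (apply A g y) _)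
            }
          ; *-cong = λ {A} {A′} {B} {B′} d e → pointwise λ g y →
              mod-trans (apply-cong A (at e g) y) (at d (apply B′ g) y)
          ; *-assoc = λ _ _ _ → pointwise λ _ _ → mod-refl
          ; *-identity = (λ _ → pointwise λ _ _ → mod-refl) , (λ _ → pointwise λ _ _ → mod-refl)
          ; distrib = (λ A B C → pointwise λ g y → apply-+ A (apply B g) (apply C g) y)
                    , (λ _ _ _ → pointwise λ _ _ → mod-refl)
          }
        ; zero = (λ _ → pointwise λ _ _ → mod-refl) , (λ A → pointwise λ _ y → apply-0 A y)
        }
      }
      where
      interchange : ∀ a b c d → (a + b) + (c + d) ≡ (a + c) + (b + d)
      interchange = solve-∀

    open Semiring operators using () renaming (_*_ to _∘_)
    open import Algebra.Properties.Semiring.Exp operators using () renaming (_^_ to _^ᵒ_)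
    open import Algebra.Properties.Semiring.Mult operators using () renaming (_×_ to _×ᵒ_)
    open import Algebra.Properties.Semiring.Sum operators using () renaming (sum to sumᵒ)

    char-operators : ∀ A → q ×ᵒ A ≈ Semiring.0# operators
    char-operators A = pointwise λ g y →
      mod-trans (mod-reflexive (×-apply q g y)) (∣⇒≡0 (divides (apply A g y) (*-comm (+ q) (apply A g y))))
      where
      ×-apply : ∀ n g y → apply (n ×ᵒ A) g y ≡ + n * apply A g y
      ×-apply zero    g y = refl
      ×-apply (suc n) g y = trans (cong (_+_ (apply A g y)) (×-apply n g y)) (sym (suc-* (+ n) (apply A g y)))

    -- The operator w T^s, where (T h) y = h (y + 1).
    shift : ℤ → ℤ → Operator
    shift w s = record
      { apply = λ g y → w * g (s + y)
      ; apply-cong = λ e y → mod-* (mod-refl {a = w}) (e (s + y))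
      ; apply-+ = λ g h y → mod-reflexive (*-distribˡ-+ w (g (s + y)) (h (s + y)))
      ; apply-0 = λ y → mod-reflexive (*-zeroʳ w)
      }

    shift-commute : ∀ v r w s → shift v r ∘ shift w s ≈ shift w s ∘ shift v r
    shift-commute v r w s = pointwise λ g y → mod-reflexive
      (trans (cong (λ z → v * (w * g z)) (lemma r s y)) (lemma′ v w (g (r + (s + y)))))
      where
      lemma : ∀ r s y → s + (r + y) ≡ r + (s + y)
      lemma = solve-∀
      lemma′ : ∀ v w g → v * (w * g) ≡ w * (v * g)
      lemma′ = solve-∀

    shift-^ : ∀ w s n g y → apply (shift w s ^ᵒ n) g y ≡ w ^ n * g (+ n * s + y)
    shift-^ w s zero    g y = trans (cong g (lemma s y)) (sym (*-identityˡ (g (0ℤ * s + y))))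
      where
      lemma : ∀ s y → y ≡ 0ℤ * s + y
      lemma = solve-∀
    shift-^ w s (suc n) g y = trans (cong (w *_) (shift-^ w s n g (s + y)))
      (trans (cong (λ z → w * (w ^ n * g z)) (lemma (+ n) s y)) (sym (*-assoc w (w ^ n) (g (+ suc n * s + y)))))
      where
      lemma : ∀ n s y → n * s + (s + y) ≡ (1ℤ + n) * s + y
      lemma = solve-∀

    apply-sum : ∀ {n} (t : Fin n → Operator) g y →
      apply (sumᵒ t) g y ≡ sum (λ i → apply (t i) g y)
    apply-sum {zero}  t g y = refl
    apply-sum {suc n} t g y = cong (_+_ (apply (t zero) g y)) (apply-sum (λ i → t (suc i)) g y)

    frobeniusᵒ : ∀ {n} (t : Fin n → Operator) → (∀ i j → t i ∘ t j ≈ t j ∘ t i) →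
      sumᵒ t ^ᵒ q ≈ sumᵒ (λ i → t i ^ᵒ q)
    frobeniusᵒ = frobenius-sum operators q-prime char-operators

    module _ (p : ℕ) (w : ℤ → ℤ) where

      convolve : (ℤ → ℤ) → ℤ → ℤ
      convolve g y = ∑ p (λ x → w x * g (x + y))

      private
        term : Fin p → Operator
        term i = shift (w (+ toℕ i)) (+ toℕ i)

      sum-mod : ∀ {n} {s t : Fin n → ℤ} → (∀ i → s i ≡ t i [ + q ]) → sum s ≡ sum t [ + q ]
      sum-mod {zero}  e = mod-refl
      sum-mod {suc n} e = mod-+ (e zero) (sum-mod (λ i → e (suc i)))

      -- (Σ w(x) T^x)^q ≡ Σ w(x) T^(q x) modulo q, applied to an eigenfunction.
      frobenius-eigenfunction : ∀ t h → (∀ y → convolve h y ≡ t * h y [ + q ]) →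
        ∀ y → ∑ p (λ x → w x * h (+ q * x + y)) ≡ t * h y [ + q ]
      frobenius-eigenfunction t h eigen y =
        mod-trans (mod-sym (mod-trans expand (mod-trans (mod-reflexive distribute) evaluate)))
          (mod-trans (power q y) (mod-* (fermat t) (mod-refl {a = h y})))
        where
        powers : Fin p → Operator
        powers i = term i ^ᵒ q
        expand : apply (sumᵒ term ^ᵒ q) h y ≡ apply (sumᵒ powers) h y [ + q ]
        commute : ∀ i j → term i ∘ term j ≈ term j ∘ term i
        commute i j = pointwise λ g y →
          at (shift-commute (w (+ toℕ i)) (+ toℕ i) (w (+ toℕ j)) (+ toℕ j)) g y
        expand = at (frobeniusᵒ term commute) h y
        distribute : apply (sumᵒ powers) h y ≡ sum (λ i → apply (powers i) h y)
        distribute = apply-sum powers h y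
        evaluate : sum (λ i → apply (powers i) h y) ≡ ∑ p (λ x → w x * h (+ q * x + y)) [ + q ]
        evaluate = sum-mod {p} (λ i → mod-trans
          (mod-reflexive (shift-^ (w (+ toℕ i)) (+ toℕ i) q h y))
          (mod-* (fermat (w (+ toℕ i))) mod-refl))
        power : ∀ n y → apply (sumᵒ term ^ᵒ n) h y ≡ t ^ n * h y [ + q ]
        power zero    y = mod-reflexive (sym (*-identityˡ (h y)))
        power (suc n) y = mod-trans (apply-cong (sumᵒ term) (power n) y)
          (mod-trans (mod-reflexive (apply-sum term (λ z → t ^ n * h z) y))
          (mod-trans (mod-reflexive (trans
              (∑-cong p (λ x → lemma (w x) (t ^ n) (h (x + y))))
              (∑-*ˡ p (t ^ n) (λ x → w x * h (x + y)))))
          (mod-trans (mod-* (mod-refl {a = t ^ n}) (eigen y))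
            (mod-reflexive (lemma′ (t ^ n) t (h y))))))
          where
          lemma : ∀ w t h → w * (t * h) ≡ t * (w * h)
          lemma = solve-∀
          lemma′ : ∀ s t h → s * (t * h) ≡ t * s * h
          lemma′ = solve-∀

-- A prime modulo which the periods have images is a cubic residue.

module Reciprocity where

  open Congruence
  open Residues
  open CubicCharacter
  open Cyclotomic
  open ShiftOperators using (frobenius-eigenfunction)
  open import Data.Integer.Base hiding (suc; pred)
  open import Data.Integer.Divisibility.Signed
  open import Data.Integer.Properties
  open import Data.Integer.Tactic.RingSolver using (solve-∀)

  prime∣prime⇒≡ : ∀ {p q} → Prime p → Prime q → + p ∣ + q → p ≡ q
  prime∣prime⇒≡ p-prime q-prime p∣q with prime⇒irreducible q-prime (∣⇒∣ℕ p∣q)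
  ... | inj₁ refl = contradiction p-prime ¬prime[1]
  ... | inj₂ p≡q  = p≡q

  module _ (f : ℕ) (p-prime : Prime (suc (3 ℕ.* f)))
           {q : ℕ} (q-prime : Prime q) where

    open CyclotomicNumbers f p-prime

    private
      F : ℤ
      F = + f

    -- The images of the Gaussian periods η₀, η₁, η₂ under a ring homomorphism to ℤ/q.
    record PeriodImages (t : ℤ₃ → ℤ) : Set where
      field
        product : ∀ i j → t i * t j ≡
          F * ind j i + ∑₃ (λ k → t k * table (⊖ j ⊕ i) (⊖ j ⊕ k)) [ + q ]
        total   : ∑₃ t ≡ -1ℤ [ + q ]

    module _ {t} (images : PeriodImages t) (q≢p : ¬ q ≡ p) where

      open PeriodImages images

      private
        -- The image of y ↦ Tr(η₀ ζ^y): an eigenfunction of all the periods.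
        h : ℤ → ℤ
        h = classFunction F t

        h-∈C : ∀ {j y} → y ∈C j → h y ≡ t j
        h-∈C = classFunction-∈C F t

        eigen : ∀ i y → ∑ p (λ x → I i x * h (x + y)) ≡ t i * h y [ + q ]
        eigen i y = by-cases (+ p ∣? y)
          where
          by-cases : Dec (+ p ∣ y) → ∑ p (λ x → I i x * h (x + y)) ≡ t i * h y [ + q ]
          by-cases (yes p∣y) = mod-reflexive (trans (∑-I-classFunction-∣ p∣y i F t)
            (cong (t i *_) (sym (classFunction-∣ F t p∣y))))
          by-cases (no p∤y) = let j , y∈C = classify p∤y in mod-trans
            (mod-reflexive (trans (∑-I-classFunction y∈C i F t)
              (cong (λ z → F * z + ∑₃ (λ k → t k * table (⊖ j ⊕ i) (⊖ j ⊕ k))) (I-ind j i y∈C))))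
            (mod-trans (mod-sym (product i j)) (mod-reflexive (cong (t i *_) (sym (h-∈C y∈C)))))

        p∤q : ¬ + p ∣ + q
        p∤q p∣q = q≢p (sym (prime∣prime⇒≡ p-prime q-prime p∣q))

        module _ {s} (q∈C : + q ∈C s) where

          -- If q lies in class s, then Σ T^(qx) over x in class `i` is the period `s ⊕ i`. By
          -- Frobenius it acts on the eigenfunction `h` with the same eigenvalue as the period `i`.
          rotate : ∀ i y → t i * h y ≡ t (s ⊕ i) * h y [ + q ]
          rotate i y = mod-trans
            (mod-sym (frobenius-eigenfunction q-prime p (I i) (t i) h (eigen i) y))
            (mod-trans (mod-reflexive (begin
              ∑ p (λ x → I i x * h (+ q * x + y))
                ≡⟨ ∑-cong p (λ x → cong (_* h (+ q * x + y)) (I-scale q∈C i x)) ⟨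
              ∑ p (λ x → I (s ⊕ i) (+ q * x) * h (+ q * x + y))
                ≡⟨ ∑-scale p-prime {λ x → I (s ⊕ i) x * h (x + y)}
                     (λ e → cong₂ _*_ (I-periodic (s ⊕ i) e) (classFunction-periodic F t (mod-+ e mod-refl))) p∤q ⟩
              ∑ p (λ x → I (s ⊕ i) x * h (x + y)) ∎))
            (eigen (s ⊕ i) y))
            where open ≡-Reasoning

          -- Taking one y in each class, `rotate` gives tᵢ tⱼ ≡ tₛ₊ᵢ tⱼ for every j. Adding these
          -- cancels the second factor, since Σ tⱼ ≡ -1 is a unit; no single tⱼ has to be shown
          -- invertible.
          t-invariant : ∀ i → t i ≡ t (s ⊕ i) [ + q ]
          t-invariant i = mod-trans (mod-sym (times-total (t i)))
            (mod-trans (mod-neg (mod-trans (mod-reflexive (sym (expand (t i))))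
              (mod-trans (mod-+ (mod-+ (on 𝟘) (on 𝟙)) (on 𝟚)) (mod-reflexive (expand (t (s ⊕ i)))))))
            (times-total (t (s ⊕ i))))
            where
            on : ∀ j → t i * t j ≡ t (s ⊕ i) * t j [ + q ]
            on j = let y , y∈C = element j in
              subst (λ z → t i * z ≡ t (s ⊕ i) * z [ + q ]) (h-∈C y∈C) (rotate i y)
            expand : ∀ x → x * t 𝟘 + x * t 𝟙 + x * t 𝟚 ≡ x * ∑₃ t
            expand x = lemma x (t 𝟘) (t 𝟙) (t 𝟚)
              where
              lemma : ∀ x u v w → x * u + x * v + x * w ≡ x * (u + v + w)
              lemma = solve-∀
            times-total : ∀ x → - (x * ∑₃ t) ≡ x [ + q ]
            times-total x = mod-trans (mod-neg (mod-* (mod-refl {a = x}) total)) (mod-reflexive (lemma x))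
              where
              lemma : ∀ x → - (x * -1ℤ) ≡ x
              lemma = solve-∀

          -- If all t i agree modulo q then so do the two products, which forces t ≡ f
          -- and hence p = 1 + 3f ≡ 0.
          constant-impossible : t 𝟙 ≡ t 𝟘 [ + q ] → ¬ t 𝟚 ≡ t 𝟘 [ + q ]
          constant-impossible t₁≡t₀ t₂≡t₀ = q≢p (prime∣prime⇒≡ q-prime p-prime
            (≡0⇒∣ (mod-trans (mod-reflexive (trans (cong (λ z → 1ℤ + z) (pos-* 3 f)) (lemma₄ F)))
              (mod-trans (mod-+ (mod-refl {a = 1ℤ}) (mod-+ (mod-+ F≡t F≡t) F≡t))
                (mod-+ (mod-refl {a = 1ℤ}) (mod-trans
                    (mod-+ (mod-+ (mod-refl {a = t₀}) (mod-sym t₁≡t₀)) (mod-sym t₂≡t₀)) total))))))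
            where
            t₀ = t 𝟘
            square : t₀ * t₀ ≡ F * 1ℤ + (t₀ * a + t₀ * b + t₀ * c) [ + q ]
            square = mod-trans (product 𝟘 𝟘) (mod-+ (mod-refl {a = F * 1ℤ})
              (mod-+ (mod-+ (mod-refl {a = t₀ * a}) (mod-* t₁≡t₀ (mod-refl {a = b}))) (mod-* t₂≡t₀ (mod-refl {a = c}))))
            mixed : t₀ * t₀ ≡ F * 0ℤ + (t₀ * b + t₀ * c + t₀ * d) [ + q ]
            mixed = mod-trans (mod-* (mod-sym t₁≡t₀) (mod-refl {a = t₀}))
              (mod-trans (product 𝟙 𝟘) (mod-+ (mod-refl {a = F * 0ℤ})
                (mod-+ (mod-+ (mod-refl {a = t₀ * b}) (mod-* t₁≡t₀ (mod-refl {a = c}))) (mod-* t₂≡t₀ (mod-refl {a = d})))))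
            lemma₁ : ∀ t F a b c → F * 1ℤ + (t * a + t * b + t * c) ≡
              F + t * (1ℤ + (a + b + c)) - t
            lemma₁ = solve-∀
            lemma₂ : ∀ t F b c d → F * 0ℤ + (t * b + t * c + t * d) ≡ t * (b + c + d)
            lemma₂ = solve-∀
            lemma₃ : ∀ t F → F ≡ t + ((F + t * F - t) - t * F)
            lemma₃ = solve-∀
            lemma₄ : ∀ F → 1ℤ + + 3 * F ≡ 1ℤ + (F + F + F)
            lemma₄ = solve-∀
            F≡t : F ≡ t₀ [ + q ]
            F≡t = mod-trans (mod-reflexive (lemma₃ t₀ F)) (mod-trans (mod-+ (mod-refl {a = t₀})
              (mod-trans (mod-minus (mod-sym (subst (λ z → t₀ * t₀ ≡ F + t₀ * z - t₀ [ + q ]) (sym f≡1+a+b+c)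
                  (mod-trans square (mod-reflexive (lemma₁ t₀ F a b c)))))
                (mod-sym (subst (λ z → t₀ * t₀ ≡ t₀ * z [ + q ]) (sym f≡b+c+d)
                  (mod-trans mixed (mod-reflexive (lemma₂ t₀ F b c d))))))
                (mod-reflexive (+-inverseʳ (t₀ * t₀)))))
              (mod-reflexive (+-identityʳ t₀)))

      q-class : + q ∈C 𝟘
      q-class = let s , q∈C = classify p∤q in by-cases s q∈C
        where
        by-cases : ∀ s → + q ∈C s → + q ∈C 𝟘
        by-cases 𝟘 m = m
        by-cases 𝟙 m = contradiction (mod-trans (mod-sym (t-invariant m 𝟙)) (mod-sym (t-invariant m 𝟘)))
          (constant-impossible m (mod-sym (t-invariant m 𝟘)))
        by-cases 𝟚 m = contradiction (mod-sym (t-invariant m 𝟘))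
          (constant-impossible m (t-invariant m 𝟙))

      cubic-residue : ∃[ y ] + q ≡ y ^ 3 [ + p ]
      cubic-residue = ∈C𝟘⇒cube q-class

-- The index form and the prime divisors of its primitive values.

module CubicForm where

  open Congruence
  open CubicCharacter
  open Cyclotomic
  open Reciprocity
  open import Data.Integer.Base hiding (suc; pred)
  open import Data.Integer.Divisibility.Signed
  open import Data.Integer.Properties
  open import Data.Integer.Solver using (module +-*-Solver)
  open import Data.Integer.Tactic.RingSolver using (solve-∀)

  -- A binary cubic form of discriminant (B² + 3BM + 9M²)².
  form : ℤ → ℤ → ℤ → ℤ → ℤ
  form M B u v = M * (u * u * u) + B * (u * u * v) + - (+ 3 * M + B) * (u * v * v) + M * (v * v * v)

  -- All that the counting argument uses from the theory of periods. With `M` and `B` abstract, the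
  -- form can later be replaced by its negative.
  record ResidueForm (p : ℕ) : Set where
    field
      M B      : ℤ
      norm     : + p ≡ B * B + + 3 * (B * M) + + 9 * (M * M)
      residues : ∀ {q} → Prime q → ¬ q ≡ p → ∀ u v → ¬ ((+ q ∣ u) × (+ q ∣ v)) →
                 + q ∣ form M B u v → ∃[ y ] + q ≡ y ^ 3 [ + p ]

  form-cong : ∀ {m} M B {u v x y} → u ≡ x [ m ] → v ≡ y [ m ] → form M B u v ≡ form M B x y [ m ]
  form-cong {m} M B u≡x v≡y = mod-+ (mod-+ (mod-+
      (mod-* (mod-refl {a = M}) (mod-* (mod-* u≡x u≡x) u≡x))
      (mod-* (mod-refl {a = B}) (mod-* (mod-* u≡x u≡x) v≡y)))
      (mod-* (mod-refl {a = - (+ 3 * M + B)}) (mod-* (mod-* u≡x v≡y) v≡y)))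
      (mod-* (mod-refl {a = M}) (mod-* (mod-* v≡y v≡y) v≡y))

  open +-*-Solver using (Polynomial; solve; con; _:+_; _:*_; _:-_; :-_; _:=_)

  -- The quantities of `PeriodIdentities` once more, as solver expressions, so that each identity
  -- can be handed to reflection in its structured form.
  module Symbolic (b c d n : Polynomial 4) where

    a′ R′ M′ B′ φ′ t₀′ t₁′ t₂′ : Polynomial 4
    a′  = d :- con 1ℤ
    R′  = (b :+ c :+ d :+ (c :* a′ :+ a′ :* b :+ b :* c)) :- (b :* b :+ c :* c :+ d :* d)
    M′  = b :- c
    B′  = con 1ℤ :- con (+ 3) :* d :+ con (+ 3) :* c
    φ′  = M′ :* (n :* n :* n) :+ B′ :* (n :* n :* con 1ℤ) :+ :- (con (+ 3) :* M′ :+ B′) :* (n :* con 1ℤ :* con 1ℤ)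
         :+ M′ :* con 1ℤ
    t₀′ = M′ :* n :+ (c :- d)
    t₁′ = M′ :* n :* n :+ B′ :* n :- (con (+ 3) :* M′ :+ B′) :+ (b :- d)
    t₂′ = con -1ℤ :- t₀′ :- t₁′

  -- The period relations modulo φ = form M B n 1, as identities in b, c, d, n once
  -- f = b + c + d and a = d - 1 are eliminated; R vanishes for cyclotomic numbers.
  module PeriodIdentities (b c d n : ℤ) where

    a R M B φ t₀ t₁ t₂ : ℤ
    a  = d - 1ℤ
    R  = (b + c + d + (c * a + a * b + b * c)) - (b * b + c * c + d * d)
    M  = b - c
    B  = 1ℤ - + 3 * d + + 3 * c
    φ  = form M B n 1ℤ
    -- For a root θ of the form, 1, Mθ, Mθ² + Bθ is the Delone-Faddeev basis of its cubic ring. Here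
    -- `n` stands for θ and the added constants translate the basis onto two periods; the third
    -- follows from the trace -1.
    t₀ = M * n + (c - d)
    t₁ = M * n * n + B * n - (+ 3 * M + B) + (b - d)
    t₂ = -1ℤ - t₀ - t₁

    -- Once `R` vanishes the right side is 1 + 3f = p. Multiplied by 4 this is Gauss's 4p = L² +
    -- 27M² with L = 2B + 3M.
    norm : B * B + + 3 * (B * M) + + 9 * (M * M) ≡ 1ℤ + + 3 * (b + c + d) - + 9 * R
    norm = solve 4 (λ b c d n → let open Symbolic b c d n in
      B′ :* B′ :+ con (+ 3) :* (B′ :* M′) :+ con (+ 9) :* (M′ :* M′) :=
      con 1ℤ :+ con (+ 3) :* (b :+ c :+ d) :- con (+ 9) :* R′) refl b c d n

    P₀₀ : t₀ * t₀ ≡ (b + c + d) * 1ℤ + (t₀ * a + t₁ * b + t₂ * c) + (0ℤ * φ + - + 2 * R)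
    P₀₀ = solve 4 (λ b c d n → let open Symbolic b c d n in
      t₀′ :* t₀′ := (b :+ c :+ d) :* con 1ℤ :+ (t₀′ :* a′ :+ t₁′ :* b :+ t₂′ :* c) :+ (con 0ℤ :* φ′ :+ con (- + 2) :* R′)) refl b c d n

    P₀₁ : t₀ * t₁ ≡ (b + c + d) * 0ℤ + (t₀ * b + t₁ * c + t₂ * d) + (M * φ + 1ℤ * R)
    P₀₁ = solve 4 (λ b c d n → let open Symbolic b c d n in
      t₀′ :* t₁′ := (b :+ c :+ d) :* con 0ℤ :+ (t₀′ :* b :+ t₁′ :* c :+ t₂′ :* d) :+ (M′ :* φ′ :+ con (1ℤ) :* R′)) refl b c d n

    P₀₂ : t₀ * t₂ ≡ (b + c + d) * 0ℤ + (t₀ * c + t₁ * d + t₂ * b) + (- M * φ + 1ℤ * R)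
    P₀₂ = solve 4 (λ b c d n → let open Symbolic b c d n in
      t₀′ :* t₂′ := (b :+ c :+ d) :* con 0ℤ :+ (t₀′ :* c :+ t₁′ :* d :+ t₂′ :* b) :+ (:- M′ :* φ′ :+ con (1ℤ) :* R′)) refl b c d n

    P₁₁ : t₁ * t₁ ≡ (b + c + d) * 1ℤ + (t₀ * c + t₁ * a + t₂ * b) + ((M * n + B) * φ + - + 2 * R)
    P₁₁ = solve 4 (λ b c d n → let open Symbolic b c d n in
      t₁′ :* t₁′ := (b :+ c :+ d) :* con 1ℤ :+ (t₀′ :* c :+ t₁′ :* a′ :+ t₂′ :* b) :+ ((M′ :* n :+ B′) :* φ′ :+ con (- + 2) :* R′)) refl b c d n

    P₁₂ : t₁ * t₂ ≡ (b + c + d) * 0ℤ + (t₀ * d + t₁ * b + t₂ * c) + (- (M * n + B + M) * φ + 1ℤ * R)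
    P₁₂ = solve 4 (λ b c d n → let open Symbolic b c d n in
      t₁′ :* t₂′ := (b :+ c :+ d) :* con 0ℤ :+ (t₀′ :* d :+ t₁′ :* b :+ t₂′ :* c) :+ (:- (M′ :* n :+ B′ :+ M′) :* φ′ :+ con (1ℤ) :* R′)) refl b c d n

    P₂₂ : t₂ * t₂ ≡ (b + c + d) * 1ℤ + (t₀ * b + t₁ * c + t₂ * a) + ((M * n + B + M + M) * φ + - + 2 * R)
    P₂₂ = solve 4 (λ b c d n → let open Symbolic b c d n in
      t₂′ :* t₂′ := (b :+ c :+ d) :* con 1ℤ :+ (t₀′ :* b :+ t₁′ :* c :+ t₂′ :* a′) :+ ((M′ :* n :+ B′ :+ M′ :+ M′) :* φ′ :+ con (- + 2) :* R′)) refl b c d n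

  module _ (f : ℕ) (p-prime : Prime (suc (3 ℕ.* f))) where

    open CyclotomicNumbers f p-prime
    open module Values n = PeriodIdentities b c d n
      using (φ; t₀; t₁; t₂; P₀₀; P₀₁; P₀₂; P₁₁; P₁₂; P₂₂)
    open PeriodIdentities b c d 0ℤ using (R; M; B)

    private
      a≡d-1 : a ≡ d - 1ℤ
      a≡d-1 = trans (lemma a b c) (trans (cong (λ z → z - 1ℤ - b - c) (trans (sym f≡1+a+b+c) f≡b+c+d)) (lemma′ b c d))
        where
        lemma : ∀ a b c → a ≡ (1ℤ + (a + b + c)) - 1ℤ - b - c
        lemma = solve-∀
        lemma′ : ∀ b c d → (b + c + d) - 1ℤ - b - c ≡ d - 1ℤ
        lemma′ = solve-∀

      R≡0 : R ≡ 0ℤ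
      R≡0 = trans (cong₂ (λ z a → z + (c * a + a * b + b * c) - (b * b + c * c + d * d)) (sym f≡b+c+d) (sym a≡d-1))
        (trans (cong (_- (b * b + c * c + d * d)) commutation) (+-inverseʳ (b * b + c * c + d * d)))

      module _ {q} (q-prime : Prime q) (n : ℤ) (q∣φ : + q ∣ φ n) where

        t : ℤ₃ → ℤ
        t 𝟘 = t₀ n
        t 𝟙 = t₁ n
        t 𝟚 = t₂ n

        -- The cofactors `k` and `l` show the defect to be a combination of `φ n`, divisible by q,
        -- and of `R`, which is zero. The last argument restores `a` where the identity has d - 1.
        reduce : ∀ {x r s} e k l → x ≡ (b + c + d) * e + r + (k * φ n + l * R) → r ≡ s →
          x ≡ + f * e + s [ + q ]
        reduce {x} {r} {s} e k l identity r≡s = mod-trans (mod-reflexive identity)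
          (mod-trans (mod-+ (mod-reflexive (cong₂ (λ z r → z * e + r) (sym f≡b+c+d) r≡s))
              (∣⇒≡0 (∣m∣n⇒∣m+n (∣n⇒∣m*n k q∣φ) (∣n⇒∣m*n l (divides 0ℤ R≡0)))))
            (mod-reflexive (+-identityʳ (+ f * e + s))))

        swap : ∀ {x} i j → t j * t i ≡ x [ + q ] → t i * t j ≡ x [ + q ]
        swap i j = mod-trans (mod-reflexive (*-comm (t i) (t j)))

        images : PeriodImages f p-prime q-prime t
        images = record { product = product ; total = mod-reflexive (lemma (t₀ n) (t₁ n)) }
          where
          lemma : ∀ x y → x + y + (-1ℤ - x - y) ≡ -1ℤ
          lemma = solve-∀
          product : ∀ i j → t i * t j ≡
            + f * ind j i + ∑₃ (λ k → t k * table (⊖ j ⊕ i) (⊖ j ⊕ k)) [ + q ]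
          product 𝟘 𝟘 = reduce 1ℤ 0ℤ (- + 2) (P₀₀ n) (cong (λ a → t₀ n * a + t₁ n * b + t₂ n * c) (sym a≡d-1))
          product 𝟘 𝟙 = reduce 0ℤ M 1ℤ (P₀₁ n) refl
          product 𝟘 𝟚 = reduce 0ℤ (- M) 1ℤ (P₀₂ n) refl
          product 𝟙 𝟘 = swap 𝟙 𝟘 (reduce 0ℤ M 1ℤ (P₀₁ n) refl)
          product 𝟙 𝟙 = reduce 1ℤ (M * n + B) (- + 2) (P₁₁ n) (cong (λ a → t₀ n * c + t₁ n * a + t₂ n * b) (sym a≡d-1))
          product 𝟙 𝟚 = reduce 0ℤ (- (M * n + B + M)) 1ℤ (P₁₂ n) refl
          product 𝟚 𝟘 = swap 𝟚 𝟘 (reduce 0ℤ (- M) 1ℤ (P₀₂ n) refl)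
          product 𝟚 𝟙 = swap 𝟚 𝟙 (reduce 0ℤ (- (M * n + B + M)) 1ℤ (P₁₂ n) refl)
          product 𝟚 𝟚 = reduce 1ℤ (M * n + B + M + M) (- + 2) (P₂₂ n) (cong (λ a → t₀ n * b + t₁ n * c + t₂ n * a) (sym a≡d-1))

      module _ {q} (q-prime : Prime q) where

        open PrimeModulus q-prime

        -- A root with v ≡ 0 forces M ≡ 0, and then (1, 1) is a root as well.
        affine-root : ∀ u v → ¬ ((+ q ∣ u) × (+ q ∣ v)) → + q ∣ form M B u v → ∃[ n ] + q ∣ φ n
        affine-root u v coprime q∣form = by-cases (+ q ∣? v)
          where
          by-cases : Dec (+ q ∣ v) → ∃[ n ] + q ∣ φ n
          by-cases (no q∤v) = let w , vw≡1 = inverse q∤v in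
            u * w , mod-∣ (mod-trans (mod-reflexive (scale M B u v w)) (form-cong M B (mod-refl {a = u * w}) vw≡1))
                      (∣n⇒∣m*n (w * w * w) q∣form)
            where
            scale : ∀ M B u v w → w * w * w * form M B u v ≡ form M B (u * w) (v * w)
            scale = solve 5 (λ M B u v w →
              let F = λ u v → M :* (u :* u :* u) :+ B :* (u :* u :* v)
                    :+ :- (con (+ 3) :* M :+ B) :* (u :* v :* v) :+ M :* (v :* v :* v)
              in w :* w :* w :* F u v := F (u :* w) (v :* w)) refl
          by-cases (yes q∣v) = 1ℤ , ∣-resp (at-1 M B) (∣m⇒∣-m q∣M)
            where
            q∤u : ¬ + q ∣ u
            q∤u q∣u = coprime (q∣u , q∣v)
            at-0 : ∀ M B u → form M B u 0ℤ ≡ M * (u * u * u)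
            at-0 = solve 3 (λ M B u → M :* (u :* u :* u) :+ B :* (u :* u :* con 0ℤ)
              :+ :- (con (+ 3) :* M :+ B) :* (u :* con 0ℤ :* con 0ℤ) :+ M :* con 0ℤ := M :* (u :* u :* u)) refl
            at-1 : ∀ M B → - M ≡ form M B 1ℤ 1ℤ
            at-1 = solve 2 (λ M B → :- M := M :* con 1ℤ :+ B :* con 1ℤ
              :+ :- (con (+ 3) :* M :+ B) :* con 1ℤ :+ M :* con 1ℤ) refl
            q∣M : + q ∣ M
            q∣M = [ (λ d → d) , (λ d → contradiction d (∤-* (∤-* q∤u q∤u) q∤u)) ]′
              (euclid M (u * u * u) (mod-∣ (mod-trans (form-cong M B (mod-refl {a = u}) (∣⇒≡0 q∣v))
                (mod-reflexive (at-0 M B u))) q∣form))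

    residueForm : ResidueForm p
    residueForm = record
      { M = M
      ; B = B
      ; norm = trans (cong (λ z → 1ℤ + z) (pos-* 3 f)) (trans (cong (λ z → 1ℤ + + 3 * z) f≡b+c+d)
          (sym (trans (PeriodIdentities.norm b c d 0ℤ)
            (trans (cong (λ z → 1ℤ + + 3 * (b + c + d) - + 9 * z) R≡0) (+-identityʳ _)))))
      ; residues = λ q-prime q≢p u v coprime q∣form →
          let n , q∣φ = affine-root q-prime u v coprime q∣form
          in cubic-residue f p-prime q-prime (images q-prime n q∣φ) q≢p
      }

-- Counting the primes that divide a product of polynomial values.

module PrimeDivisors where

  open Congruence using (_≡_[_]; ∣⇒≡; _≡?_[_]; mod-sym; mod-trans)
  open import Data.Bool.Base using (true; false; if_then_else_; _∧_; not)
  open import Data.Integer.Base as ℤ using (+_)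
  open import Data.Integer.Divisibility.Signed using (∣⇒∣ᵤ)
  import Data.Integer.Properties as ℤ
  open import Data.Nat.Base
  open import Data.Nat.Combinatorics using (k![n∸k]!∣n!)
  open import Data.Nat.Divisibility
  open import Data.Nat.ListAction using (product)
  open import Data.Nat.Primality.Factorisation using (PrimeFactorisation; factorise)
  open import Data.Nat.Properties
  open import Data.Nat.Solver using (module +-*-Solver)

  private
    interchange : ∀ a b c d → (a * b) * (c * d) ≡ (a * c) * (b * d)
    interchange = solve 4 (λ a b c d → (a :* b) :* (c :* d) := (a :* c) :* (b :* d)) refl
      where open +-*-Solver

  ^-distribʳ-* : ∀ a b n → (a * b) ^ n ≡ a ^ n * b ^ n
  ^-distribʳ-* a b zero    = refl
  ^-distribʳ-* a b (suc n) =
    trans (cong (a * b *_) (^-distribʳ-* a b n)) (interchange a b (a ^ n) (b ^ n))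

  Π : ℕ → (ℕ → ℕ) → ℕ
  Π zero    h = 1
  Π (suc N) h = Π N h * h (suc N)

  Π-cong : ∀ N {g h} → (∀ n → 1 ≤ n → n ≤ N → g n ≡ h n) → Π N g ≡ Π N h
  Π-cong zero    e = refl
  Π-cong (suc N) e = cong₂ _*_ (Π-cong N (λ n 1≤n n≤N → e n 1≤n (m≤n⇒m≤1+n n≤N)))
    (e (suc N) (s≤s z≤n) ≤-refl)

  Π-mono : ∀ N {g h} → (∀ n → 1 ≤ n → n ≤ N → g n ≤ h n) → Π N g ≤ Π N h
  Π-mono zero    e = ≤-refl
  Π-mono (suc N) e = *-mono-≤ (Π-mono N (λ n 1≤n n≤N → e n 1≤n (m≤n⇒m≤1+n n≤N)))
    (e (suc N) (s≤s z≤n) ≤-refl)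

  Π-∣ : ∀ N {g h} → (∀ n → 1 ≤ n → n ≤ N → g n ∣ h n) → Π N g ∣ Π N h
  Π-∣ zero    e = ∣-refl
  Π-∣ (suc N) e = *-pres-∣ (Π-∣ N (λ n 1≤n n≤N → e n 1≤n (m≤n⇒m≤1+n n≤N)))
    (e (suc N) (s≤s z≤n) ≤-refl)

  Π-* : ∀ N g h → Π N (λ n → g n * h n) ≡ Π N g * Π N h
  Π-* zero    g h = refl
  Π-* (suc N) g h = trans (cong (_* (g (suc N) * h (suc N))) (Π-* N g h))
    (interchange (Π N g) (Π N h) (g (suc N)) (h (suc N)))

  Π-1 : ∀ N → Π N (λ _ → 1) ≡ 1
  Π-1 zero    = refl
  Π-1 (suc N) = trans (*-identityʳ _) (Π-1 N)

  Π-first : ∀ N h → Π (suc N) h ≡ h 1 * Π N (λ n → h (suc n))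
  Π-first zero    h = *-comm 1 (h 1)
  Π-first (suc N) h = trans (cong (_* h (suc (suc N))) (Π-first N h)) (*-assoc (h 1) _ _)

  Π-split : ∀ a b h → Π (a + suc b) h ≡ Π a h * (h (suc a) * Π b (λ i → h (suc a + i)))
  Π-split a zero h rewrite +-comm a 1 = cong (Π a h *_) (sym (*-identityʳ (h (suc a))))
  Π-split a (suc b) h rewrite +-suc a (suc b) = trans
    (cong (_* h (suc (a + suc b))) (Π-split a b h))
    (trans (*-assoc (Π a h) _ _) (cong (Π a h *_) (*-assoc (h (suc a)) _ _)))

  Π-! : ∀ N → Π N (λ n → n) ≡ N !
  Π-! zero    = refl
  Π-! (suc N) = trans (cong (_* suc N) (Π-! N)) (*-comm (N !) (suc N))

  Π-reverse-! : ∀ N → Π N (λ n → suc N ∸ n) ≡ N !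
  Π-reverse-! zero    = refl
  Π-reverse-! (suc N) = trans (Π-first N (λ n → suc (suc N) ∸ n)) (cong (suc N *_) (Π-reverse-! N))

  Π-^ : ∀ N q (e : ℕ → ℕ) → ∃[ s ] Π N (λ n → q ^ e n) ≡ q ^ s
  Π-^ zero    q e = 0 , refl
  Π-^ (suc N) q e = let s , eq = Π-^ N q e in
    s + e (suc N) , trans (cong (_* q ^ e (suc N)) eq) (sym (^-distribˡ-+-* q s (e (suc N))))

  ∏ : List ℕ → (ℕ → ℕ) → ℕ
  ∏ []       h = 1
  ∏ (q ∷ qs) h = h q * ∏ qs h

  ∏-Π-swap : ∀ qs N (h : ℕ → ℕ → ℕ) → Π N (λ n → ∏ qs (h n)) ≡ ∏ qs (λ q → Π N (λ n → h n q))
  ∏-Π-swap []       N h = Π-1 N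
  ∏-Π-swap (q ∷ qs) N h = trans (Π-* N (λ n → h n q) (λ n → ∏ qs (h n)))
    (cong (Π N (λ n → h n q) *_) (∏-Π-swap qs N h))

  ∏-mono : ∀ qs {g h} → All (λ q → g q ≤ h q) qs → ∏ qs g ≤ ∏ qs h
  ∏-mono []       []       = ≤-refl
  ∏-mono (q ∷ qs) (e ∷ es) = *-mono-≤ e (∏-mono qs es)

  ∏-bound : ∀ qs (h : ℕ → ℕ) M d → ∏ qs (λ q → (h q * M) ^ d) ≡ ∏ qs h ^ d * M ^ (d * length qs)
  ∏-bound [] h M d = sym (trans (cong₂ _*_ (^-zeroˡ d) (cong (M ^_) (*-zeroʳ d))) refl)
  ∏-bound (q ∷ qs) h M d = begin
    (h q * M) ^ d * ∏ qs (λ q → (h q * M) ^ d)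
      ≡⟨ cong₂ _*_ (^-distribʳ-* (h q) M d) (∏-bound qs h M d) ⟩
    (h q ^ d * M ^ d) * (∏ qs h ^ d * M ^ (d * length qs))
      ≡⟨ interchange (h q ^ d) (M ^ d) (∏ qs h ^ d) (M ^ (d * length qs)) ⟩
    (h q ^ d * ∏ qs h ^ d) * (M ^ d * M ^ (d * length qs))
      ≡⟨ cong₂ _*_ (^-distribʳ-* (h q) (∏ qs h) d)
           (trans (cong (M ^_) (*-suc d (length qs))) (^-distribˡ-+-* M d (d * length qs))) ⟨
    (h q * ∏ qs h) ^ d * M ^ (d * suc (length qs)) ∎
    where open ≡-Reasoning

  -- Each division by a prime q makes a nonzero h strictly smaller, so h itself is enough fuel for
  -- the valuation.
  v-fuel : ℕ → ℕ → ℕ → ℕ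
  v-fuel zero    q h = 0
  v-fuel (suc n) q h with q ∣? h
  ... | yes (divides r _) = suc (v-fuel n q r)
  ... | no _              = 0

  v : ℕ → ℕ → ℕ
  v q h = v-fuel h q h

  part : ℕ → ℕ → ℕ
  part q h = q ^ v q h

  module _ {q} (q-prime : Prime q) where

    private
      instance
        _ = prime⇒nonZero q-prime
        _ = prime⇒nonTrivial q-prime

    1<q : 1 < q
    1<q = nonTrivial⇒n>1 q

    ^∣⇒≤ : ∀ {i j} → q ^ i ∣ q ^ j → i ≤ j
    ^∣⇒≤ {i} {j} d = ≮⇒≥ λ j<i → <⇒≱ (^-monoʳ-< q 1<q j<i) (∣⇒≤ {{m^n≢0 q j}} d)

    ^-mono-∣ : ∀ {i j} → i ≤ j → q ^ i ∣ q ^ j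
    ^-mono-∣ {i} {j} i≤j = divides (q ^ (j ∸ i))
      (trans (cong (q ^_) (sym (m∸n+n≡m i≤j))) (^-distribˡ-+-* q (j ∸ i) i))

    v-split : ∀ h .{{_ : NonZero h}} → ∃[ r ] (h ≡ part q h * r × ¬ q ∣ r)
    v-split h = go h h ≤-refl
      where
      go : ∀ n h .{{_ : NonZero h}} → h ≤ n → ∃[ r ] (h ≡ q ^ v-fuel n q h * r × ¬ q ∣ r)
      go zero    (suc _) ()
      go (suc n) h h≤n with q ∣? h
      ... | no q∤h = h , sym (*-identityˡ h) , q∤h
      ... | yes (divides r refl) =
        let instance r≢0 = m*n≢0⇒m≢0 r {q}
            s , eq , q∤s = go n r (≤-pred (<-≤-trans (m<m*n r q 1<q) h≤n))
        in s , trans (*-comm r q) (trans (cong (q *_) eq) (sym (*-assoc q _ s))) , q∤s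

    part∣ : ∀ h .{{_ : NonZero h}} → part q h ∣ h
    part∣ h = let r , h≡ , _ = v-split h in divides r (trans h≡ (*-comm (part q h) r))

    ^∣-cancel : ∀ k {x y} → ¬ q ∣ x → q ^ k ∣ x * y → q ^ k ∣ y
    ^∣-cancel zero    {x} {y} _   _ = 1∣ y
    ^∣-cancel (suc k) {x} {y} q∤x d = next (^∣-cancel k q∤x (m*n∣⇒n∣ q (q ^ k) d))
      where
      next : q ^ k ∣ y → q * q ^ k ∣ y
      next (divides m refl) = [ (λ q∣x → contradiction q∣x q∤x) , (λ q∣m → *-monoˡ-∣ (q ^ k) q∣m) ]′
        (euclidsLemma x m q-prime (*-cancelʳ-∣ (q ^ k) {{m^n≢0 q k}}
          (subst (q * q ^ k ∣_) (sym (*-assoc x m (q ^ k))) d)))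

    ^∣⇒≤v : ∀ {j} h .{{_ : NonZero h}} → q ^ j ∣ h → j ≤ v q h
    ^∣⇒≤v {j} h d = let r , h≡ , q∤r = v-split h in
      ^∣⇒≤ (^∣-cancel j q∤r (subst (q ^ j ∣_) (trans h≡ (*-comm (part q h) r)) d))

    0<v⇒∣ : ∀ h .{{_ : NonZero h}} → 0 < v q h → q ∣ h
    0<v⇒∣ h 0<v = ∣-trans (subst (_∣ part q h) (^-identityʳ q) (^-mono-∣ 0<v)) (part∣ h)

  prime∣^⇒≡ : ∀ {q r} → Prime q → Prime r → ∀ k → q ∣ r ^ k → q ≡ r
  prime∣^⇒≡ q-prime r-prime zero q∣1 with refl ← ∣1⇒≡1 q∣1 = contradiction q-prime ¬prime[1]
  prime∣^⇒≡ {r = r} q-prime r-prime (suc k) d with euclidsLemma r (r ^ k) q-prime d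
  ... | inj₂ e = prime∣^⇒≡ q-prime r-prime k e
  ... | inj₁ e with prime⇒irreducible r-prime e
  ...   | inj₁ refl = contradiction q-prime ¬prime[1]
  ...   | inj₂ q≡r  = q≡r

  ∏-part-∣ : ∀ qs → Unique qs → All Prime qs → ∀ h .{{_ : NonZero h}} → ∏ qs (λ q → part q h) ∣ h
  ∏-part-∣ [] _ _ h = 1∣ h
  ∏-part-∣ (q ∷ qs) (q∉qs ∷ unique) (q-prime ∷ primes) h = combine (∏-part-∣ qs unique primes h)
    where
    q∤∏ : ∀ rs → All (q ≢_) rs → All Prime rs → ¬ q ∣ ∏ rs (λ r → part r h)
    q∤∏ [] _ _ q∣1 with refl ← ∣1⇒≡1 q∣1 = ¬prime[1] q-prime
    q∤∏ (r ∷ rs) (q≢r ∷ q≢rs) (r-prime ∷ rs-prime) d =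
      [ (λ e → q≢r (prime∣^⇒≡ q-prime r-prime (v r h) e)) , q∤∏ rs q≢rs rs-prime ]′
        (euclidsLemma (part r h) (∏ rs (λ r → part r h)) q-prime d)
    combine : ∏ qs (λ q → part q h) ∣ h → part q h * ∏ qs (λ q → part q h) ∣ h
    combine (divides m h≡) = subst (part q h * rest ∣_) (sym h≡)
      (*-monoˡ-∣ rest (^∣-cancel q-prime (v q h) (q∤∏ qs q∉qs primes)
        (subst (part q h ∣_) (trans h≡ (*-comm m rest)) (part∣ q-prime h))))
      where rest = ∏ qs (λ q → part q h)

  prime-divisor : ∀ h → 1 < h → ∃[ r ] (Prime r × r ∣ h)
  prime-divisor h 1<h = from-factors (factorise h {{>-nonZero (<-trans z<s 1<h)}})
    where
    from-factors : PrimeFactorisation h → ∃[ r ] (Prime r × r ∣ h)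
    from-factors record { factors = [] ; isFactorisation = refl } = contradiction 1<h λ { (s≤s ()) }
    from-factors record { factors = r ∷ rs ; isFactorisation = refl ; factorsPrime = r-prime ∷ _ } =
      r , r-prime , m∣m*n (product rs)

  ∏-mono-∣ : ∀ qs {g h} → All (λ q → g q ∣ h q) qs → ∏ qs g ∣ ∏ qs h
  ∏-mono-∣ []       []       = ∣-refl
  ∏-mono-∣ (q ∷ qs) (e ∷ es) = *-pres-∣ e (∏-mono-∣ qs es)

  ∣-∏-part : ∀ qs → All Prime qs → ∀ h .{{_ : NonZero h}} →
    (∀ {r} → Prime r → r ∣ h → r ∈ qs) → h ∣ ∏ qs (λ q → part q h)
  ∣-∏-part [] _ h@(suc zero)    _       = ∣-refl
  ∣-∏-part [] _ h@(suc (suc _)) factors with _ , r-prime , r∣h ← prime-divisor h (s≤s (s≤s z≤n))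
    with () ← factors r-prime r∣h
  ∣-∏-part (q ∷ qs) (q-prime ∷ primes) h factors = from-split (v-split q-prime h)
    where
    from-split : ∃[ s ] (h ≡ part q h * s × ¬ q ∣ s) → h ∣ part q h * ∏ qs (λ q → part q h)
    from-split (s , h≡ , q∤s) = subst (_∣ part q h * ∏ qs (λ q → part q h)) (sym h≡)
      (*-monoʳ-∣ (part q h) (∣-trans (∣-∏-part qs primes s factors′) (∏-mono-∣ qs (All.map part-∣ primes))))
      where
      s∣h : s ∣ h
      s∣h = divides (part q h) h≡
      instance s≢0 = ≢-nonZero λ { refl → ≢-nonZero⁻¹ h (0∣⇒≡0 s∣h) }
      factors′ : ∀ {r} → Prime r → r ∣ s → r ∈ qs
      factors′ r-prime r∣s with factors r-prime (∣-trans r∣s s∣h)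
      ... | here refl = contradiction r∣s q∤s
      ... | there r∈ = r∈
      part-∣ : ∀ {r} → Prime r → part r s ∣ part r h
      part-∣ {r} r-prime = ^-mono-∣ r-prime {v r s} {v r h} (^∣⇒≤v r-prime {v r s} h (∣-trans (part∣ r-prime s) s∣h))

  argmax : ∀ N (e : ℕ → ℕ) → ∃[ a ] (a ≤ N × (∀ n → 1 ≤ n → n ≤ suc N → e n ≤ e (suc a)))
  argmax zero    e = 0 , z≤n , λ { (suc zero) _ _ → ≤-refl ; (suc (suc n)) _ (s≤s ()) }
  argmax (suc N) e = choose (argmax N e) (≤-total (e (suc (suc N))) (e (suc a₀)))
    where
    a₀ = proj₁ (argmax N e)
    extend : ∀ {b} → (∀ n → 1 ≤ n → n ≤ suc N → e n ≤ b) → e (suc (suc N)) ≤ b →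
      ∀ n → 1 ≤ n → n ≤ suc (suc N) → e n ≤ b
    extend below top n 1≤n n≤ with m≤n⇒m<n∨m≡n n≤
    ... | inj₁ n< = below n 1≤n (≤-pred n<)
    ... | inj₂ refl = top
    choose : ∃[ a ] (a ≤ N × (∀ n → 1 ≤ n → n ≤ suc N → e n ≤ e (suc a))) →
      e (suc (suc N)) ≤ e (suc a₀) ⊎ e (suc a₀) ≤ e (suc (suc N)) →
      ∃[ a ] (a ≤ suc N × (∀ n → 1 ≤ n → n ≤ suc (suc N) → e n ≤ e (suc a)))
    choose _ (inj₁ top≤) = let _ , a≤N , max = argmax N e in
      a₀ , m≤n⇒m≤1+n a≤N , extend max top≤
    choose _ (inj₂ ≤top) = let _ , _ , max = argmax N e in
      suc N , ≤-refl , extend (λ n 1≤n n≤ → ≤-trans (max n 1≤n n≤) ≤top) ≤-refl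

  module _ {q} (q-prime : Prime q) where

    private instance
      _ = prime⇒nonZero q-prime

    -- All factors but one of largest exponent, at n₀ say, divide the differences
    -- n₀ - n, whose product (n₀ - 1)! (N - n₀)! divides N!.
    class-bound : ∀ N M (e : ℕ → ℕ) →
      (∀ {m n} → 1 ≤ m → n ≤ N → m < n → q ^ (e m ⊓ e n) ∣ n ∸ m) →
      1 ≤ M → (∀ n → 1 ≤ n → n ≤ N → q ^ e n ≤ M) →
      Π N (λ n → q ^ e n) ≤ part q (N !) * M
    class-bound zero M e _ 1≤M _ = *-mono-≤ (m^n>0 q (v q 1)) 1≤M
    class-bound (suc N′) M e close 1≤M small = let a , a≤N′ , max = argmax N′ e in
      at-max a (N′ ∸ a) (m+[n∸m]≡n a≤N′) max
      where
      instance _ = suc N′ !≢0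
      at-max : ∀ a b → a + b ≡ N′ → (∀ n → 1 ≤ n → n ≤ suc N′ → e n ≤ e (suc a)) →
        Π (suc N′) (λ n → q ^ e n) ≤ part q (suc N′ !) * M
      at-max a b refl max = begin
        Π (suc N′) h                                 ≡⟨ cong (λ N → Π N h) (+-suc a b) ⟨
        Π (a + suc b) h                              ≡⟨ Π-split a b h ⟩
        Π a h * (h (suc a) * Π b (λ i → h (suc a + i))) ≡⟨ regroup (Π a h) (h (suc a)) _ ⟩
        Π a h * Π b (λ i → h (suc a + i)) * h (suc a) ≤⟨ *-mono-≤ others (small (suc a) (s≤s z≤n) (s≤s (m≤m+n a b))) ⟩
        part q (suc N′ !) * M                        ∎
        where
        open ≤-Reasoning
        open +-*-Solver
        h : ℕ → ℕ
        h n = q ^ e n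
        regroup : ∀ x y z → x * (y * z) ≡ x * z * y
        regroup = solve 3 (λ x y z → x :* (y :* z) := x :* z :* y) refl
        left : Π a h ∣ a !
        left = subst (Π a h ∣_) (Π-reverse-! a) (Π-∣ a λ n 1≤n n≤a →
          subst (λ k → q ^ k ∣ suc a ∸ n) (m≤n⇒m⊓n≡m (max n 1≤n (m≤n⇒m≤1+n (≤-trans n≤a (m≤m+n a b)))))
            (close 1≤n (s≤s (m≤m+n a b)) (s≤s n≤a)))
        right : Π b (λ i → h (suc a + i)) ∣ b !
        right = subst (Π b (λ i → h (suc a + i)) ∣_) (Π-! b) (Π-∣ b λ i 1≤i i≤b →
          subst (λ d → h (suc a + i) ∣ d) (m+n∸m≡n (suc a) i)
            (subst (λ k → q ^ k ∣ suc a + i ∸ suc a)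
              (m≥n⇒m⊓n≡n (max (suc a + i) (s≤s z≤n) (s≤s (+-monoʳ-≤ a i≤b))))
              (close (s≤s z≤n) (s≤s (+-monoʳ-≤ a i≤b)) (m<m+n (suc a) 1≤i))))
        a!b!∣N! : a ! * b ! ∣ suc N′ !
        a!b!∣N! = ∣-trans (subst (λ c → a ! * c ! ∣ (a + b) !) (m+n∸m≡n a b) (k![n∸k]!∣n! (m≤m+n a b)))
          (n∣m*n (suc N′))
        others : Π a h * Π b (λ i → h (suc a + i)) ≤ part q (suc N′ !)
        others with Π-^ a q e | Π-^ b q (λ i → e (suc a + i))
        ... | s , eq | t , eq′ = begin
          Π a h * Π b (λ i → h (suc a + i)) ≡⟨ product≡ ⟩
          q ^ (s + t) ≤⟨ ^-monoʳ-≤ q (^∣⇒≤v q-prime {s + t} (suc N′ !)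
            (subst (_∣ suc N′ !) product≡ (∣-trans (*-pres-∣ left right) a!b!∣N!))) ⟩
          part q (suc N′ !) ∎
          where
          product≡ : Π a h * Π b (λ i → h (suc a + i)) ≡ q ^ (s + t)
          product≡ = trans (cong₂ _*_ eq eq′) (sym (^-distribˡ-+-* q s t))

  -- What bounds the power of q in the product of the values: the roots modulo q fill at most `d`
  -- residue classes, and within such a class a power of q common to two values divides the
  -- difference of their arguments, as happens at simple roots.
  record Separated (g : ℕ → ℕ) (N d q : ℕ) : Set where
    field
      roots   : ∀ zs → AllPairs (λ m n → ¬ + n ≡ + m [ + q ]) zs →
                All (λ n → 1 ≤ n × n ≤ N × q ∣ g n) zs → length zs ≤ d
      lifting : ∀ {m n} k → 1 ≤ m → n ≤ N → m < n → q ∣ g m → + n ≡ + m [ + q ] →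
                q ^ k ∣ g m → q ^ k ∣ g n → + n ≡ + m [ + (q ^ k) ]

  mod⇒∣∸ : ∀ {m n q} → m ≤ n → + n ≡ + m [ + q ] → q ∣ n ∸ m
  mod⇒∣∸ {m} {n} {q} m≤n (∣⇒≡ d) = subst (λ z → q ∣ ℤ.∣ z ∣)
    (trans (ℤ.[+m]-[+n]≡m⊖n n m) (ℤ.⊖-≥ m≤n)) (∣⇒∣ᵤ d)

  module _ {g : ℕ → ℕ} {N M d q} (q-prime : Prime q) (separated : Separated g N d q)
           (positive : ∀ n → 1 ≤ n → n ≤ N → NonZero (g n))
           (bounded : ∀ n → 1 ≤ n → n ≤ N → g n ≤ M) (1≤M : 1 ≤ M) where

    open Separated separated

    private
      instance
        _ = prime⇒nonZero q-prime
        _ = N !≢0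

      -- The valuation is set to zero outside `P` instead of restricting the index set, so every
      -- partial product still runs over 1, ..., N.
      exponent : ∀ {P : ℕ → Set} → Decidable P → ℕ → ℕ
      exponent P? n = if does (P? n) then v q (g n) else 0

      base : ℕ
      base = part q (N !) * M

      1≤base : 1 ≤ base
      1≤base = *-mono-≤ (m^n>0 q (v q (N !))) 1≤M

      exponent≤v : ∀ {P : ℕ → Set} (P? : Decidable P) n → exponent P? n ≤ v q (g n)
      exponent≤v P? n with P? n
      ... | yes _ = ≤-refl
      ... | no _  = z≤n

      ^exponent∣ : ∀ {P : ℕ → Set} (P? : Decidable P) n → 1 ≤ n → n ≤ N → q ^ exponent P? n ∣ g n
      ^exponent∣ P? n 1≤n n≤N = ∣-trans (^-mono-∣ q-prime (exponent≤v P? n)) (part∣ q-prime (g n))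
        where instance _ = positive n 1≤n n≤N

      0<exponent : ∀ {P : ℕ → Set} (P? : Decidable P) n → 1 ≤ n → n ≤ N →
        0 < exponent P? n → P n × q ∣ g n
      0<exponent P? n 1≤n n≤N 0<e with P? n
      ... | yes Pn = Pn , 0<v⇒∣ q-prime (g n) {{positive n 1≤n n≤N}} 0<e
      ... | no _ with () ← 0<e

      one-class : ∀ {P : ℕ → Set} (P? : Decidable P) →
        (∀ {m n} → 1 ≤ m → n ≤ N → m < n → P m → P n → + n ≡ + m [ + q ]) →
        Π N (λ n → q ^ exponent P? n) ≤ base
      one-class {P} P? congruent = class-bound q-prime N M (exponent P?) close 1≤M λ n 1≤n n≤N →
        ≤-trans (∣⇒≤ {{positive n 1≤n n≤N}} (^exponent∣ P? n 1≤n n≤N)) (bounded n 1≤n n≤N)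
        where
        close : ∀ {m n} → 1 ≤ m → n ≤ N → m < n → q ^ (exponent P? m ⊓ exponent P? n) ∣ n ∸ m
        close {m} {n} 1≤m n≤N m<n = by-cases (exponent P? m) (exponent P? n) refl refl
          where
          1≤n = ≤-trans 1≤m (<⇒≤ m<n)
          m≤N = ≤-trans (<⇒≤ m<n) n≤N
          by-cases : ∀ i j → exponent P? m ≡ i → exponent P? n ≡ j → q ^ (i ⊓ j) ∣ n ∸ m
          by-cases zero    j       _  _  = 1∣ (n ∸ m)
          by-cases (suc i) zero    _  _  = 1∣ (n ∸ m)
          by-cases (suc i) (suc j) eᵢ eⱼ =
            let Pm , q∣gm = 0<exponent P? m 1≤m m≤N (subst (0 <_) (sym eᵢ) z<s)
                Pn , _    = 0<exponent P? n 1≤n n≤N (subst (0 <_) (sym eⱼ) z<s)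
            in mod⇒∣∸ (<⇒≤ m<n) (lifting (suc i ⊓ suc j) 1≤m n≤N m<n q∣gm (congruent 1≤m n≤N m<n Pm Pn)
                 (∣-trans (^-mono-∣ q-prime (m⊓n≤m (suc i) (suc j)))
                   (subst (λ e → q ^ e ∣ g m) eᵢ (^exponent∣ P? m 1≤m m≤N)))
                 (∣-trans (^-mono-∣ q-prime (m⊓n≤n (suc i) (suc j)))
                   (subst (λ e → q ^ e ∣ g n) eⱼ (^exponent∣ P? n 1≤n n≤N))))

      Incongruent : ℕ → ℕ → Set
      Incongruent m n = ¬ + n ≡ + m [ + q ]

      -- Induction on `d`. If some value with index in `P` is divisible by q, the residue class of
      -- that index is split off and bounded by `one-class`; putting this index in front of any list
      -- of incongruent roots outside the class shows that at most d - 1 classes remain.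
      classes : ∀ d {P : ℕ → Set} (P? : Decidable P) →
        (∀ zs → AllPairs Incongruent zs → All (λ n → P n × 1 ≤ n × n ≤ N × q ∣ g n) zs → length zs ≤ d) →
        Π N (λ n → q ^ exponent P? n) ≤ base ^ d
      classes d {P} P? few = search d few (anyUpTo? (λ n → P? (suc n) ×-dec (q ∣? g (suc n))) N)
        where
        search : ∀ d →
          (∀ zs → AllPairs Incongruent zs → All (λ n → P n × 1 ≤ n × n ≤ N × q ∣ g n) zs → length zs ≤ d) →
          Dec (∃[ n ] (n < N × P (suc n) × q ∣ g (suc n))) → Π N (λ n → q ^ exponent P? n) ≤ base ^ d
        search d few (no none) = ≤-trans (≤-reflexive (trans (Π-cong N trivial) (Π-1 N)))
          (m^n>0 base {{>-nonZero 1≤base}} d)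
          where
          trivial : ∀ n → 1 ≤ n → n ≤ N → q ^ exponent P? n ≡ 1
          trivial (suc n) 1≤n n<N = cong (q ^_) (n≤0⇒n≡0 (≮⇒≥ λ 0<e →
            none (n , n<N , 0<exponent P? (suc n) 1≤n n<N 0<e)))
        search zero few (yes (n , n<N , Pn , q∣gn))
          with () ← few (suc n ∷ []) ([] ∷ []) ((Pn , s≤s z≤n , n<N , q∣gn) ∷ [])
        search (suc d) few (yes (n , n<N , Pn , q∣gn)) = begin
          Π N (λ m → q ^ exponent P? m) ≡⟨ Π-cong N (λ m _ _ → split m) ⟩
          Π N (λ m → q ^ exponent same? m * q ^ exponent other? m)
            ≡⟨ Π-* N (λ m → q ^ exponent same? m) (λ m → q ^ exponent other? m) ⟩
          Π N (λ m → q ^ exponent same? m) * Π N (λ m → q ^ exponent other? m)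
            ≤⟨ *-mono-≤ (one-class same? same-congruent) (classes d other? few-others) ⟩
          base * base ^ d ∎
          where
          open ≤-Reasoning
          near? : Decidable (λ m → + m ≡ + suc n [ + q ])
          near? m = + m ≡? + suc n [ + q ]
          same? : Decidable (λ m → P m × + m ≡ + suc n [ + q ])
          same? m = P? m ×-dec near? m
          other? : Decidable (λ m → P m × ¬ + m ≡ + suc n [ + q ])
          other? m = P? m ×-dec ¬? (near? m)
          split : ∀ m → q ^ exponent P? m ≡ q ^ exponent same? m * q ^ exponent other? m
          split m = by-cases (does (P? m)) (does (near? m)) (v q (g m))
            where
            by-cases : ∀ x y e → q ^ (if x then e else 0) ≡
              q ^ (if x ∧ y then e else 0) * q ^ (if x ∧ not y then e else 0)
            by-cases false _     e = refl
            by-cases true  true  e = sym (*-identityʳ (q ^ e))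
            by-cases true  false e = sym (*-identityˡ (q ^ e))
          same-congruent : ∀ {l m} → 1 ≤ l → m ≤ N → l < m →
            P l × + l ≡ + suc n [ + q ] → P m × + m ≡ + suc n [ + q ] → + m ≡ + l [ + q ]
          same-congruent _ _ _ (_ , l≡n) (_ , m≡n) = mod-trans m≡n (mod-sym l≡n)
          few-others : ∀ zs → AllPairs Incongruent zs →
            All (λ m → (P m × ¬ + m ≡ + suc n [ + q ]) × 1 ≤ m × m ≤ N × q ∣ g m) zs → length zs ≤ d
          few-others zs incongruent members = ≤-pred (few (suc n ∷ zs)
            (All.map (λ ((_ , far) , _) → far) members ∷ incongruent)
            ((Pn , s≤s z≤n , n<N , q∣gn) ∷ All.map (λ ((Pm , _) , rest) → Pm , rest) members))

    part-bound : Π N (λ n → part q (g n)) ≤ base ^ d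
    -- The predicate `q ≡ q` is merely one that always holds.
    part-bound = classes d {P = λ _ → q ≡ q} (λ _ → yes refl) λ zs incongruent members →
      roots zs incongruent (All.map proj₂ members)

  -- The product of the values is at least W^N (N!)^d. From above, each prime of `Q` contributes at
  -- most (part q (N!) · M)^d, and the parts of N! multiply to at most N!. The factor (N!)^d
  -- cancels, leaving a bound on `length Q` alone.
  count-primes : ∀ {g N M W d} Q → Unique Q → All Prime Q → All (Separated g N d) Q →
    1 ≤ W → (∀ n → 1 ≤ n → n ≤ N → W * n ^ d ≤ g n) → 1 ≤ M → (∀ n → 1 ≤ n → n ≤ N → g n ≤ M) →
    (∀ n → 1 ≤ n → n ≤ N → ∀ {r} → Prime r → r ∣ g n → r ∈ Q) →
    W ^ N ≤ M ^ (d * length Q)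
  count-primes {g} {N} {M} {W} {d} Q unique primes separated 1≤W below 1≤M bounded covered =
    *-cancelˡ-≤ ((N !) ^ d) {{m^n≢0 (N !) d}} (begin
      (N !) ^ d * W ^ N ≡⟨ *-comm ((N !) ^ d) (W ^ N) ⟩
      W ^ N * (N !) ^ d ≡⟨ Π-W N ⟨
      Π N (λ n → W * n ^ d) ≤⟨ Π-mono N below ⟩
      Π N g ≤⟨ Π-mono N (λ n 1≤n n≤N → ∣⇒≤ {{∏-parts≢0 n}} (∣-∏-part Q primes (g n) {{positive n 1≤n n≤N}} (covered n 1≤n n≤N))) ⟩
      Π N (λ n → ∏ Q (λ q → part q (g n))) ≡⟨ ∏-Π-swap Q N (λ n q → part q (g n)) ⟩
      ∏ Q (λ q → Π N (λ n → part q (g n)))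
        ≤⟨ ∏-mono Q (All.zipWith (λ (q-prime , sep) → part-bound q-prime sep positive bounded 1≤M) (primes , separated)) ⟩
      ∏ Q (λ q → (part q (N !) * M) ^ d) ≡⟨ ∏-bound Q (λ q → part q (N !)) M d ⟩
      ∏ Q (λ q → part q (N !)) ^ d * M ^ (d * length Q)
        ≤⟨ *-monoˡ-≤ (M ^ (d * length Q)) (^-monoˡ-≤ d (∣⇒≤ (∏-part-∣ Q unique primes (N !)))) ⟩
      (N !) ^ d * M ^ (d * length Q) ∎)
    where
    open ≤-Reasoning
    instance _ = N !≢0
    positive : ∀ n → 1 ≤ n → n ≤ N → NonZero (g n)
    positive n 1≤n n≤N = >-nonZero (≤-trans
      (*-mono-≤ 1≤W (m^n>0 n {{>-nonZero 1≤n}} d)) (below n 1≤n n≤N))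
    ∏-parts≢0 : ∀ n → NonZero (∏ Q (λ q → part q (g n)))
    ∏-parts≢0 n = nonzero Q primes
      where
      nonzero : ∀ qs → All Prime qs → NonZero (∏ qs (λ q → part q (g n)))
      nonzero []       []         = _
      nonzero (q ∷ qs) (pr ∷ prs) = m*n≢0 (part q (g n)) _ {{m^n≢0 q (v q (g n)) {{prime⇒nonZero pr}}}} {{nonzero qs prs}}
    Π-W : ∀ N → Π N (λ n → W * n ^ d) ≡ W ^ N * (N !) ^ d
    Π-W zero    = sym (trans (+-identityʳ _) (^-zeroˡ d))
    Π-W (suc N) = trans (cong (_* (W * suc N ^ d)) (Π-W N)) (trans
      (lemma (W ^ N) ((N !) ^ d) W (suc N ^ d))
      (cong (W * W ^ N *_) (sym (^-distribʳ-* (suc N) (N !) d))))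
      where
      open +-*-Solver
      lemma : ∀ a b c d → (a * b) * (c * d) ≡ (c * a) * (d * b)
      lemma = solve 4 (λ a b c d → (a :* b) :* (c :* d) := (c :* a) :* (d :* b)) refl

-- Separating large prime divisors from the few small ones.

module Collect where

  open PrimeDivisors
  open import Data.List.Base using (List; []; _∷_; length; filter; upTo; applyUpTo; _++_; map)
  open import Data.List.Membership.Propositional.Properties
    using (∈-filter⁺; ∈-upTo⁺; ∈-applyUpTo⁺; ∈-∃++; ∈-++⁻; ∈-++⁺ˡ; ∈-++⁺ʳ)
  open import Data.Nat.Base
  open import Data.Nat.DivMod using (_%_; _/_; m≡m%n+[m/n]*n; m%n<n; m/n*n≤m; m*n/n≡m; /-monoˡ-≤)
  open import Data.Nat.Divisibility
  open import Data.Nat.Properties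
  open import Data.Nat.Solver using (module +-*-Solver)

  unique-⊆⇒length≤ : ∀ {A : Set} {xs ys : List A} → Unique xs → (∀ {x} → x ∈ xs → x ∈ ys) →
    length xs ≤ length ys
  unique-⊆⇒length≤ {xs = []} _ _ = z≤n
  unique-⊆⇒length≤ {xs = x ∷ xs} {ys} (x∉xs ∷ unique) xs⊆ys
    with as , bs , refl ← ∈-∃++ (xs⊆ys (here refl)) = begin
    suc (length xs)               ≤⟨ s≤s (unique-⊆⇒length≤ unique xs⊆as++bs) ⟩
    suc (length (as ++ bs))       ≡⟨ cong suc (List.length-++ as) ⟩
    suc (length as + length bs)   ≡⟨ +-suc (length as) (length bs) ⟨
    length as + suc (length bs)   ≡⟨ List.length-++ as ⟨
    length (as ++ x ∷ bs)         ∎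
    where
    open ≤-Reasoning
    xs⊆as++bs : ∀ {y} → y ∈ xs → y ∈ as ++ bs
    xs⊆as++bs {y} y∈xs with ∈-++⁻ as (xs⊆ys (there y∈xs))
    ... | inj₁ y∈as         = ∈-++⁺ˡ y∈as
    ... | inj₂ (here refl)  = contradiction refl (All.lookup x∉xs y∈xs)
    ... | inj₂ (there y∈bs) = ∈-++⁺ʳ as y∈bs

  length-filter-¬ : ∀ {A : Set} {P : A → Set} (P? : Decidable P) xs →
    length xs ≡ length (filter P? xs) + length (filter (λ x → ¬? (P? x)) xs)
  length-filter-¬ P? [] = refl
  length-filter-¬ P? (x ∷ xs) with P? x
  ... | yes _ = cong suc (length-filter-¬ P? xs)
  ... | no _  = trans (cong suc (length-filter-¬ P? xs)) (sym (+-suc _ _))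

  prime-mod-6 : ∀ {q} → Prime q →
    q ≡ 2 ⊎ q ≡ 3 ⊎ ∃[ k ] (q ≡ 5 + 6 * k ⊎ q ≡ 7 + 6 * k)
  prime-mod-6 {q} q-prime = by-remainder (q % 6) (q / 6) (m%n<n q 6) (m≡m%n+[m/n]*n q 6)
    where
    divisor : ∀ d e → d ∣ q → d ≡ suc (suc e) → q ≡ d
    divisor d e d∣q refl with prime⇒irreducible q-prime d∣q
    ... | inj₂ d≡q = sym d≡q
    by-remainder : ∀ r k → r < 6 → q ≡ r + k * 6 →
      q ≡ 2 ⊎ q ≡ 3 ⊎ ∃[ k ] (q ≡ 5 + 6 * k ⊎ q ≡ 7 + 6 * k)
    by-remainder 0 k _ eq = inj₁ (divisor 2 0 (subst (2 ∣_) (sym eq) (∣n⇒∣m*n k (divides 3 refl))) refl)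
    by-remainder 1 zero _ refl = contradiction q-prime ¬prime[1]
    by-remainder 1 (suc k) _ eq = inj₂ (inj₂ (k , inj₂ (trans eq (cong (7 +_) (*-comm k 6)))))
    by-remainder 2 k _ eq = inj₁ (divisor 2 0
      (subst (2 ∣_) (sym eq) (∣m∣n⇒∣m+n {m = 2} (divides 1 refl) (∣n⇒∣m*n k (divides 3 refl)))) refl)
    by-remainder 3 k _ eq = inj₂ (inj₁ (divisor 3 1
      (subst (3 ∣_) (sym eq) (∣m∣n⇒∣m+n {m = 3} (divides 1 refl) (∣n⇒∣m*n k (divides 2 refl)))) refl))
    by-remainder 4 k _ eq = inj₁ (divisor 2 0
      (subst (2 ∣_) (sym eq) (∣m∣n⇒∣m+n {m = 4} (divides 2 refl) (∣n⇒∣m*n k (divides 3 refl)))) refl)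
    by-remainder 5 k _ eq = inj₂ (inj₂ (k , inj₁ (trans eq (cong (5 +_) (*-comm k 6)))))
    by-remainder (suc (suc (suc (suc (suc (suc r)))))) k (s≤s (s≤s (s≤s (s≤s (s≤s (s≤s ())))))) _

  -- Apart from p, 2 and 3, all lie among the numbers ±1 modulo 6, giving at most 3 + 2k candidates
  -- with 6k ≤ m + 1. The candidates need not be prime.
  few-small-primes : ∀ p m {qs} → Unique qs → All (λ q → Prime q × (q ≡ p ⊎ q ≤ m)) qs →
    3 * length qs ≤ m + 10
  few-small-primes p m {qs} unique small = begin
    3 * length qs ≤⟨ *-monoʳ-≤ 3 (unique-⊆⇒length≤ unique (λ q∈ → candidate (All.lookup small q∈))) ⟩
    3 * length candidates ≡⟨ cong (λ l → 3 * (3 + l)) (trans (List.length-++ (applyUpTo (λ i → 5 + 6 * i) k))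
      (cong₂ _+_ (List.length-applyUpTo (λ i → 5 + 6 * i) k) (List.length-applyUpTo (λ i → 7 + 6 * i) k))) ⟩
    3 * (3 + (k + k))     ≡⟨ lemma k ⟩
    9 + k * 6             ≤⟨ +-monoʳ-≤ 9 (m/n*n≤m (suc m) 6) ⟩
    9 + suc m             ≡⟨ trans (+-comm 9 (suc m)) (sym (+-suc m 9)) ⟩
    m + 10                ∎
    where
    open ≤-Reasoning
    -- The condition 5 + 6i ≤ m says exactly 6(i + 1) ≤ m + 1; it also follows from 7 + 6i ≤ m.
    k = suc m / 6
    candidates = p ∷ 2 ∷ 3 ∷ applyUpTo (λ i → 5 + 6 * i) k ++ applyUpTo (λ i → 7 + 6 * i) k
    lemma : ∀ k → 3 * (3 + (k + k)) ≡ 9 + k * 6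
    lemma = solve 1 (λ k → con 3 :* (con 3 :+ (k :+ k)) := con 9 :+ k :* con 6) refl
      where open +-*-Solver
    in-range : ∀ {i} → 5 + 6 * i ≤ m → i < k
    in-range {i} h = subst (_≤ k) (m*n/n≡m (suc i) 6) (/-monoˡ-≤ 6
      (s≤s (subst (λ z → 5 + z ≤ m) (*-comm 6 i) h)))
    candidate : ∀ {q} → Prime q × (q ≡ p ⊎ q ≤ m) → q ∈ candidates
    candidate (_ , inj₁ refl) = here refl
    candidate (q-prime , inj₂ q≤m) with prime-mod-6 q-prime
    ... | inj₁ refl = there (here refl)
    ... | inj₂ (inj₁ refl) = there (there (here refl))
    ... | inj₂ (inj₂ (i , inj₁ refl)) = there (there (there (∈-++⁺ˡ
      (∈-applyUpTo⁺ (λ i → 5 + 6 * i) (in-range {i} q≤m)))))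
    ... | inj₂ (inj₂ (i , inj₂ refl)) = there (there (there (∈-++⁺ʳ (applyUpTo (λ i → 5 + 6 * i) k)
      (∈-applyUpTo⁺ (λ i → 7 + 6 * i) (in-range {i} (≤-trans (m≤n+m (5 + 6 * i) 2) q≤m))))))

  DividesSome : (ℕ → ℕ) → ℕ → ℕ → Set
  DividesSome g N q = ∃[ n ] (1 ≤ n × n ≤ N × q ∣ g n)

  -- A prime dividing a value is at most `M`, so all of them are found by filtering 0, ..., M. The
  -- prime p is set aside along with those up to `m`, and `r` is the number set aside.
  large-prime-divisors : ∀ p m {g N M W d} → (∀ {q} → Prime q → Separated g N d q) →
    1 ≤ W → (∀ n → 1 ≤ n → n ≤ N → W * n ^ d ≤ g n) → 1 ≤ M → (∀ n → 1 ≤ n → n ≤ N → g n ≤ M) →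
    ∃[ qs ] (Unique qs × All (λ q → Prime q × m < q × q ≢ p × DividesSome g N q) qs ×
      ∃[ r ] (3 * r ≤ m + 10 × W ^ N ≤ M ^ (d * (length qs + r))))
  large-prime-divisors p m {g} {N} {M} {W} {d} separated 1≤W below 1≤M bounded =
    filter large? Q , Unique.filter⁺ large? Q-unique
    , All.zipWith (λ ((q-prime , divides-some) , m<q , q≢p) → q-prime , m<q , q≢p , divides-some)
        (All.filter⁺ large? Q-members , All.all-filter large? Q)
    , length (filter (λ q → ¬? (large? q)) Q)
    , few-small-primes p m (Unique.filter⁺ _ Q-unique)
        (All.zipWith (λ ((q-prime , _) , ¬large) → q-prime , small ¬large)
          (All.filter⁺ _ Q-members , All.all-filter _ Q))
    , subst (λ l → W ^ N ≤ M ^ (d * l)) (length-filter-¬ large? Q)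
        (count-primes {g} {N} {M} {W} {d} Q Q-unique (All.map proj₁ Q-members)
          (All.map (λ (q-prime , _) → separated q-prime) Q-members) 1≤W below 1≤M bounded covered)
    where
    large? : Decidable (λ q → m < q × q ≢ p)
    large? q = (m <? q) ×-dec ¬? (q ≟ p)
    divides-some? : Decidable (DividesSome g N)
    divides-some? q = map′ (λ (n , n<N , d) → suc n , s≤s z≤n , n<N , d)
      (λ { (suc n , _ , n<N , d) → n , n<N , d }) (anyUpTo? (λ n → q ∣? g (suc n)) N)
    member? : Decidable (λ q → Prime q × DividesSome g N q)
    member? q = prime? q ×-dec divides-some? q
    Q : List ℕ
    Q = filter member? (upTo (suc M))
    Q-unique : Unique Q
    Q-unique = Unique.filter⁺ member? (Unique.upTo⁺ (suc M))
    Q-members : All (λ q → Prime q × DividesSome g N q) Q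
    Q-members = All.all-filter member? (upTo (suc M))
    small : ∀ {q} → ¬ (m < q × q ≢ p) → q ≡ p ⊎ q ≤ m
    small {q} ¬large with q ≟ p
    ... | yes q≡p = inj₁ q≡p
    ... | no q≢p  = inj₂ (≮⇒≥ λ m<q → ¬large (m<q , q≢p))
    covered : ∀ n → 1 ≤ n → n ≤ N → ∀ {r} → Prime r → r ∣ g n → r ∈ Q
    covered n 1≤n n≤N {r} r-prime r∣gn = ∈-filter⁺ member? (∈-upTo⁺ (s≤s (≤-trans
      (∣⇒≤ {{>-nonZero (≤-trans (*-mono-≤ 1≤W (m^n>0 n {{>-nonZero 1≤n}} d)) (below n 1≤n n≤N))}} r∣gn)
      (bounded n 1≤n n≤N)))) (r-prime , n , 1≤n , n≤N , r∣gn)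

-- Cubic polynomials of discriminant p² satisfy the separation conditions.

module CubicPolynomial where

  open Congruence
  open Lagrange using (eval; lagrange-<)
  open PrimeDivisors using (Separated; ^∣-cancel)
  open Reciprocity using (prime∣prime⇒≡)
  open import Data.Integer.Base hiding (suc; pred)
  open import Data.Integer.Divisibility.Signed
  open import Data.Integer.Properties
  open import Data.Integer.Solver using (module +-*-Solver)

  open +-*-Solver using (solve; con; _:+_; _:*_; _:-_; :-_; _:=_)

  cubic : ℤ → ℤ → ℤ → ℤ → List ℤ
  cubic a b c d = d ∷ c ∷ b ∷ a ∷ []

  -- Grouped as a combination of `b` and `a`, so that a common divisor of these two visibly divides
  -- it.
  discriminant : ℤ → ℤ → ℤ → ℤ → ℤ
  discriminant a b c d = b * (b * c * c - + 4 * (b * b * d) + + 18 * (a * c * d))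
                       + a * (- + 4 * (c * c * c) - + 27 * (a * d * d))

  derivative : ℤ → ℤ → ℤ → ℤ → ℤ
  derivative a b c x = + 3 * a * x * x + + 2 * b * x + c

  private
    cofactor₁ cofactor₂ : ℤ → ℤ → ℤ → ℤ → ℤ → ℤ
    cofactor₁ a b c d x = - + 4 * (b * b * b) + + 15 * (a * b * c) - + 6 * (a * b * b * x)
      - + 27 * (a * a * d) + + 18 * (a * a * c * x)
    cofactor₂ a b c d x = b * b * c + + 2 * (b * b * b * x) - + 4 * (a * c * c) + + 3 * (a * b * d)
      - + 7 * (a * b * c * x) + + 2 * (a * b * b * x * x) + + 9 * (a * a * d * x) - + 6 * (a * a * c * x * x)

    -- A Bézout identity over ℤ between a cubic and its derivative: a double root modulo q makes q
    -- divide the discriminant.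
    discriminant-combination : ∀ a b c d x →
      cofactor₁ a b c d x * eval (cubic a b c d) x + cofactor₂ a b c d x * derivative a b c x
      ≡ discriminant a b c d
    discriminant-combination = solve 5 (λ a b c d x →
      (con (- + 4) :* (b :* b :* b) :+ con (+ 15) :* (a :* b :* c) :- con (+ 6) :* (a :* b :* b :* x)
        :- con (+ 27) :* (a :* a :* d) :+ con (+ 18) :* (a :* a :* c :* x))
        :* (d :+ x :* (c :+ x :* (b :+ x :* (a :+ x :* con 0ℤ))))
      :+ (b :* b :* c :+ con (+ 2) :* (b :* b :* b :* x) :- con (+ 4) :* (a :* c :* c) :+ con (+ 3) :* (a :* b :* d)
         :- con (+ 7) :* (a :* b :* c :* x) :+ con (+ 2) :* (a :* b :* b :* x :* x)
         :+ con (+ 9) :* (a :* a :* d :* x) :- con (+ 6) :* (a :* a :* c :* x :* x))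
        :* (con (+ 3) :* a :* x :* x :+ con (+ 2) :* b :* x :+ c)
      := b :* (b :* c :* c :- con (+ 4) :* (b :* b :* d) :+ con (+ 18) :* (a :* c :* d))
         :+ a :* (con (- + 4) :* (c :* c :* c) :- con (+ 27) :* (a :* d :* d))) refl

    discriminant-scale : ∀ k a b c d →
      discriminant (a * k) (b * k) (c * k) (d * k) ≡ k * k * (k * k * discriminant a b c d)
    discriminant-scale = solve 5 (λ k a b c d →
      let Δ = λ a b c d → b :* (b :* c :* c :- con (+ 4) :* (b :* b :* d) :+ con (+ 18) :* (a :* c :* d))
            :+ a :* (con (- + 4) :* (c :* c :* c) :- con (+ 27) :* (a :* d :* d))
      in Δ (a :* k) (b :* k) (c :* k) (d :* k) := k :* k :* (k :* k :* Δ a b c d)) refl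

  module _ {p : ℕ} (p-prime : Prime p) (a b c d : ℤ) (disc≡p² : discriminant a b c d ≡ + p * + p) where

    private
      instance p≢0 = prime⇒nonZero p-prime

      F : ℤ → ℤ
      F = eval (cubic a b c d)

      ∣p²⇒≡p : ∀ {q} → Prime q → + q ∣ + p * + p → q ≡ p
      ∣p²⇒≡p q-prime q∣p² = prime∣prime⇒≡ q-prime p-prime
        ([ (λ e → e) , (λ e → e) ]′ (PrimeModulus.euclid q-prime (+ p) (+ p) q∣p²))

      -- A common divisor q divides the discriminant p², so q = p. But the discriminant is
      -- homogeneous of degree four, so p⁴ would then divide p².
      no-content : ∀ {q} → Prime q → ¬ All (+ q ∣_) (cubic a b c d)
      no-content {q} q-prime q∣coefficients@(_ ∷ _ ∷ q∣b ∷ q∣a ∷ []) =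
        content-p (subst (λ q → All (+ q ∣_) (cubic a b c d)) (∣p²⇒≡p q-prime (∣-resp disc≡p²
          (∣m∣n⇒∣m+n (∣m⇒∣m*n (b * c * c - + 4 * (b * b * d) + + 18 * (a * c * d)) q∣b)
            (∣m⇒∣m*n (- + 4 * (c * c * c) - + 27 * (a * d * d)) q∣a)))) q∣coefficients)
        where
        content-p : ¬ All (+ p ∣_) (cubic a b c d)
        content-p (divides d′ d≡ ∷ divides c′ c≡ ∷ divides b′ b≡ ∷ divides a′ a≡ ∷ []) =
          PrimeModulus.∤1 p-prime (divides (+ p * Δ) (*-cancelˡ-≡ (+ p * + p) 1ℤ (+ p * Δ * + p) {{i*j≢0 (+ p) (+ p)}}
            (trans (*-identityʳ (+ p * + p)) (trans (trans (sym disc≡p²) (trans scaled (discriminant-scale (+ p) a′ b′ c′ d′)))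
              (cong (+ p * + p *_) (lemma (+ p) Δ))))))
          where
          Δ = discriminant a′ b′ c′ d′
          lemma : ∀ p Δ → p * p * Δ ≡ p * Δ * p
          lemma = solve 2 (λ p Δ → p :* p :* Δ := p :* Δ :* p) refl
          scaled : discriminant a b c d ≡ discriminant (a′ * + p) (b′ * + p) (c′ * + p) (d′ * + p)
          scaled = trans (cong₂ (λ a b → discriminant a b c d) a≡ b≡)
            (cong₂ (λ c d → discriminant (a′ * + p) (b′ * + p) c d) c≡ d≡)

      slope : ℤ → ℤ → ℤ
      slope x y = a * (x * x + x * y + y * y) + b * (x + y) + c

      F-difference : ∀ x y → F x - F y ≡ slope x y * (x - y)
      F-difference x y = lemma a b c d x y
        where
        lemma : ∀ a b c d x y → eval (cubic a b c d) x - eval (cubic a b c d) y ≡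
          (a * (x * x + x * y + y * y) + b * (x + y) + c) * (x - y)
        lemma = solve 6 (λ a b c d x y →
          let F = λ x → d :+ x :* (c :+ x :* (b :+ x :* (a :+ x :* con 0ℤ)))
          in F x :- F y := (a :* (x :* x :+ x :* y :+ y :* y) :+ b :* (x :+ y) :+ c) :* (x :- y)) refl

      derivative-slope : ∀ x y → derivative a b c y ≡ slope x y - (a * (x + + 2 * y) + b) * (x - y)
      derivative-slope x y = lemma a b c x y
        where
        lemma : ∀ a b c x y → derivative a b c y ≡
          (a * (x * x + x * y + y * y) + b * (x + y) + c) - (a * (x + + 2 * y) + b) * (x - y)
        lemma = solve 5 (λ a b c x y → con (+ 3) :* a :* y :* y :+ con (+ 2) :* b :* y :+ c :=
          (a :* (x :* x :+ x :* y :+ y :* y) :+ b :* (x :+ y) :+ c) :- (a :* (x :+ con (+ 2) :* y) :+ b) :* (x :- y)) refl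

      -- For x ≡ y the difference quotient is congruent to the derivative at y, and a root common to
      -- cubic and derivative forces q to divide p².
      simple-root : ∀ {q} → Prime q → ¬ q ≡ p → ∀ x y → x ≡ y [ + q ] → + q ∣ F y → ¬ + q ∣ slope x y
      simple-root {q} q-prime q≢p x y (∣⇒≡ q∣x-y) q∣Fy q∣slope = q≢p (∣p²⇒≡p q-prime (∣-resp
        (trans (discriminant-combination a b c d y) disc≡p²)
        (∣m∣n⇒∣m+n (∣n⇒∣m*n (cofactor₁ a b c d y) q∣Fy) (∣n⇒∣m*n (cofactor₂ a b c d y) (∣-resp (sym (derivative-slope x y))
          (∣m∣n⇒∣m-n q∣slope (∣n⇒∣m*n (a * (x + + 2 * y) + b) q∣x-y)))))))

    -- For q ≠ p, F(n) - F(m) is n - m times a slope prime to q. The prime p divides the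
    -- discriminant, so there size is used instead: nonzero values below p² are not divisible by p²,
    -- and only exponents up to 1 occur.
    cubic-separated : ∀ {q N} → Prime q →
      (∀ n → 1 ℕ.≤ n → n ℕ.≤ N → 1 ℕ.≤ ∣ F (+ n) ∣ × ∣ F (+ n) ∣ ℕ.< p ℕ.* p) →
      Separated (λ n → ∣ F (+ n) ∣) N 3 q
    cubic-separated {q} {N} q-prime small = record { roots = roots ; lifting = lifting }
      where
      roots : ∀ zs → AllPairs (λ m n → ¬ + n ≡ + m [ + q ]) zs →
        All (λ n → 1 ℕ.≤ n × n ℕ.≤ N × q ℕ.∣ ∣ F (+ n) ∣) zs → length zs ℕ.≤ 3
      roots zs distinct are-roots = ℕ.≤-pred (subst (ℕ._< 4) (List.length-map +_ zs)
        (lagrange-< q-prime (cubic a b c d) (no-content q-prime) (map +_ zs)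
          (AllPairs.map⁺ distinct) (All.map⁺ (All.map (λ (_ , _ , q∣) → ∣ᵤ⇒∣ q∣) are-roots))))
      lifting : ∀ {m n} k → 1 ℕ.≤ m → n ℕ.≤ N → m ℕ.< n → q ℕ.∣ ∣ F (+ m) ∣ → + n ≡ + m [ + q ] →
        q ℕ.^ k ℕ.∣ ∣ F (+ m) ∣ → q ℕ.^ k ℕ.∣ ∣ F (+ n) ∣ → + n ≡ + m [ + (q ℕ.^ k) ]
      lifting {m} {n} k 1≤m n≤N m<n q∣Fm n≡m q^k∣Fm q^k∣Fn = by-cases (q ℕ.≟ p) k q^k∣Fm q^k∣Fn
        where
        by-cases : Dec (q ≡ p) → ∀ k → q ℕ.^ k ℕ.∣ ∣ F (+ m) ∣ → q ℕ.^ k ℕ.∣ ∣ F (+ n) ∣ →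
          + n ≡ + m [ + (q ℕ.^ k) ]
        by-cases (no q≢p) k q^k∣Fm q^k∣Fn = ∣⇒≡ (∣ᵤ⇒∣ (^∣-cancel q-prime k
          (λ d → simple-root q-prime q≢p (+ n) (+ m) n≡m (∣ᵤ⇒∣ q∣Fm) (∣ᵤ⇒∣ d))
          (subst (q ℕ.^ k ℕ.∣_) (trans (cong ∣_∣ (F-difference (+ n) (+ m))) (abs-* (slope (+ n) (+ m)) (+ n - + m)))
            (∣⇒∣ᵤ (∣m∣n⇒∣m-n {i = + (q ℕ.^ k)} (∣ᵤ⇒∣ {i = F (+ n)} q^k∣Fn) (∣ᵤ⇒∣ {i = F (+ m)} q^k∣Fm))))))
        by-cases (yes _) zero _ _ = ∣⇒≡ (divides (+ n - + m) (sym (*-identityʳ (+ n - + m))))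
        by-cases (yes _) (suc zero) _ _ = subst (λ z → + n ≡ + m [ + z ]) (sym (ℕ.^-identityʳ q)) n≡m
        by-cases (yes refl) (suc (suc k)) q^k∣Fm _ =
          let 1≤F , F<p² = small m 1≤m (ℕ.≤-trans (ℕ.<⇒≤ m<n) n≤N) in
          contradiction (ℕ.∣⇒≤ {{ℕ.>-nonZero 1≤F}}
            (ℕ.m*n∣⇒m∣ (p ℕ.* p) (p ℕ.^ k) (subst (ℕ._∣ ∣ F (+ m) ∣) (sym (ℕ.*-assoc p p (p ℕ.^ k))) q^k∣Fm)))
            (ℕ.<⇒≱ F<p²)

-- The case p ≡ 1 modulo 3: two families of values and their sizes.

module CubicCase where

  open Congruence
  open Lagrange using (eval)
  open PrimeDivisors using () renaming (^-distribʳ-* to ℕ-^-distribʳ-*)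
  open Collect
  open CubicForm
  open CubicPolynomial
  open import Data.Integer.Base using (ℤ; +_; -_; ∣_∣; 0ℤ; 1ℤ; +≤+)
  import Data.Integer.Base as ℤ
  open import Data.Integer.Divisibility.Signed as ℤ using (∣ᵤ⇒∣)
  import Data.Integer.Properties as ℤ
  import Data.Integer.Solver as ℤ
  open import Data.Nat.Base
  open import Data.Nat.Divisibility
  open import Data.Nat.Properties
  open import Data.Nat.Solver using (module +-*-Solver)

  square-cancel-≤ : ∀ {x y} → x * x ≤ y * y → x ≤ y
  square-cancel-≤ x²≤y² = ≮⇒≥ λ y<x → <⇒≱ (*-mono-< y<x y<x) x²≤y²

  ^-cancelʳ-≤ : ∀ {w i j} → 1 < w → w ^ i ≤ w ^ j → i ≤ j
  ^-cancelʳ-≤ {w} 1<w wⁱ≤wʲ = ≮⇒≥ λ j<i → <⇒≱ (^-monoʳ-< w 1<w j<i) wⁱ≤wʲ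

  ^-exchange : ∀ x i j → (x ^ i) ^ j ≡ (x ^ j) ^ i
  ^-exchange x i j = trans (^-*-assoc x i j) (trans (cong (x ^_) (*-comm i j)) (sym (^-*-assoc x j i)))

  -- If log M ≤ (r / s) log W then W ^ N ≤ M ^ T gives s N ≤ r T.
  exponents : ∀ {W M} r s N T → 1 < W → M ^ s ≤ W ^ r → W ^ N ≤ M ^ T → N * s ≤ r * T
  exponents {W} {M} r s N T 1<W Mˢ≤Wʳ Wᴺ≤Mᵀ = ^-cancelʳ-≤ 1<W (begin
    W ^ (N * s)  ≡⟨ ^-*-assoc W N s ⟨
    (W ^ N) ^ s  ≤⟨ ^-monoˡ-≤ s Wᴺ≤Mᵀ ⟩
    (M ^ T) ^ s  ≡⟨ ^-exchange M T s ⟩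
    (M ^ s) ^ T  ≤⟨ ^-monoˡ-≤ T Mˢ≤Wʳ ⟩
    (W ^ r) ^ T  ≡⟨ ^-*-assoc W r T ⟩
    W ^ (r * T)  ∎)
    where open ≤-Reasoning

  -- Raises a ratio bound H/m ≤ β/α to the sixth power, leaving only a comparison of numerals to be
  -- decided.
  sixth-power-bound : ∀ {H m} α β k l p .{{_ : NonZero α}} → α * H ≤ β * m → l * β ^ 6 ≤ α ^ 6 * k →
    l * p * H ^ 6 ≤ k * p * m ^ 6
  sixth-power-bound {H} {m} α β k l p αH≤βm lβ⁶≤α⁶k = *-cancelˡ-≤ (α ^ 6) {{m^n≢0 α 6}} (begin
    α ^ 6 * (l * p * H ^ 6)   ≡⟨ lemma (α ^ 6) l p (H ^ 6) ⟩
    l * p * (α ^ 6 * H ^ 6)   ≡⟨ cong (l * p *_) (ℕ-^-distribʳ-* α H 6) ⟨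
    l * p * (α * H) ^ 6       ≤⟨ *-monoʳ-≤ (l * p) (^-monoˡ-≤ 6 αH≤βm) ⟩
    l * p * (β * m) ^ 6       ≡⟨ cong (l * p *_) (ℕ-^-distribʳ-* β m 6) ⟩
    l * p * (β ^ 6 * m ^ 6)   ≡⟨ lemma′ l p (β ^ 6) (m ^ 6) ⟩
    l * β ^ 6 * (p * m ^ 6)   ≤⟨ *-monoˡ-≤ (p * m ^ 6) lβ⁶≤α⁶k ⟩
    α ^ 6 * k * (p * m ^ 6)   ≡⟨ lemma″ (α ^ 6) k p (m ^ 6) ⟩
    α ^ 6 * (k * p * m ^ 6)   ∎)
    where
    open ≤-Reasoning
    open +-*-Solver
    lemma : ∀ x l p y → x * (l * p * y) ≡ l * p * (x * y)
    lemma = solve 4 (λ x l p y → x :* (l :* p :* y) := l :* p :* (x :* y)) refl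
    lemma′ : ∀ l p x y → l * p * (x * y) ≡ l * x * (p * y)
    lemma′ = solve 4 (λ l p x y → l :* p :* (x :* y) := l :* x :* (p :* y)) refl
    lemma″ : ∀ x k p y → x * k * (p * y) ≡ x * (k * p * y)
    lemma″ = solve 4 (λ x k p y → x :* k :* (p :* y) := x :* (k :* p :* y)) refl

  scaled-square-bound : ∀ {W} c → c ^ 5 ≤ W → (c * (W * W)) ^ 5 ≤ W ^ 11
  scaled-square-bound {W} c c⁵≤W = begin
    (c * (W * W)) ^ 5   ≡⟨ ℕ-^-distribʳ-* c (W * W) 5 ⟩
    c ^ 5 * (W * W) ^ 5 ≤⟨ *-monoˡ-≤ ((W * W) ^ 5) c⁵≤W ⟩
    W * (W * W) ^ 5     ≡⟨ solve 1 (λ W → W :* (W :* W) :^ 5 := W :^ 11) refl W ⟩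
    W ^ 11              ∎
    where
    open ≤-Reasoning
    open +-*-Solver

  module Size {p m : ℕ} (2¹³⁹≤p : 2 ^ 139 ≤ p) (75≤m : 75 ≤ m) (m⁶≤2p : m ^ 6 ≤ 2 * p) where

    open ≤-Reasoning
    open +-*-Solver

    100<p : 100 < p
    100<p = ≤-trans (from-yes (101 ≤? 2 ^ 139)) 2¹³⁹≤p

    -- With H = 3m + 3 the hypotheses give g² ≤ 4 p H⁶, and m ≥ 75 gives H ≤ (76/25) m. The
    -- numerical condition is 4 (76/25)⁶ ≤ 5000.
    value-bound : ∀ g Q → 27 * (g * g) ≤ 4 * p * (Q * Q * Q) → Q ≤ 3 * ((3 * m + 3) * (3 * m + 3)) →
      g * g ≤ 5000 * p * m ^ 6
    value-bound g Q 27g²≤ Q≤ = ≤-trans (*-cancelˡ-≤ 27 (begin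
        27 * (g * g)         ≤⟨ 27g²≤ ⟩
        4 * p * (Q * Q * Q)  ≤⟨ *-monoʳ-≤ (4 * p) (*-mono-≤ (*-mono-≤ Q≤ Q≤) Q≤) ⟩
        4 * p * (3 * (H * H) * (3 * (H * H)) * (3 * (H * H))) ≡⟨ lemma p H ⟩
        27 * (4 * p * H ^ 6) ∎))
      (sixth-power-bound {3 * m + 3} {m} 25 76 5000 4 p 25H≤76m (from-yes (4 * 76 ^ 6 ≤? 25 ^ 6 * 5000)))
      where
      H = 3 * m + 3
      lemma : ∀ p H → 4 * p * (3 * (H * H) * (3 * (H * H)) * (3 * (H * H))) ≡ 27 * (4 * p * H ^ 6)
      lemma = solve 2 (λ p H → con 4 :* p :* (con 3 :* (H :* H) :* (con 3 :* (H :* H)) :* (con 3 :* (H :* H)))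
        := con 27 :* (con 4 :* p :* H :^ 6)) refl
      25H≤76m : 25 * (3 * m + 3) ≤ 76 * m
      25H≤76m = begin
        25 * (3 * m + 3) ≡⟨ solve 1 (λ m → con 25 :* (con 3 :* m :+ con 3) := con 75 :* m :+ con 75) refl m ⟩
        75 * m + 75      ≤⟨ +-monoʳ-≤ (75 * m) 75≤m ⟩
        75 * m + m       ≡⟨ solve 1 (λ m → con 75 :* m :+ m := con 76 :* m) refl m ⟩
        76 * m           ∎

    ≤100p : ∀ {g} → g * g ≤ 5000 * p * m ^ 6 → g ≤ 100 * p
    ≤100p {g} g²≤ = square-cancel-≤ (begin
      g * g                ≤⟨ g²≤ ⟩
      5000 * p * m ^ 6     ≤⟨ *-monoʳ-≤ (5000 * p) m⁶≤2p ⟩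
      5000 * p * (2 * p)   ≡⟨ solve 1 (λ p → con 5000 :* p :* (con 2 :* p) := con 100 :* p :* (con 100 :* p)) refl p ⟩
      100 * p * (100 * p)  ∎)

    -- Needed at the prime p, where roots may be multiple; see `cubic-separated`.
    <p² : ∀ {g} → g * g ≤ 5000 * p * m ^ 6 → g < p * p
    <p² g²≤ = ≤-<-trans (≤100p g²≤) (*-monoˡ-< p {{>-nonZero (<-trans z<s 100<p)}} 100<p)

    ≤900W² : ∀ {g W} → p ≤ 9 * (W * W) → g * g ≤ 5000 * p * m ^ 6 → g ≤ 900 * (W * W)
    ≤900W² {g} {W} p≤9W² g²≤ = begin
      g                   ≤⟨ ≤100p g²≤ ⟩
      100 * p             ≤⟨ *-monoʳ-≤ 100 p≤9W² ⟩
      100 * (9 * (W * W)) ≡⟨ *-assoc 100 9 (W * W) ⟨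
      900 * (W * W)       ∎

    W-large : ∀ {W} → p ≤ 9 * (W * W) → 2 ^ 67 ≤ W
    W-large {W} p≤9W² = ≮⇒≥ λ W<2⁶⁷ → <⇒≱ (begin-strict
      9 * (W * W)           ≤⟨ *-monoʳ-≤ 9 (*-mono-≤ (<⇒≤ W<2⁶⁷) (<⇒≤ W<2⁶⁷)) ⟩
      9 * (2 ^ 67 * 2 ^ 67) <⟨ from-yes (9 * (2 ^ 67 * 2 ^ 67) <? 2 ^ 139) ⟩
      2 ^ 139               ≤⟨ 2¹³⁹≤p ⟩
      p                     ∎) p≤9W²

    -- From M⁵ ≤ W^11 with M = 900 W² comes 15m ≤ 33 (G + r), that is G + r ≥ 5m/11. As r ≤ (m +
    -- 10)/3, the claim reduces to 27m ≥ 1683, which m ≥ 75 ensures.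
    enough : ∀ {W G r} → 2 ^ 67 ≤ W → 3 * r ≤ m + 10 →
      W ^ (3 * m) ≤ (900 * (W * W)) ^ (3 * (G + r)) → suc m ≤ 15 * G
    enough {W} {G} {r} 2⁶⁷≤W 3r≤m+10 Wᴺ≤ = *-cancelˡ-≤ 33 (+-cancelʳ-≤ (165 * m + 1650) _ _ (begin
      33 * suc m + (165 * m + 1650)
        ≡⟨ solve 1 (λ m → con 33 :* (con 1 :+ m) :+ (con 165 :* m :+ con 1650) := con 198 :* m :+ con 1683) refl m ⟩
      198 * m + 1683            ≤⟨ +-monoʳ-≤ (198 * m) (≤-trans (from-yes (1683 ≤? 27 * 75)) (*-monoʳ-≤ 27 75≤m)) ⟩
      198 * m + 27 * m          ≡⟨ solve 1 (λ m → con 198 :* m :+ con 27 :* m := con 15 :* (con 3 :* m :* con 5)) refl m ⟩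
      15 * (3 * m * 5)          ≤⟨ *-monoʳ-≤ 15 (exponents 11 5 (3 * m) (3 * (G + r)) 1<W M⁵≤W¹¹ Wᴺ≤) ⟩
      15 * (11 * (3 * (G + r))) ≡⟨ solve 2 (λ G r → con 15 :* (con 11 :* (con 3 :* (G :+ r))) :=
                                     con 33 :* (con 15 :* G) :+ con 165 :* (con 3 :* r)) refl G r ⟩
      33 * (15 * G) + 165 * (3 * r)         ≤⟨ +-monoʳ-≤ (33 * (15 * G)) (*-monoʳ-≤ 165 3r≤m+10) ⟩
      33 * (15 * G) + 165 * (m + 10)        ≡⟨ cong (λ z → 33 * (15 * G) + z) (*-distribˡ-+ 165 m 10) ⟩
      33 * (15 * G) + (165 * m + 1650)      ∎))
      where
      1<W : 1 < W
      1<W = ≤-trans (from-yes (2 ≤? 2 ^ 67)) 2⁶⁷≤W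
      M⁵≤W¹¹ : (900 * (W * W)) ^ 5 ≤ W ^ 11
      M⁵≤W¹¹ = scaled-square-bound 900 (≤-trans (from-yes (900 ^ 5 ≤? 2 ^ 67)) 2⁶⁷≤W)

  module _ {p m : ℕ} (p-prime : Prime p) (2¹³⁹≤p : 2 ^ 139 ≤ p) (75≤m : 75 ≤ m) (m⁶≤2p : m ^ 6 ≤ 2 * p) where

    open Size 2¹³⁹≤p 75≤m m⁶≤2p

    Found : (ℕ → Set) → Set
    Found Good = ∃[ qs ] (Unique qs
      × All (λ q → Prime q × m < q × q * q ≤ 5000 * p * m ^ 6 × Good q) qs
      × suc m ≤ 15 * length qs)

    module _ (a b c d : ℤ) (disc≡p² : discriminant a b c d ≡ + p ℤ.* + p) where

      private
        g : ℕ → ℕ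
        g n = ∣ eval (cubic a b c d) (+ n) ∣

      cubic-values : ∀ W → p ≤ 9 * (W * W) → (∀ n → W * n ^ 3 ≤ g n) →
        (∀ n → n ≤ 3 * m → g n * g n ≤ 5000 * p * m ^ 6) →
        Found (λ q → q ≢ p × ∃[ n ] q ∣ g n)
      cubic-values W p≤9W² lower upper =
        let qs , unique , good , r , 3r≤m+10 , Wᴺ≤Mᵀ = large-prime-divisors p m {g} {3 * m} {900 * (W * W)} {W} {3}
              (λ q-prime → cubic-separated p-prime a b c d disc≡p² q-prime
                (λ n 1≤n n≤N → 1≤g 1≤n , <p² (upper n n≤N)))
              1≤W (λ n _ _ → lower n)
              (*-mono-≤ {1} {900} (s≤s z≤n) (*-mono-≤ 1≤W 1≤W))
              (λ n _ n≤N → ≤900W² {W = W} p≤9W² (upper n n≤N))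
        in qs , unique
         , All.map (λ (q-prime , m<q , q≢p , n , 1≤n , n≤N , q∣gn) →
             let q≤gn = ∣⇒≤ {{>-nonZero (1≤g 1≤n)}} q∣gn in
             q-prime , m<q , ≤-trans (*-mono-≤ q≤gn q≤gn) (upper n n≤N) , q≢p , n , q∣gn) good
         , enough {W} {length qs} {r} (W-large p≤9W²) 3r≤m+10 Wᴺ≤Mᵀ
        where
        1≤W : 1 ≤ W
        1≤W = ≤-trans (from-yes (1 ≤? 2 ^ 67)) (W-large p≤9W²)
        1≤g : ∀ {n} → 1 ≤ n → 1 ≤ g n
        1≤g {n} 1≤n = ≤-trans (*-mono-≤ 1≤W (m^n>0 n {{>-nonZero 1≤n}} 3)) (lower n)

  -- With coefficients in ℕ, dropping terms gives a lower bound without any discussion of signs.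
  cubicℕ : ℕ → ℕ → ℕ → ℕ → ℕ → ℕ
  cubicℕ e₃ e₂ e₁ e₀ n = e₃ * (n * n * n) + e₂ * (n * n) + e₁ * n + e₀

  cubicℤ : ℕ → ℕ → ℕ → ℕ → ℤ → ℤ
  cubicℤ e₃ e₂ e₁ e₀ x = + e₃ ℤ.* (x ℤ.* x ℤ.* x) ℤ.+ + e₂ ℤ.* (x ℤ.* x) ℤ.+ + e₁ ℤ.* x ℤ.+ + e₀

  cubicℕ≡cubicℤ : ∀ e₃ e₂ e₁ e₀ n → + cubicℕ e₃ e₂ e₁ e₀ n ≡ cubicℤ e₃ e₂ e₁ e₀ (+ n)
  cubicℕ≡cubicℤ e₃ e₂ e₁ e₀ n = cong (ℤ._+ + e₀) (cong₂ ℤ._+_ (cong₂ ℤ._+_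
    (trans (ℤ.pos-* e₃ (n * n * n)) (cong (+ e₃ ℤ.*_) (trans (ℤ.pos-* (n * n) n) (cong (ℤ._* + n) (ℤ.pos-* n n)))))
    (trans (ℤ.pos-* e₂ (n * n)) (cong (+ e₂ ℤ.*_) (ℤ.pos-* n n))))
    (ℤ.pos-* e₁ n))

  0≤* : ∀ {i j} → 0ℤ ℤ.≤ i → 0ℤ ℤ.≤ j → 0ℤ ℤ.≤ i ℤ.* j
  0≤* {+ m} {+ n} (+≤+ _) (+≤+ _) = subst (0ℤ ℤ.≤_) (ℤ.pos-* m n) (+≤+ z≤n)

  private
    κ : ∀ {k} → ℕ → ℕ → ℕ → ℕ → ℤ.+-*-Solver.Polynomial k → ℤ.+-*-Solver.Polynomial k
    κ e₃ e₂ e₁ e₀ x = con (+ e₃) :* (x :* x :* x) :+ con (+ e₂) :* (x :* x) :+ con (+ e₁) :* x :+ con (+ e₀)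
      where open ℤ.+-*-Solver

  module _ where

    open ℤ.+-*-Solver

    square₁ : ∀ n → + cubicℕ 0 1 5 7 n ≡
      (+ n ℤ.+ + 3) ℤ.* (+ n ℤ.+ + 3) ℤ.- (+ n ℤ.+ + 3) ℤ.* 1ℤ ℤ.+ 1ℤ ℤ.* 1ℤ
    square₁ n = trans (cubicℕ≡cubicℤ 0 1 5 7 n) (solve 1 (λ x → let u = x :+ con (+ 3) in
      κ 0 1 5 7 x := u :* u :- u :* con 1ℤ :+ con 1ℤ :* con 1ℤ) refl (+ n))

    square₂ : ∀ n → let u = - (+ n ℤ.+ + 2) ; v = + n ℤ.+ + 3 in
      + cubicℕ 0 3 15 19 n ≡ u ℤ.* u ℤ.- u ℤ.* v ℤ.+ v ℤ.* v
    square₂ n = trans (cubicℕ≡cubicℤ 0 3 15 19 n) (solve 1 (λ x → let u = :- (x :+ con (+ 2)) ; v = x :+ con (+ 3) in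
      κ 0 3 15 19 x := u :* u :- u :* v :+ v :* v) refl (+ n))

  module _ (M B : ℤ) where

    open ℤ.+-*-Solver

    private
      covariant : ℤ → ℤ → ℤ
      covariant u v = (+ 2 ℤ.* B ℤ.+ + 3 ℤ.* M) ℤ.* (u ℤ.* u ℤ.* u) ℤ.- (+ 3 ℤ.* B ℤ.+ + 18 ℤ.* M) ℤ.* (u ℤ.* u ℤ.* v)
        ℤ.+ (+ 9 ℤ.* M ℤ.- + 3 ℤ.* B) ℤ.* (u ℤ.* v ℤ.* v) ℤ.+ (+ 2 ℤ.* B ℤ.+ + 3 ℤ.* M) ℤ.* (v ℤ.* v ℤ.* v)

      -- Up to scaling, form and covariant are the two coordinates of (u + v ω)³ π, where p = π π̄.
      syzygy : ∀ u v → let F = form M B u v ; G = covariant u v ; Q = u ℤ.* u ℤ.- u ℤ.* v ℤ.+ v ℤ.* v in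
        + 4 ℤ.* (B ℤ.* B ℤ.+ + 3 ℤ.* (B ℤ.* M) ℤ.+ + 9 ℤ.* (M ℤ.* M)) ℤ.* (Q ℤ.* Q ℤ.* Q) ≡
        + 27 ℤ.* (F ℤ.* F) ℤ.+ G ℤ.* G
      syzygy u v = solve 4 (λ M B u v →
        let F = M :* (u :* u :* u) :+ B :* (u :* u :* v) :+ :- (con (+ 3) :* M :+ B) :* (u :* v :* v) :+ M :* (v :* v :* v)
            G = (con (+ 2) :* B :+ con (+ 3) :* M) :* (u :* u :* u) :- (con (+ 3) :* B :+ con (+ 18) :* M) :* (u :* u :* v)
                :+ (con (+ 9) :* M :- con (+ 3) :* B) :* (u :* v :* v) :+ (con (+ 2) :* B :+ con (+ 3) :* M) :* (v :* v :* v)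
            Q = u :* u :- u :* v :+ v :* v
        in con (+ 4) :* (B :* B :+ con (+ 3) :* (B :* M) :+ con (+ 9) :* (M :* M)) :* (Q :* Q :* Q) :=
           con (+ 27) :* (F :* F) :+ G :* G) refl M B u v

      abs-square : ∀ i → i ℤ.* i ≡ + (∣ i ∣ * ∣ i ∣)
      abs-square (+ n)      = sym (ℤ.pos-* n n)
      abs-square ℤ.-[1+ n ] = refl

    private
      Δ : Polynomial 2 → Polynomial 2 → Polynomial 2 → Polynomial 2 → Polynomial 2
      Δ a b c d = b :* (b :* c :* c :- con (+ 4) :* (b :* b :* d) :+ con (+ 18) :* (a :* c :* d))
        :+ a :* (con (- + 4) :* (c :* c :* c) :- con (+ 27) :* (a :* d :* d))
      N² : Polynomial 2 → Polynomial 2 → Polynomial 2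
      N² M B = (B :* B :+ con (+ 3) :* (B :* M) :+ con (+ 9) :* (M :* M))
        :* (B :* B :+ con (+ 3) :* (B :* M) :+ con (+ 9) :* (M :* M))

    b₁ c₁ d₁ a₂ b₂ c₂ d₂ : ℤ
    b₁ = + 9 ℤ.* M ℤ.+ B
    c₁ = + 24 ℤ.* M ℤ.+ + 5 ℤ.* B
    d₁ = + 19 ℤ.* M ℤ.+ + 6 ℤ.* B
    a₂ = + 3 ℤ.* M ℤ.+ + 2 ℤ.* B
    b₂ = + 27 ℤ.* M ℤ.+ + 15 ℤ.* B
    c₂ = + 78 ℤ.* M ℤ.+ + 37 ℤ.* B
    d₂ = + 73 ℤ.* M ℤ.+ + 30 ℤ.* B

    values₁ : ∀ x → eval (cubic M b₁ c₁ d₁) x ≡ form M B (x ℤ.+ + 3) 1ℤ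
    values₁ = solve 3 (λ M B x →
      con (+ 19) :* M :+ con (+ 6) :* B :+ x :* (con (+ 24) :* M :+ con (+ 5) :* B :+ x :* (con (+ 9) :* M :+ B
        :+ x :* (M :+ x :* con 0ℤ))) :=
      let u = x :+ con (+ 3) in
      M :* (u :* u :* u) :+ B :* (u :* u :* con 1ℤ) :+ :- (con (+ 3) :* M :+ B) :* (u :* con 1ℤ :* con 1ℤ) :+ M :* con 1ℤ)
      refl M B

    values₂ : ∀ x → eval (cubic a₂ b₂ c₂ d₂) x ≡ form M B (- (x ℤ.+ + 2)) (x ℤ.+ + 3)
    values₂ = solve 3 (λ M B x →
      con (+ 73) :* M :+ con (+ 30) :* B :+ x :* (con (+ 78) :* M :+ con (+ 37) :* B :+ x :* (con (+ 27) :* M :+ con (+ 15) :* B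
        :+ x :* (con (+ 3) :* M :+ con (+ 2) :* B :+ x :* con 0ℤ))) :=
      let u = :- (x :+ con (+ 2)) ; v = x :+ con (+ 3) in
      M :* (u :* u :* u) :+ B :* (u :* u :* v) :+ :- (con (+ 3) :* M :+ B) :* (u :* v :* v) :+ M :* (v :* v :* v))
      refl M B

    -- With u = x + 3 and γ = B + 3M, F(u, 1) = M (u² (u - 3) + 1) + γ (u² - u). The offset 3 makes
    -- every coefficient in x nonnegative.
    growth₁ : ∀ x → form M B (x ℤ.+ + 3) 1ℤ ≡
      M ℤ.* cubicℤ 1 6 9 1 x ℤ.+ (B ℤ.+ + 3 ℤ.* M) ℤ.* cubicℤ 0 1 5 6 x
    growth₁ = solve 3 (λ M B x → let u = x :+ con (+ 3) in
      M :* (u :* u :* u) :+ B :* (u :* u :* con 1ℤ) :+ :- (con (+ 3) :* M :+ B) :* (u :* con 1ℤ :* con 1ℤ) :+ M :* con 1ℤ :=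
      M :* κ 1 6 9 1 x :+ (B :+ con (+ 3) :* M) :* κ 0 1 5 6 x) refl M B

    -- The same for the direction (-1, 1), in terms of L = 3M + 2B, its leading coefficient, and γ =
    -- B + 3M. Since 3M = 2γ - L, the form must be tripled to keep the coefficients integral.
    growth₂ : ∀ x → + 3 ℤ.* form M B (- (x ℤ.+ + 2)) (x ℤ.+ + 3) ≡
      (+ 3 ℤ.* M ℤ.+ + 2 ℤ.* B) ℤ.* cubicℤ 3 18 33 17 x ℤ.+ (B ℤ.+ + 3 ℤ.* M) ℤ.* cubicℤ 0 9 45 56 x
    growth₂ = solve 3 (λ M B x → let u = :- (x :+ con (+ 2)) ; v = x :+ con (+ 3) in
      con (+ 3) :* (M :* (u :* u :* u) :+ B :* (u :* u :* v) :+ :- (con (+ 3) :* M :+ B) :* (u :* v :* v) :+ M :* (v :* v :* v)) :=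
      (con (+ 3) :* M :+ con (+ 2) :* B) :* κ 3 18 33 17 x :+ (B :+ con (+ 3) :* M) :* κ 0 9 45 56 x) refl M B

    module _ {p : ℕ} (norm : + p ≡ B ℤ.* B ℤ.+ + 3 ℤ.* (B ℤ.* M) ℤ.+ + 9 ℤ.* (M ℤ.* M)) where

      -- The square of the covariant is dropped from `syzygy`.
      form-bound : ∀ u v Q → + Q ≡ u ℤ.* u ℤ.- u ℤ.* v ℤ.+ v ℤ.* v →
        27 * (∣ form M B u v ∣ * ∣ form M B u v ∣) ≤ 4 * p * (Q * Q * Q)
      form-bound u v Q Q≡ = subst (27 * (g * g) ≤_) (sym (ℤ.+-injective total)) (m≤m+n (27 * (g * g)) (h * h))
        where
        F = form M B u v
        g = ∣ F ∣
        h = ∣ covariant u v ∣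
        Qᶻ = u ℤ.* u ℤ.- u ℤ.* v ℤ.+ v ℤ.* v
        total : + (4 * p * (Q * Q * Q)) ≡ + (27 * (g * g) + h * h)
        total = begin
          + (4 * p * (Q * Q * Q)) ≡⟨ trans (ℤ.pos-* (4 * p) (Q * Q * Q)) (cong₂ ℤ._*_ (ℤ.pos-* 4 p)
                                       (trans (ℤ.pos-* (Q * Q) Q) (cong (ℤ._* + Q) (ℤ.pos-* Q Q)))) ⟩
          + 4 ℤ.* + p ℤ.* (+ Q ℤ.* + Q ℤ.* + Q) ≡⟨ cong₂ (λ p Q → + 4 ℤ.* p ℤ.* (Q ℤ.* Q ℤ.* Q)) norm Q≡ ⟩
          + 4 ℤ.* (B ℤ.* B ℤ.+ + 3 ℤ.* (B ℤ.* M) ℤ.+ + 9 ℤ.* (M ℤ.* M)) ℤ.* (Qᶻ ℤ.* Qᶻ ℤ.* Qᶻ) ≡⟨ syzygy u v ⟩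
          + 27 ℤ.* (F ℤ.* F) ℤ.+ covariant u v ℤ.* covariant u v
            ≡⟨ cong₂ ℤ._+_ (trans (cong (+ 27 ℤ.*_) (abs-square F)) (sym (ℤ.pos-* 27 (g * g)))) (abs-square (covariant u v)) ⟩
          + (27 * (g * g)) ℤ.+ + (h * h) ≡⟨ ℤ.pos-+ (27 * (g * g)) (h * h) ⟨
          + (27 * (g * g) + h * h) ∎
          where open ≡-Reasoning

      -- Both this polynomial and that of `disc₂` arise from the form by a substitution of
      -- determinant ±1, which preserves the discriminant.
      disc₁ : discriminant M b₁ c₁ d₁ ≡ + p ℤ.* + p
      disc₁ = trans (solve 2 (λ M B → Δ M (con (+ 9) :* M :+ B) (con (+ 24) :* M :+ con (+ 5) :* B)
        (con (+ 19) :* M :+ con (+ 6) :* B) := N² M B) refl M B) (cong₂ ℤ._*_ (sym norm) (sym norm))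

      disc₂ : discriminant a₂ b₂ c₂ d₂ ≡ + p ℤ.* + p
      disc₂ = trans (solve 2 (λ M B → Δ (con (+ 3) :* M :+ con (+ 2) :* B) (con (+ 27) :* M :+ con (+ 15) :* B)
        (con (+ 78) :* M :+ con (+ 37) :* B) (con (+ 73) :* M :+ con (+ 30) :* B) := N² M B) refl M B)
        (cong₂ ℤ._*_ (sym norm) (sym norm))

      -- With γ = B + 3M one has p = 9M² + Bγ = L² - 3Bγ. The sign of B thus decides whether M or L
      -- = 3M + 2B is the large leading coefficient; the second identity serves `norm₂`.
      norm₁ : ∀ {W} → M ≡ + W → B ℤ.≤ 0ℤ → 0ℤ ℤ.≤ B ℤ.+ + 3 ℤ.* M → p ≤ 9 * (W * W)
      norm₁ {W} M≡W B≤0 0≤γ = ℤ.drop‿+≤+ (subst₂ ℤ._≤_ (sym norm)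
        (trans (cong (λ M → + 9 ℤ.* (M ℤ.* M)) M≡W) (sym (trans (ℤ.pos-* 9 (W * W)) (cong (+ 9 ℤ.*_) (ℤ.pos-* W W)))))
        (subst (ℤ._≤ + 9 ℤ.* (M ℤ.* M)) (lemma M B) (ℤ.i-j≤i (+ 9 ℤ.* (M ℤ.* M)) (- B ℤ.* (B ℤ.+ + 3 ℤ.* M))
          {{ℤ.nonNegative (0≤* (ℤ.neg-mono-≤ B≤0) 0≤γ)}})))
        where
        lemma : ∀ M B → + 9 ℤ.* (M ℤ.* M) ℤ.- - B ℤ.* (B ℤ.+ + 3 ℤ.* M) ≡ B ℤ.* B ℤ.+ + 3 ℤ.* (B ℤ.* M) ℤ.+ + 9 ℤ.* (M ℤ.* M)
        lemma = solve 2 (λ M B → con (+ 9) :* (M :* M) :- :- B :* (B :+ con (+ 3) :* M) :=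
          B :* B :+ con (+ 3) :* (B :* M) :+ con (+ 9) :* (M :* M)) refl

      norm₂ : ∀ {W} → + 3 ℤ.* M ℤ.+ + 2 ℤ.* B ≡ + W → 0ℤ ℤ.≤ B → 0ℤ ℤ.≤ B ℤ.+ + 3 ℤ.* M → p ≤ W * W
      norm₂ {W} L≡W 0≤B 0≤γ = ℤ.drop‿+≤+ (subst₂ ℤ._≤_ (sym norm)
        (trans (cong (λ L → L ℤ.* L) L≡W) (sym (ℤ.pos-* W W)))
        (subst (ℤ._≤ L ℤ.* L) (lemma M B) (ℤ.i-j≤i (L ℤ.* L) (+ 3 ℤ.* (B ℤ.* (B ℤ.+ + 3 ℤ.* M)))
          {{ℤ.nonNegative (0≤* {+ 3} (+≤+ z≤n) (0≤* 0≤B 0≤γ))}})))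
        where
        L = + 3 ℤ.* M ℤ.+ + 2 ℤ.* B
        lemma : ∀ M B → (+ 3 ℤ.* M ℤ.+ + 2 ℤ.* B) ℤ.* (+ 3 ℤ.* M ℤ.+ + 2 ℤ.* B) ℤ.- + 3 ℤ.* (B ℤ.* (B ℤ.+ + 3 ℤ.* M)) ≡
          B ℤ.* B ℤ.+ + 3 ℤ.* (B ℤ.* M) ℤ.+ + 9 ℤ.* (M ℤ.* M)
        lemma = solve 2 (λ M B → (con (+ 3) :* M :+ con (+ 2) :* B) :* (con (+ 3) :* M :+ con (+ 2) :* B)
          :- con (+ 3) :* (B :* (B :+ con (+ 3) :* M)) := B :* B :+ con (+ 3) :* (B :* M) :+ con (+ 9) :* (M :* M)) refl

  -- A form and its negative have the same prime divisors of values, so B + 3M may be taken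
  -- nonnegative.
  negate : ∀ {p} → ResidueForm p → ResidueForm p
  negate φ = record
    { M = - M
    ; B = - B
    ; norm = trans norm (norm-even M B)
    ; residues = λ {q} q-prime q≢p u v coprime q∣form → residues q-prime q≢p u v coprime
        (subst (+ q ℤ.∣_) (form-odd M B u v) (ℤ.∣m⇒∣-m q∣form))
    }
    where
    open ResidueForm φ
    open ℤ.+-*-Solver
    norm-even : ∀ M B → B ℤ.* B ℤ.+ + 3 ℤ.* (B ℤ.* M) ℤ.+ + 9 ℤ.* (M ℤ.* M) ≡
      - B ℤ.* - B ℤ.+ + 3 ℤ.* (- B ℤ.* - M) ℤ.+ + 9 ℤ.* (- M ℤ.* - M)
    norm-even = solve 2 (λ M B → B :* B :+ con (+ 3) :* (B :* M) :+ con (+ 9) :* (M :* M) :=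
      :- B :* :- B :+ con (+ 3) :* (:- B :* :- M) :+ con (+ 9) :* (:- M :* :- M)) refl
    form-odd : ∀ M B u v → - form (- M) (- B) u v ≡ form M B u v
    form-odd = solve 4 (λ M B u v →
      let F = λ M B → M :* (u :* u :* u) :+ B :* (u :* u :* v) :+ :- (con (+ 3) :* M :+ B) :* (u :* v :* v) :+ M :* (v :* v :* v)
      in :- F (:- M) (:- B) := F M B) refl

  -- The left-hand sides are the values of u² - uv + v² along the two families (see square₁, square₂).
  Q₁-bound : ∀ {m} n → n ≤ 3 * m → cubicℕ 0 1 5 7 n ≤ 3 * ((3 * m + 3) * (3 * m + 3))
  Q₁-bound {m} n n≤3m = begin
    cubicℕ 0 1 5 7 n                             ≤⟨ m≤m+n _ (cubicℕ 0 2 13 20 n) ⟩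
    cubicℕ 0 1 5 7 n + cubicℕ 0 2 13 20 n        ≡⟨ lemma n ⟩
    3 * ((n + 3) * (n + 3))                      ≤⟨ *-monoʳ-≤ 3 (*-mono-≤ (+-monoˡ-≤ 3 n≤3m) (+-monoˡ-≤ 3 n≤3m)) ⟩
    3 * ((3 * m + 3) * (3 * m + 3))              ∎
    where
    open ≤-Reasoning
    open +-*-Solver
    lemma : ∀ n → cubicℕ 0 1 5 7 n + cubicℕ 0 2 13 20 n ≡ 3 * ((n + 3) * (n + 3))
    lemma = solve 1 (λ n →
      let k = λ e₃ e₂ e₁ e₀ → con e₃ :* (n :* n :* n) :+ con e₂ :* (n :* n) :+ con e₁ :* n :+ con e₀ in
      k 0 1 5 7 :+ k 0 2 13 20 := con 3 :* ((n :+ con 3) :* (n :+ con 3))) refl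

  Q₂-bound : ∀ {m} n → n ≤ 3 * m → cubicℕ 0 3 15 19 n ≤ 3 * ((3 * m + 3) * (3 * m + 3))
  Q₂-bound {m} n n≤3m = begin
    cubicℕ 0 3 15 19 n                           ≤⟨ m≤m+n _ (cubicℕ 0 0 3 8 n) ⟩
    cubicℕ 0 3 15 19 n + cubicℕ 0 0 3 8 n        ≡⟨ lemma n ⟩
    3 * ((n + 3) * (n + 3))                      ≤⟨ *-monoʳ-≤ 3 (*-mono-≤ (+-monoˡ-≤ 3 n≤3m) (+-monoˡ-≤ 3 n≤3m)) ⟩
    3 * ((3 * m + 3) * (3 * m + 3))              ∎
    where
    open ≤-Reasoning
    open +-*-Solver
    lemma : ∀ n → cubicℕ 0 3 15 19 n + cubicℕ 0 0 3 8 n ≡ 3 * ((n + 3) * (n + 3))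
    lemma = solve 1 (λ n →
      let k = λ e₃ e₂ e₁ e₀ → con e₃ :* (n :* n :* n) :+ con e₂ :* (n :* n) :+ con e₁ :* n :+ con e₀ in
      k 0 3 15 19 :+ k 0 0 3 8 := con 3 :* ((n :+ con 3) :* (n :+ con 3))) refl

  cube≤cubicℕ : ∀ e e₂ e₁ e₀ n → e * n ^ 3 ≤ cubicℕ e e₂ e₁ e₀ n
  cube≤cubicℕ e e₂ e₁ e₀ n = subst (_≤ cubicℕ e e₂ e₁ e₀ n) (cong (e *_) (lemma n))
    (≤-trans (m≤m+n _ (e₂ * (n * n))) (≤-trans (m≤m+n _ (e₁ * n)) (m≤m+n _ e₀)))
    where
    open +-*-Solver
    lemma : ∀ n → n * n * n ≡ n ^ 3
    lemma = solve 1 (λ n → n :* n :* n := n :^ 3) refl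

  module _ {p m : ℕ} (p-prime : Prime p) (2¹³⁹≤p : 2 ^ 139 ≤ p) (75≤m : 75 ≤ m) (m⁶≤2p : m ^ 6 ≤ 2 * p) where

    private
      Residue : ℕ → Set
      Residue q = q ≢ p × ∃[ y ] + q ≡ y ℤ.^ 3 [ + p ]

      Result : Set
      Result = Found p-prime 2¹³⁹≤p 75≤m m⁶≤2p Residue

    module _ (φ : ResidueForm p) where

      open ResidueForm φ
      open Size 2¹³⁹≤p 75≤m m⁶≤2p

      private
        to-residues : ∀ (h : ℕ → ℤ) (u v : ℕ → ℤ) → (∀ n → h n ≡ form M B (u n) (v n)) →
          (∀ {q} → Prime q → ∀ n → ¬ ((+ q ℤ.∣ u n) × (+ q ℤ.∣ v n))) →
          Found p-prime 2¹³⁹≤p 75≤m m⁶≤2p (λ q → q ≢ p × ∃[ n ] q ∣ ∣ h n ∣) → Result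
        to-residues h u v h≡form coprime (qs , unique , good , enough) = qs , unique
          , All.map (λ {q} (q-prime , m<q , q²≤ , q≢p , n , q∣h) → q-prime , m<q , q²≤ ,
              q≢p , residues q-prime q≢p (u n) (v n) (coprime q-prime n)
                (subst (+ q ℤ.∣_) (h≡form n) (∣ᵤ⇒∣ {+ q} {h n} q∣h))) good
          , enough

      family₁ : ∀ {W γ} → M ≡ + W → B ℤ.≤ 0ℤ → B ℤ.+ + 3 ℤ.* M ≡ + γ → Result
      family₁ {W} {γ} M≡W B≤0 γ≡ = to-residues h (λ n → + n ℤ.+ + 3) (λ _ → 1ℤ) (λ n → values₁ M B (+ n))
        (λ q-prime n (_ , q∣1) → PrimeModulus.∤1 q-prime q∣1)
        (cubic-values p-prime 2¹³⁹≤p 75≤m m⁶≤2p M (b₁ M B) (c₁ M B) (d₁ M B) (disc₁ M B norm) W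
          (norm₁ M B norm M≡W B≤0 (subst (0ℤ ℤ.≤_) (sym γ≡) (+≤+ z≤n)))
          lower
          (λ n n≤3m → value-bound ∣ h n ∣ (Q n) (subst (λ z → 27 * (∣ z ∣ * ∣ z ∣) ≤ 4 * p * (Q n * Q n * Q n))
            (sym (values₁ M B (+ n))) (form-bound M B norm (+ n ℤ.+ + 3) 1ℤ (Q n) (square₁ n)))
            (Q₁-bound {m} n n≤3m)))
        where
        Q = cubicℕ 0 1 5 7
        h : ℕ → ℤ
        h n = eval (cubic M (b₁ M B) (c₁ M B) (d₁ M B)) (+ n)
        value : ∀ n → h n ≡ + (W * cubicℕ 1 6 9 1 n + γ * cubicℕ 0 1 5 6 n)
        value n = trans (values₁ M B (+ n)) (trans (growth₁ M B (+ n)) (cong₂ ℤ._+_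
          (trans (cong₂ ℤ._*_ M≡W (sym (cubicℕ≡cubicℤ 1 6 9 1 n))) (sym (ℤ.pos-* W _)))
          (trans (cong₂ ℤ._*_ γ≡ (sym (cubicℕ≡cubicℤ 0 1 5 6 n))) (sym (ℤ.pos-* γ _)))))
        lower : ∀ n → W * n ^ 3 ≤ ∣ h n ∣
        lower n = subst (λ z → W * n ^ 3 ≤ ∣ z ∣) (sym (value n)) (≤-trans
          (*-monoʳ-≤ W (subst (_≤ cubicℕ 1 6 9 1 n) (*-identityˡ (n ^ 3)) (cube≤cubicℕ 1 6 9 1 n)))
          (m≤m+n _ (γ * cubicℕ 0 1 5 6 n)))

      family₂ : ∀ {W γ} → + 3 ℤ.* M ℤ.+ + 2 ℤ.* B ≡ + W → 0ℤ ℤ.≤ B → B ℤ.+ + 3 ℤ.* M ≡ + γ → Result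
      family₂ {W} {γ} L≡W 0≤B γ≡ = to-residues h (λ n → - (+ n ℤ.+ + 2)) (λ n → + n ℤ.+ + 3) (λ n → values₂ M B (+ n))
        (λ q-prime n (q∣u , q∣v) → PrimeModulus.∤1 q-prime (subst (+ _ ℤ.∣_) (u+v≡1 (+ n)) (ℤ.∣m∣n⇒∣m+n q∣u q∣v)))
        (cubic-values p-prime 2¹³⁹≤p 75≤m m⁶≤2p (a₂ M B) (b₂ M B) (c₂ M B) (d₂ M B) (disc₂ M B norm) W
          (≤-trans (norm₂ M B norm L≡W 0≤B (subst (0ℤ ℤ.≤_) (sym γ≡) (+≤+ z≤n))) (m≤n*m (W * W) 9))
          lower
          (λ n n≤3m → value-bound ∣ h n ∣ (Q n) (subst (λ z → 27 * (∣ z ∣ * ∣ z ∣) ≤ 4 * p * (Q n * Q n * Q n))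
            (sym (values₂ M B (+ n))) (form-bound M B norm (- (+ n ℤ.+ + 2)) (+ n ℤ.+ + 3) (Q n) (square₂ n)))
            (Q₂-bound {m} n n≤3m)))
        where
        Q = cubicℕ 0 3 15 19
        h : ℕ → ℤ
        h n = eval (cubic (a₂ M B) (b₂ M B) (c₂ M B) (d₂ M B)) (+ n)
        u+v≡1 : ∀ x → - (x ℤ.+ + 2) ℤ.+ (x ℤ.+ + 3) ≡ 1ℤ
        u+v≡1 = solve 1 (λ x → :- (x :+ con (+ 2)) :+ (x :+ con (+ 3)) := con 1ℤ) refl
          where open ℤ.+-*-Solver
        value : ∀ n → + 3 ℤ.* h n ≡ + (W * cubicℕ 3 18 33 17 n + γ * cubicℕ 0 9 45 56 n)
        value n = trans (cong (+ 3 ℤ.*_) (values₂ M B (+ n))) (trans (growth₂ M B (+ n)) (cong₂ ℤ._+_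
          (trans (cong₂ ℤ._*_ L≡W (sym (cubicℕ≡cubicℤ 3 18 33 17 n))) (sym (ℤ.pos-* W _)))
          (trans (cong₂ ℤ._*_ γ≡ (sym (cubicℕ≡cubicℤ 0 9 45 56 n))) (sym (ℤ.pos-* γ _)))))
        lower : ∀ n → W * n ^ 3 ≤ ∣ h n ∣
        lower n = *-cancelˡ-≤ 3 (begin
          3 * (W * n ^ 3)                ≡⟨ exchange 3 W (n ^ 3) ⟩
          W * (3 * n ^ 3)                ≤⟨ *-monoʳ-≤ W (cube≤cubicℕ 3 18 33 17 n) ⟩
          W * cubicℕ 3 18 33 17 n        ≤⟨ m≤m+n _ (γ * cubicℕ 0 9 45 56 n) ⟩
          W * cubicℕ 3 18 33 17 n + γ * cubicℕ 0 9 45 56 n ≡⟨ cong ∣_∣ (value n) ⟨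
          ∣ + 3 ℤ.* h n ∣                ≡⟨ ℤ.abs-* (+ 3) (h n) ⟩
          3 * ∣ h n ∣                    ∎)
          where
          open ≤-Reasoning
          exchange : ∀ a b c → a * (b * c) ≡ b * (a * c)
          exchange = solve 3 (λ a b c → a :* (b :* c) := b :* (a :* c)) refl
            where open +-*-Solver

      -- With γ = B + 3M and L = 2B + 3M, signs follow from 3M = γ - B and L = B + γ.
      nonneg-γ : 0ℤ ℤ.≤ B ℤ.+ + 3 ℤ.* M → Result
      nonneg-γ 0≤γ = by-sign (ℤ.≤-total B 0ℤ)
        where
        γ≡ : B ℤ.+ + 3 ℤ.* M ≡ + ∣ B ℤ.+ + 3 ℤ.* M ∣
        γ≡ = sym (ℤ.0≤i⇒+∣i∣≡i 0≤γ)
        by-sign : B ℤ.≤ 0ℤ ⊎ 0ℤ ℤ.≤ B → Result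
        by-sign (inj₁ B≤0) = family₁ (sym (ℤ.0≤i⇒+∣i∣≡i 0≤M)) B≤0 γ≡
          where
          γ-B : ∀ M B → (B ℤ.+ + 3 ℤ.* M) ℤ.+ - B ≡ + 3 ℤ.* M
          γ-B = solve 2 (λ M B → (B :+ con (+ 3) :* M) :+ :- B := con (+ 3) :* M) refl
            where open ℤ.+-*-Solver
          0≤M : 0ℤ ℤ.≤ M
          0≤M = ℤ.*-cancelˡ-≤-pos 0ℤ M (+ 3) (subst (0ℤ ℤ.≤_) (γ-B M B) (ℤ.+-mono-≤ 0≤γ (ℤ.neg-mono-≤ B≤0)))
        by-sign (inj₂ 0≤B) = family₂ (sym (ℤ.0≤i⇒+∣i∣≡i 0≤L)) 0≤B γ≡
          where
          γ+B : ∀ M B → (B ℤ.+ + 3 ℤ.* M) ℤ.+ B ≡ + 3 ℤ.* M ℤ.+ + 2 ℤ.* B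
          γ+B = solve 2 (λ M B → (B :+ con (+ 3) :* M) :+ B := con (+ 3) :* M :+ con (+ 2) :* B) refl
            where open ℤ.+-*-Solver
          0≤L : 0ℤ ℤ.≤ + 3 ℤ.* M ℤ.+ + 2 ℤ.* B
          0≤L = subst (0ℤ ℤ.≤_) (γ+B M B) (ℤ.+-mono-≤ 0≤γ 0≤B)

    cubic-case : ResidueForm p → Result
    cubic-case φ = by-sign (ℤ.≤-total 0ℤ (B ℤ.+ + 3 ℤ.* M))
      where
      open ResidueForm φ
      negated : ∀ M B → - (B ℤ.+ + 3 ℤ.* M) ≡ - B ℤ.+ + 3 ℤ.* - M
      negated = solve 2 (λ M B → :- (B :+ con (+ 3) :* M) := :- B :+ con (+ 3) :* :- M) refl
        where open ℤ.+-*-Solver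
      by-sign : 0ℤ ℤ.≤ B ℤ.+ + 3 ℤ.* M ⊎ B ℤ.+ + 3 ℤ.* M ℤ.≤ 0ℤ → Result
      by-sign (inj₁ 0≤γ) = nonneg-γ φ 0≤γ
      by-sign (inj₂ γ≤0) = nonneg-γ (negate φ) (subst (0ℤ ℤ.≤_) (negated M B) (ℤ.neg-mono-≤ γ≤0))

-- The case p ≡ 2 modulo 3, and the two cases combined.

module CubicResidues where

  open Congruence
  open Reciprocity using (prime∣prime⇒≡)
  open PrimeDivisors using (Separated; ^∣-cancel)
  open Collect
  open CubicForm using (residueForm)
  open CubicCase using (cubic-case; exponents)
  open import Defs using (CubicResidue)
  open import Data.Integer.Base using (ℤ; +_; ∣_∣; 1ℤ)
  import Data.Integer.Base as ℤ
  open import Data.Integer.Divisibility.Signed as ℤ using (∣ᵤ⇒∣; ∣⇒∣ᵤ)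
  import Data.Integer.Properties as ℤ
  open import Data.Integer.Tactic.RingSolver using (solve-∀)
  open import Data.Nat.Base
  open import Data.Nat.Divisibility
  open import Data.Nat.DivMod using (_%_; _/_; m≡m%n+[m/n]*n; m%n<n)
  open import Data.Nat.Properties
  open import Data.Nat.Solver using (module +-*-Solver)

  IsResidue : ℕ → ℕ → Set
  IsResidue p q = q ≢ p × ∃[ y ] + q ≡ y ℤ.^ 3 [ + p ]

  Found : ℕ → ℕ → Set
  Found p m = ∃[ qs ] (Unique qs
    × All (λ q → Prime q × m < q × q * q ≤ 5000 * p * m ^ 6 × IsResidue p q) qs
    × suc m ≤ 15 * length qs)

  -- With p = 3j + 2, the cube of q^(2j + 1) is q (q^(p - 1))².
  all-cubes : ∀ j → Prime (suc (suc (3 * j))) → ∀ {q} → ¬ + (suc (suc (3 * j))) ℤ.∣ + q →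
    ∃[ y ] + q ≡ y ℤ.^ 3 [ + (suc (suc (3 * j))) ]
  all-cubes j p-prime {q} p∤q = x ℤ.^ (2 * j + 1) , mod-sym (mod-trans (mod-reflexive (begin
    (x ℤ.^ (2 * j + 1)) ℤ.^ 3     ≡⟨ ℤ.^-*-assoc x (2 * j + 1) 3 ⟩
    x ℤ.^ ((2 * j + 1) * 3)       ≡⟨ cong (x ℤ.^_) (lemma j) ⟩
    x ℤ.* x ℤ.^ (suc (3 * j) * 2) ≡⟨ cong (x ℤ.*_) (ℤ.^-*-assoc x (suc (3 * j)) 2) ⟨
    x ℤ.* (x ℤ.^ suc (3 * j)) ℤ.^ 2 ∎))
    (mod-trans (mod-* (mod-refl {a = x}) (mod-^ 2 (PrimeModulus.fermat-unit p-prime p∤q)))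
      (mod-reflexive (ℤ.*-identityʳ x))))
    where
    open ≡-Reasoning
    x : ℤ
    x = + q
    lemma : ∀ j → (2 * j + 1) * 3 ≡ suc (suc (3 * j) * 2)
    lemma = solve 1 (λ j → (con 2 :* j :+ con 1) :* con 3 := con 1 :+ (con 1 :+ con 3 :* j) :* con 2) refl
      where open +-*-Solver

  -- The difference of two values is A(n - m), and a prime dividing a value An + 1 cannot divide A.
  linear-separated : ∀ A N {q} → Prime q → Separated (λ n → A * n + 1) N 1 q
  linear-separated A N {q} q-prime = record { roots = roots ; lifting = lifting }
    where
    open PrimeModulus q-prime
    difference : ∀ m n → + (A * n + 1) ℤ.- + (A * m + 1) ≡ + A ℤ.* (+ n ℤ.- + m)
    difference m n = trans (cong₂ (λ x y → (x ℤ.+ 1ℤ) ℤ.- (y ℤ.+ 1ℤ)) (ℤ.pos-* A n) (ℤ.pos-* A m)) (lemma (+ A) (+ n) (+ m))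
      where
      lemma : ∀ A n m → (A ℤ.* n ℤ.+ 1ℤ) ℤ.- (A ℤ.* m ℤ.+ 1ℤ) ≡ A ℤ.* (n ℤ.- m)
      lemma = solve-∀
    q∤A : ∀ {n} → q ∣ A * n + 1 → ¬ q ∣ A
    q∤A {n} q∣g q∣A = ∤1 (∣ᵤ⇒∣ (∣m+n∣m⇒∣n q∣g (∣m⇒∣m*n n q∣A)))
    congruent : ∀ {m n} k → ¬ q ∣ A → q ^ k ∣ A * m + 1 → q ^ k ∣ A * n + 1 → + n ≡ + m [ + (q ^ k) ]
    congruent {m} {n} k q∤A q∣gm q∣gn = ∣⇒≡ (∣ᵤ⇒∣ (^∣-cancel q-prime k q∤A
      (subst (q ^ k ∣_) (trans (cong ∣_∣ (difference m n)) (ℤ.abs-* (+ A) (+ n ℤ.- + m)))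
        (∣⇒∣ᵤ (ℤ.∣m∣n⇒∣m-n {i = + (q ^ k)} (∣ᵤ⇒∣ {i = + (A * n + 1)} q∣gn) (∣ᵤ⇒∣ {i = + (A * m + 1)} q∣gm))))))
    roots : ∀ zs → AllPairs (λ m n → ¬ + n ≡ + m [ + q ]) zs →
      All (λ n → 1 ≤ n × n ≤ N × q ∣ A * n + 1) zs → length zs ≤ 1
    roots []          _ _ = z≤n
    roots (_ ∷ [])    _ _ = ≤-refl
    roots (m ∷ n ∷ _) ((m≢n ∷ _) ∷ _) ((_ , _ , q∣gm) ∷ (_ , _ , q∣gn) ∷ _) = contradiction
      (subst (λ z → + n ≡ + m [ + z ]) (^-identityʳ q) (congruent 1 (q∤A {m} q∣gm)
        (subst (_∣ A * m + 1) (sym (^-identityʳ q)) q∣gm) (subst (_∣ A * n + 1) (sym (^-identityʳ q)) q∣gn))) m≢n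
    lifting : ∀ {m n} k → 1 ≤ m → n ≤ N → m < n → q ∣ A * m + 1 → + n ≡ + m [ + q ] →
      q ^ k ∣ A * m + 1 → q ^ k ∣ A * n + 1 → + n ≡ + m [ + (q ^ k) ]
    lifting {m} k _ _ _ q∣gm _ = congruent k (q∤A {m} q∣gm)

  -- The choice A = 3m + 1 bounds the values An + 1 with n ≤ 3m by A², so the count gives 3m ≤ 2 (G
  -- + r). Since r ≤ (m + 10)/3, much more than m/15 remains.
  linear-case : ∀ {p m} → 1 ≤ p → 75 ≤ m → (∀ {q} → Prime q → q ≢ p → IsResidue p q) → Found p m
  linear-case {p} {m} 1≤p 75≤m cubes =
    let qs , unique , good , r , 3r≤m+10 , Aᴺ≤ = large-prime-divisors p m {g} {3 * m} {A * A} {A} {1}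
          (linear-separated A (3 * m)) (m≤n+m 1 (3 * m))
          (λ n _ _ → ≤-trans (≤-reflexive (cong (A *_) (*-identityʳ n))) (m≤m+n (A * n) 1))
          (*-mono-≤ (m≤n+m 1 (3 * m)) (m≤n+m 1 (3 * m))) (λ n _ n≤N → g≤A² n≤N)
    in qs , unique
     , All.map (λ {q} (q-prime , m<q , q≢p , n , _ , n≤N , q∣gn) →
         let q≤A² = ≤-trans (∣⇒≤ {{>-nonZero (m≤n+m 1 (A * n))}} q∣gn) (g≤A² n≤N) in
         q-prime , m<q , ≤-trans (*-mono-≤ q≤A² q≤A²) A⁴≤ , cubes q-prime q≢p) good
     , enough (length qs) r 3r≤m+10 (exponents 2 1 (3 * m) (1 * (length qs + r)) 1<A
         (≤-reflexive (lemma₁ A)) Aᴺ≤)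
    where
    open ≤-Reasoning
    open +-*-Solver
    A = 3 * m + 1
    g : ℕ → ℕ
    g n = A * n + 1
    1<A : 1 < A
    1<A = +-monoˡ-≤ 1 (≤-trans (s≤s z≤n) (≤-trans 75≤m (m≤m+n m (2 * m))))
    lemma₁ : ∀ A → (A * A) ^ 1 ≡ A ^ 2
    lemma₁ = solve 1 (λ A → (A :* A) :^ 1 := A :^ 2) refl
    g≤A² : ∀ {n} → n ≤ 3 * m → g n ≤ A * A
    g≤A² {n} n≤3m = begin
      A * n + 1           ≤⟨ +-mono-≤ (*-monoʳ-≤ A n≤3m) (<⇒≤ 1<A) ⟩
      A * (3 * m) + A     ≡⟨ lemma A (3 * m) ⟩
      A * A               ∎
      where
      lemma : ∀ A x → A * x + A ≡ A * (x + 1)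
      lemma = solve 2 (λ A x → A :* x :+ A := A :* (x :+ con 1)) refl
    1≤m : 1 ≤ m
    1≤m = ≤-trans (s≤s z≤n) 75≤m
    A≤4m : A ≤ 4 * m
    A≤4m = ≤-trans (+-monoʳ-≤ (3 * m) 1≤m) (≤-reflexive (solve 1 (λ m → con 3 :* m :+ m := con 4 :* m) refl m))
    A⁴≤ : A * A * (A * A) ≤ 5000 * p * m ^ 6
    A⁴≤ = begin
      A * A * (A * A)                        ≤⟨ *-mono-≤ (*-mono-≤ A≤4m A≤4m) (*-mono-≤ A≤4m A≤4m) ⟩
      4 * m * (4 * m) * (4 * m * (4 * m))    ≡⟨ solve 1 (λ m → con 4 :* m :* (con 4 :* m) :* (con 4 :* m :* (con 4 :* m)) :=
                                                  con 256 :* m :^ 4) refl m ⟩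
      256 * m ^ 4                            ≤⟨ *-mono-≤ (from-yes (256 ≤? 5000)) (^-monoʳ-≤ m {{>-nonZero 1≤m}} (from-yes (4 ≤? 6))) ⟩
      5000 * m ^ 6                           ≤⟨ *-monoˡ-≤ (m ^ 6) (m≤m*n 5000 p {{>-nonZero 1≤p}}) ⟩
      5000 * p * m ^ 6                       ∎
    enough : ∀ G r → 3 * r ≤ m + 10 → 3 * m * 1 ≤ 2 * (1 * (G + r)) → suc m ≤ 15 * G
    enough G r 3r≤m+10 3m≤ = *-cancelˡ-≤ 6 (+-cancelʳ-≤ (30 * m + 300) _ _ (begin
      6 * suc m + (30 * m + 300)            ≡⟨ solve 1 (λ m → con 6 :* (con 1 :+ m) :+ (con 30 :* m :+ con 300) := con 36 :* m :+ con 306) refl m ⟩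
      36 * m + 306                          ≤⟨ +-monoʳ-≤ (36 * m) (≤-trans (from-yes (306 ≤? 99 * 75)) (*-monoʳ-≤ 99 75≤m)) ⟩
      36 * m + 99 * m                       ≡⟨ solve 1 (λ m → con 36 :* m :+ con 99 :* m := con 45 :* (con 3 :* m :* con 1)) refl m ⟩
      45 * (3 * m * 1)                      ≤⟨ *-monoʳ-≤ 45 3m≤ ⟩
      45 * (2 * (1 * (G + r)))              ≡⟨ solve 2 (λ G r → con 45 :* (con 2 :* (con 1 :* (G :+ r))) :=
                                                 con 6 :* (con 15 :* G) :+ con 30 :* (con 3 :* r)) refl G r ⟩
      6 * (15 * G) + 30 * (3 * r)           ≤⟨ +-monoʳ-≤ (6 * (15 * G)) (*-monoʳ-≤ 30 3r≤m+10) ⟩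
      6 * (15 * G) + 30 * (m + 10)          ≡⟨ cong (λ z → 6 * (15 * G) + z) (*-distribˡ-+ 30 m 10) ⟩
      6 * (15 * G) + (30 * m + 300)         ∎))

  many-cubic-residues : ∀ {p m} → Prime p → 2 ^ 139 ≤ p → 75 ≤ m → m ^ 6 ≤ 2 * p → Found p m
  many-cubic-residues {p} {m} p-prime 2¹³⁹≤p 75≤m m⁶≤2p =
    by-remainder (p % 3) (p / 3) (m%n<n p 3) (m≡m%n+[m/n]*n p 3) p-prime 2¹³⁹≤p m⁶≤2p
    where
    by-remainder : ∀ {p} r k → r < 3 → p ≡ r + k * 3 → Prime p → 2 ^ 139 ≤ p → m ^ 6 ≤ 2 * p → Found p m
    by-remainder 0 k _ refl p-prime 2¹³⁹≤p _ with prime⇒irreducible p-prime (n∣m*n k {3})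
    ... | inj₂ 3≡p = contradiction (≤-trans 2¹³⁹≤p (≤-reflexive (sym 3≡p))) (from-no-yes)
      where
      from-no-yes : ¬ 2 ^ 139 ≤ 3
      from-no-yes = <⇒≱ (from-yes (3 <? 2 ^ 139))
    by-remainder 1 k _ refl p-prime 2¹³⁹≤p m⁶≤2p rewrite *-comm k 3 =
      cubic-case p-prime 2¹³⁹≤p 75≤m m⁶≤2p (residueForm k p-prime)
    by-remainder 2 k _ refl p-prime _ _ rewrite *-comm k 3 =
      linear-case (s≤s z≤n) 75≤m (λ q-prime q≢p → q≢p ,
        all-cubes k p-prime (λ p∣q → q≢p (sym (prime∣prime⇒≡ p-prime q-prime p∣q))))
    by-remainder (suc (suc (suc _))) k (s≤s (s≤s (s≤s ())))

  residue⇒CubicResidue : ∀ {p q} → Prime p → Prime q → IsResidue p q → CubicResidue p q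
  residue⇒CubicResidue p-prime q-prime (q≢p , y , ∣⇒≡ d) =
    (λ p∣q → q≢p (sym (prime∣prime⇒≡ p-prime q-prime (∣ᵤ⇒∣ p∣q)))) , y , ∣⇒∣ᵤ d

-- Rational arithmetic and rational powers of p without roots.

module RationalPowers where

  open import Defs using (ι; _^_; _^ᶻ_; 0≤_≤_^^_)
  open import Data.Integer.Base as ℤ using (ℤ; +_; -[1+_])
  import Data.Integer.Properties as ℤ
  open import Data.Integer.Solver using () renaming (module +-*-Solver to ℤ-Solver)
  open import Data.Nat.Solver using () renaming (module +-*-Solver to ℕ-Solver)
  open PrimeDivisors using () renaming (^-distribʳ-* to ℕ-^-distribʳ-*)
  open import Data.Rational.Base
  open import Data.Rational.Properties
  import Data.Rational.Unnormalised.Base as ℚᵘ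
  import Data.Rational.Unnormalised.Properties as ℚᵘ
  open import Algebra.Bundles using (CommutativeRing)
  open CommutativeRing +-*-commutativeRing using () renaming (commutativeSemiring to ℚ-commutativeSemiring; semiring to ℚ-semiring)
  open import Algebra.Properties.Semiring.Exp ℚ-semiring using (^-assocʳ)
  open import Algebra.Properties.CommutativeSemiring.Exp ℚ-commutativeSemiring using (^-distrib-*)

  /-≃ : ∀ a b .{{_ : ℕ.NonZero b}} → toℚᵘ (+ a / b) ℚᵘ.≃ (ℚᵘ._/_ (+ a) b)
  /-≃ a (suc b) = toℚᵘ-fromℚᵘ (ℚᵘ.mkℚᵘ (+ a) b)

  /-mono-≤ : ∀ a b c d .{{_ : ℕ.NonZero b}} .{{_ : ℕ.NonZero d}} →
    a ℕ.* d ℕ.≤ c ℕ.* b → + a / b ≤ + c / d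
  /-mono-≤ a b@(suc _) c d@(suc _) ad≤cb = toℚᵘ-cancel-≤
    (ℚᵘ.≤-respˡ-≃ (ℚᵘ.≃-sym (/-≃ a b)) (ℚᵘ.≤-respʳ-≃ (ℚᵘ.≃-sym (/-≃ c d))
      (ℚᵘ.*≤* (subst₂ ℤ._≤_ (ℤ.pos-* a d) (ℤ.pos-* c b) (ℤ.+≤+ ad≤cb)))))

  /-cancel-≤ : ∀ a b c d .{{_ : ℕ.NonZero b}} .{{_ : ℕ.NonZero d}} →
    + a / b ≤ + c / d → a ℕ.* d ℕ.≤ c ℕ.* b
  /-cancel-≤ a b@(suc _) c d@(suc _) a/b≤c/d = ℤ.drop‿+≤+ (subst₂ ℤ._≤_
    (sym (ℤ.pos-* a d)) (sym (ℤ.pos-* c b)) (ℚᵘ.drop-*≤*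
      (ℚᵘ.≤-respˡ-≃ (/-≃ a b) (ℚᵘ.≤-respʳ-≃ (/-≃ c d) (toℚᵘ-mono-≤ a/b≤c/d)))))

  ι-mono-≤ : ∀ {m n} → m ℕ.≤ n → ι m ≤ ι n
  ι-mono-≤ {m} {n} m≤n = /-mono-≤ m 1 n 1 (ℕ.*-monoˡ-≤ 1 m≤n)

  ι-cancel-≤ : ∀ {m n} → ι m ≤ ι n → m ℕ.≤ n
  ι-cancel-≤ {m} {n} ιm≤ιn = ℕ.*-cancelʳ-≤ m n 1 (/-cancel-≤ m 1 n 1 ιm≤ιn)

  ι-mono-< : ∀ {m n} → m ℕ.< n → ι m < ι n
  ι-mono-< m<n = ≰⇒> λ ιn≤ιm → ℕ.<⇒≱ m<n (ι-cancel-≤ ιn≤ιm)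

  /-* : ∀ m n b .{{_ : ℕ.NonZero b}} → (+ m / b) * ι n ≡ + (m ℕ.* n) / b
  /-* m n b@(suc b-1) = toℚᵘ-injective (ℚᵘ.≃-trans (toℚᵘ-homo-* (+ m / b) (ι n))
    (ℚᵘ.≃-trans (ℚᵘ.*-cong (/-≃ m b) (/-≃ n 1))
      (ℚᵘ.≃-trans (ℚᵘ.*≡* (cong₂ ℤ._*_ (sym (ℤ.pos-* m n)) (cong +_ (sym (ℕ.*-identityʳ b)))))
        (ℚᵘ.≃-sym (/-≃ (m ℕ.* n) b)))))

  ι-* : ∀ m n → ι m * ι n ≡ ι (m ℕ.* n)
  ι-* m n = /-* m n 1

  ι-^ : ∀ m k → ι m ^ k ≡ ι (m ℕ.^ k)
  ι-^ m zero    = refl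
  ι-^ m (suc k) = trans (cong (ι m *_) (ι-^ m k)) (ι-* m (m ℕ.^ k))

  0≤ι : ∀ n → 0ℚ ≤ ι n
  0≤ι n = ι-mono-≤ {0} {n} ℕ.z≤n

  *-mono-≤ : ∀ {r s t u} → 0ℚ ≤ r → 0ℚ ≤ u → r ≤ s → t ≤ u → r * t ≤ s * u
  *-mono-≤ {r} {s} {t} {u} 0≤r 0≤u r≤s t≤u = ≤-trans
    (*-monoˡ-≤-nonNeg r {{nonNegative 0≤r}} t≤u) (*-monoʳ-≤-nonNeg u {{nonNegative 0≤u}} r≤s)

  0≤* : ∀ {s t} → 0ℚ ≤ s → 0ℚ ≤ t → 0ℚ ≤ s * t
  0≤* {s} {t} 0≤s 0≤t = subst (_≤ s * t) (*-zeroˡ 0ℚ) (*-mono-≤ ≤-refl 0≤t 0≤s 0≤t)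

  0≤^ : ∀ {s} → 0ℚ ≤ s → ∀ k → 0ℚ ≤ s ^ k
  0≤^ 0≤s zero    = 0≤ι 1
  0≤^ 0≤s (suc k) = 0≤* 0≤s (0≤^ 0≤s k)

  ^-mono-≤ : ∀ {s t} → 0ℚ ≤ s → s ≤ t → ∀ k → s ^ k ≤ t ^ k
  ^-mono-≤ 0≤s s≤t zero    = ≤-refl
  ^-mono-≤ 0≤s s≤t (suc k) = *-mono-≤ 0≤s (0≤^ (≤-trans 0≤s s≤t) k) s≤t (^-mono-≤ 0≤s s≤t k)

  ^-mono-< : ∀ {s t} → 0ℚ ≤ s → s < t → ∀ k → s ^ suc k < t ^ suc k
  ^-mono-< {s} {t} 0≤s s<t k = ≤-<-trans
    (*-monoˡ-≤-nonNeg s {{nonNegative 0≤s}} (^-mono-≤ 0≤s (<⇒≤ s<t) k))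
    (*-monoˡ-<-pos (t ^ k) {{positive (0<t^ k)}} s<t)
    where
    0<t = ≤-<-trans 0≤s s<t
    0<t^ : ∀ k → 0ℚ < t ^ k
    0<t^ zero    = ι-mono-< {0} {1} ℕ.z<s
    0<t^ (suc k) = positive⁻¹ (t * t ^ k) {{pos*pos⇒pos t {{positive 0<t}} (t ^ k) {{positive (0<t^ k)}}}}

  ^-cancel-≤ : ∀ {s t} k .{{_ : ℕ.NonZero k}} → 0ℚ ≤ t → s ^ k ≤ t ^ k → s ≤ t
  ^-cancel-≤ {s} {t} (suc k) 0≤t sᵏ≤tᵏ = ≮⇒≥ λ t<s → <-irrefl refl (<-≤-trans (^-mono-< 0≤t t<s k) sᵏ≤tᵏ)

  ^-exchange : ∀ s i j → (s ^ i) ^ j ≡ (s ^ j) ^ i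
  ^-exchange s i j = trans (^-assocʳ s i j) (trans (cong (s ^_) (ℕ.*-comm i j)) (sym (^-assocʳ s j i)))

  /-*-/ : ∀ a b c d .{{_ : ℕ.NonZero b}} .{{_ : ℕ.NonZero d}} .{{_ : ℕ.NonZero (b ℕ.* d)}} →
    (+ a / b) * (+ c / d) ≡ + (a ℕ.* c) / (b ℕ.* d)
  /-*-/ a b@(suc _) c d@(suc _) = toℚᵘ-injective (ℚᵘ.≃-trans (toℚᵘ-homo-* (+ a / b) (+ c / d))
    (ℚᵘ.≃-trans (ℚᵘ.*-cong (/-≃ a b) (/-≃ c d))
      (ℚᵘ.≃-trans (ℚᵘ.*≡* (cong (ℤ._* + (b ℕ.* d)) (sym (ℤ.pos-* a c))))
        (ℚᵘ.≃-sym (/-≃ (a ℕ.* c) (b ℕ.* d))))))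

  /-^ : ∀ a b k .{{_ : ℕ.NonZero b}} .{{_ : ℕ.NonZero (b ℕ.^ k)}} →
    (+ a / b) ^ k ≡ + (a ℕ.^ k) / (b ℕ.^ k)
  /-^ a b zero    = refl
  /-^ a b (suc k) = trans (cong ((+ a / b) *_) (/-^ a b k)) (/-*-/ a b (a ℕ.^ k) (b ℕ.^ k))
    where instance _ = ℕ.m^n≢0 b k

  -- The numerals α/β and κ record the losses allowed: m is shrunk by α/β while q is divided by κ.
  sixth-power-comparison : ∀ {q m p} c α β κ .{{_ : ℕ.NonZero β}} .{{_ : ℕ.NonZero κ}} →
    q ℕ.* q ℕ.≤ c ℕ.* p ℕ.* m ℕ.^ 6 → c ℕ.* β ℕ.^ 6 ℕ.≤ κ ℕ.^ 2 ℕ.* α ℕ.^ 6 →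
    (+ q / κ) ^ 2 ≤ ι p * (+ (α ℕ.* m) / β) ^ 6
  sixth-power-comparison {q} {m} {p} c α β κ q²≤ cβ⁶≤ = subst₂ _≤_ (sym (/-^ q κ 2))
    (sym (trans (cong (ι p *_) (/-^ (α ℕ.* m) β 6)) (/-*-/ p 1 ((α ℕ.* m) ℕ.^ 6) (β ℕ.^ 6))))
    (/-mono-≤ (q ℕ.^ 2) (κ ℕ.^ 2) (p ℕ.* (α ℕ.* m) ℕ.^ 6) (1 ℕ.* β ℕ.^ 6) (begin
      q ℕ.^ 2 ℕ.* (1 ℕ.* β ℕ.^ 6)                      ≡⟨ lemma₁ q (β ℕ.^ 6) ⟩
      q ℕ.* q ℕ.* β ℕ.^ 6                             ≤⟨ ℕ.*-monoˡ-≤ (β ℕ.^ 6) q²≤ ⟩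
      c ℕ.* p ℕ.* m ℕ.^ 6 ℕ.* β ℕ.^ 6                 ≡⟨ lemma₂ c p (m ℕ.^ 6) (β ℕ.^ 6) ⟩
      c ℕ.* β ℕ.^ 6 ℕ.* (p ℕ.* m ℕ.^ 6)               ≤⟨ ℕ.*-monoˡ-≤ (p ℕ.* m ℕ.^ 6) cβ⁶≤ ⟩
      κ ℕ.^ 2 ℕ.* α ℕ.^ 6 ℕ.* (p ℕ.* m ℕ.^ 6)         ≡⟨ lemma₃ (κ ℕ.^ 2) (α ℕ.^ 6) p (m ℕ.^ 6) ⟩
      p ℕ.* (α ℕ.^ 6 ℕ.* m ℕ.^ 6) ℕ.* κ ℕ.^ 2         ≡⟨ cong (λ z → p ℕ.* z ℕ.* κ ℕ.^ 2) (ℕ-^-distribʳ-* α m 6) ⟨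
      p ℕ.* (α ℕ.* m) ℕ.^ 6 ℕ.* κ ℕ.^ 2               ∎))
    where
    open ℕ.≤-Reasoning
    open ℕ-Solver
    instance
      _ = ℕ.m^n≢0 β 6
      _ = ℕ.m^n≢0 κ 2
      _ = ℕ.m*n≢0 1 (β ℕ.^ 6)
    lemma₁ : ∀ q b → q ℕ.^ 2 ℕ.* (1 ℕ.* b) ≡ q ℕ.* q ℕ.* b
    lemma₁ = solve 2 (λ q b → q :^ 2 :* (con 1 :* b) := q :* q :* b) refl
    lemma₂ : ∀ c p x b → c ℕ.* p ℕ.* x ℕ.* b ≡ c ℕ.* b ℕ.* (p ℕ.* x)
    lemma₂ = solve 4 (λ c p x b → c :* p :* x :* b := c :* b :* (p :* x)) refl
    lemma₃ : ∀ k a p x → k ℕ.* a ℕ.* (p ℕ.* x) ≡ p ℕ.* (a ℕ.* x) ℕ.* k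
    lemma₃ = solve 4 (λ k a p x → k :* a :* (p :* x) := p :* (a :* x) :* k) refl

  cross-multiply : ∀ r k n .{{_ : ℕ.NonZero n}} → toℚᵘ r ℚᵘ.≃ (ℚᵘ._/_ (+ k) n) → ↥ r ℤ.* + n ≡ + k ℤ.* + ↧ₙ r
  cross-multiply record{} k (suc _) (ℚᵘ.*≡* eq) = eq

  negative≢+ : ∀ j n .{{_ : ℕ.NonZero n}} {x} → ¬ -[1+ j ] ℤ.* + n ≡ + x
  negative≢+ j (suc n) ()

  module _ {p : ℕ} .{{p≢0 : ℕ.NonZero p}} where

    -- A negative exponent would bound a power of `t` by some p^(-k) ≤ 1.
    natural-exponent : ∀ {r t} → 1ℚ < t → 0≤ t ≤ p ^^ r →
      ∃[ a ] (↥ r ≡ + a × t ^ ↧ₙ r ≤ ι (p ℕ.^ a))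
    natural-exponent {r} {t} 1<t (_ , tᵇ≤) = by-sign (↥ r) refl
      where
      by-sign : ∀ i → ↥ r ≡ i → ∃[ a ] (↥ r ≡ + a × t ^ ↧ₙ r ≤ ι (p ℕ.^ a))
      by-sign (+ a) eq = a , eq , subst (λ i → t ^ ↧ₙ r ≤ p ^ᶻ i) eq tᵇ≤
      by-sign -[1+ k ] eq = contradiction (^-cancel-≤ (↧ₙ r) (0≤ι 1) (≤-trans
        (subst (λ i → t ^ ↧ₙ r ≤ p ^ᶻ i) eq tᵇ≤)
        (≤-trans (/-mono-≤ 1 (p ℕ.^ suc k) 1 1 {{ℕ.m^n≢0 p (suc k)}} (ℕ.*-monoʳ-≤ 1 (ℕ.m^n>0 p (suc k))))
          (≤-reflexive (sym (trans (ι-^ 1 (↧ₙ r)) (cong ι (ℕ.^-zeroˡ (↧ₙ r)))))))))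
        (λ t≤1 → <-irrefl refl (<-≤-trans 1<t t≤1))

    sixth-root : ∀ {t} a b .{{_ : ℕ.NonZero b}} → 0ℚ ≤ t → t ^ b ≤ ι (p ℕ.^ a) → 6 ℕ.* a ℕ.≤ b → t ^ 6 ≤ ι p
    sixth-root {t} a b 0≤t tᵇ≤pᵃ 6a≤b = ^-cancel-≤ b (0≤ι p) (begin
      (t ^ 6) ^ b             ≡⟨ ^-exchange t 6 b ⟩
      (t ^ b) ^ 6             ≤⟨ ^-mono-≤ (0≤^ 0≤t b) tᵇ≤pᵃ 6 ⟩
      ι (p ℕ.^ a) ^ 6         ≡⟨ trans (ι-^ (p ℕ.^ a) 6) (cong ι (trans (ℕ.^-*-assoc p a 6) (cong (p ℕ.^_) (ℕ.*-comm a 6)))) ⟩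
      ι (p ℕ.^ (6 ℕ.* a))     ≤⟨ ι-mono-≤ (ℕ.^-monoʳ-≤ p 6a≤b) ⟩
      ι (p ℕ.^ b)             ≡⟨ ι-^ p b ⟨
      ι p ^ b                 ∎)
      where open ≤-Reasoning

    -- From w² ≤ p t⁶ and t ≤ p^(a/b): w ≤ p^(1/2 + 3a/b).
    half-plus-triple : ∀ {w t} a b .{{_ : ℕ.NonZero b}} .{{_ : ℕ.NonZero (2 ℕ.* b)}} → 0ℚ ≤ w → 0ℚ ≤ t →
      w ^ 2 ≤ ι p * t ^ 6 → t ^ b ≤ ι (p ℕ.^ a) → 0≤ w ≤ p ^^ (+ (b ℕ.+ 6 ℕ.* a) / (2 ℕ.* b))
    half-plus-triple {w} {t} a b 0≤w 0≤t w²≤ tᵇ≤ = 0≤w , by-sign (↥ R) refl cross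
      where
      k = b ℕ.+ 6 ℕ.* a
      n = 2 ℕ.* b
      R = + k / n
      D = ↧ₙ R
      cross : ↥ R ℤ.* + n ≡ + (k ℕ.* D)
      cross = trans (cross-multiply R k n (/-≃ k n)) (sym (ℤ.pos-* k D))
      by-sign : ∀ i → ↥ R ≡ i → i ℤ.* + n ≡ + (k ℕ.* D) → w ^ D ≤ p ^ᶻ ↥ R
      by-sign -[1+ j ] _ eq = contradiction eq (negative≢+ j n)
      by-sign (+ E) ↥R≡E eq = subst (λ i → w ^ D ≤ p ^ᶻ i) (sym ↥R≡E) (^-cancel-≤ n (0≤ι (p ℕ.^ E)) (begin
        (w ^ D) ^ n                      ≡⟨ trans (^-assocʳ w D n) (trans (cong (w ^_) (lemma D b)) (sym (^-assocʳ w 2 (D ℕ.* b)))) ⟩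
        (w ^ 2) ^ (D ℕ.* b)              ≤⟨ ^-mono-≤ (0≤^ 0≤w 2) w²≤ (D ℕ.* b) ⟩
        (ι p * t ^ 6) ^ (D ℕ.* b)        ≡⟨ ^-distrib-* (ι p) (t ^ 6) (D ℕ.* b) ⟩
        ι p ^ (D ℕ.* b) * (t ^ 6) ^ (D ℕ.* b)
          ≡⟨ cong₂ _*_ (ι-^ p (D ℕ.* b)) (trans (^-assocʳ t 6 (D ℕ.* b)) (trans (cong (t ^_) (lemma′ D b)) (sym (^-assocʳ t b (6 ℕ.* D))))) ⟩
        ι (p ℕ.^ (D ℕ.* b)) * (t ^ b) ^ (6 ℕ.* D)
          ≤⟨ *-monoˡ-≤-nonNeg (ι (p ℕ.^ (D ℕ.* b))) {{nonNegative (0≤ι (p ℕ.^ (D ℕ.* b)))}} (^-mono-≤ (0≤^ 0≤t b) tᵇ≤ (6 ℕ.* D)) ⟩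
        ι (p ℕ.^ (D ℕ.* b)) * ι (p ℕ.^ a) ^ (6 ℕ.* D)
          ≡⟨ trans (cong (ι (p ℕ.^ (D ℕ.* b)) *_) (trans (ι-^ (p ℕ.^ a) (6 ℕ.* D)) (cong ι (ℕ.^-*-assoc p a (6 ℕ.* D)))))
               (trans (ι-* (p ℕ.^ (D ℕ.* b)) _) (cong ι (sym (ℕ.^-distribˡ-+-* p (D ℕ.* b) (a ℕ.* (6 ℕ.* D)))))) ⟩
        ι (p ℕ.^ (D ℕ.* b ℕ.+ a ℕ.* (6 ℕ.* D)))
          ≡⟨ cong (λ e → ι (p ℕ.^ e)) (trans (lemma″ D b a) (sym (ℤ.+-injective (trans (ℤ.pos-* E n) eq)))) ⟩
        ι (p ℕ.^ (E ℕ.* n))              ≡⟨ trans (ι-^ (p ℕ.^ E) n) (cong ι (ℕ.^-*-assoc p E n)) ⟨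
        ι (p ℕ.^ E) ^ n                  ∎))
        where
        open ≤-Reasoning
        open ℕ-Solver
        lemma : ∀ D b → D ℕ.* (2 ℕ.* b) ≡ 2 ℕ.* (D ℕ.* b)
        lemma = solve 2 (λ D b → D :* (con 2 :* b) := con 2 :* (D :* b)) refl
        lemma′ : ∀ D b → 6 ℕ.* (D ℕ.* b) ≡ b ℕ.* (6 ℕ.* D)
        lemma′ = solve 2 (λ D b → con 6 :* (D :* b) := b :* (con 6 :* D)) refl
        lemma″ : ∀ D b a → D ℕ.* b ℕ.+ a ℕ.* (6 ℕ.* D) ≡ (b ℕ.+ 6 ℕ.* a) ℕ.* D
        lemma″ = solve 3 (λ D b a → D :* b :+ a :* (con 6 :* D) := (b :+ con 6 :* a) :* D) refl

  half-plus-triple-value : ∀ a b .{{_ : ℕ.NonZero b}} .{{_ : ℕ.NonZero (2 ℕ.* b)}} →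
    + (b ℕ.+ 6 ℕ.* a) / (2 ℕ.* b) ≡ ½ + ι 3 * (+ a / b)
  half-plus-triple-value a b@(suc _) = toℚᵘ-injective (ℚᵘ.≃-trans (/-≃ (b ℕ.+ 6 ℕ.* a) (2 ℕ.* b))
    (ℚᵘ.≃-sym (ℚᵘ.≃-trans (toℚᵘ-homo-+ ½ (ι 3 * (+ a / b)))
      (ℚᵘ.≃-trans (ℚᵘ.+-congʳ (toℚᵘ ½) (ℚᵘ.≃-trans (toℚᵘ-homo-* (ι 3) (+ a / b)) (ℚᵘ.*-congˡ {toℚᵘ (ι 3)} (/-≃ a b))))
        (ℚᵘ.*≡* equation)))))
    where
    open ℤ-Solver
    equation : (+ 1 ℤ.* + (1 ℕ.* b) ℤ.+ (+ 3 ℤ.* + a) ℤ.* + 2) ℤ.* + (2 ℕ.* b) ≡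
      + (b ℕ.+ 6 ℕ.* a) ℤ.* + (2 ℕ.* (1 ℕ.* b))
    equation = trans
      (cong₂ (λ z w → (+ 1 ℤ.* z ℤ.+ (+ 3 ℤ.* + a) ℤ.* + 2) ℤ.* w) (ℤ.pos-* 1 b) (ℤ.pos-* 2 b))
      (trans (solve 2 (λ a b → (con (+ 1) :* (con (+ 1) :* b) :+ (con (+ 3) :* a) :* con (+ 2)) :* (con (+ 2) :* b) :=
          (b :+ con (+ 6) :* a) :* (con (+ 2) :* (con (+ 1) :* b))) refl (+ a) (+ b))
        (sym (cong₂ ℤ._*_ (cong (ℤ._+_ (+ b)) (ℤ.pos-* 6 a))
          (trans (ℤ.pos-* 2 (1 ℕ.* b)) (cong (+ 2 ℤ.*_) (ℤ.pos-* 1 b))))))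

-- Passage to real numbers, and the final count.

open import Defs
open RationalPowers
open Collect using (unique-⊆⇒length≤)
open CubicCase using (sixth-power-bound)
open CubicResidues using (Found; IsResidue; many-cubic-residues; residue⇒CubicResidue)
open import Axiom.ExcludedMiddle using (ExcludedMiddle)
open import Data.Integer.Base as ℤ using (ℤ; +_; -[1+_])
import Data.Integer.Properties as ℤ
open import Data.List.Membership.Propositional.Properties using (∈-filter⁺; ∈-filter⁻; ∈-upTo⁺)
open import Data.Nat.Base as ℕ using (ℕ; zero; suc; _!)
open import Data.Rational.Base
open import Data.Rational.Properties
open import Function.Bundles using (mk⇔)
open import Relation.Nullary.Decidable using (Dec; yes; no; from-yes; decidable-stable)

<⇒≱ : ∀ {r s} → r < s → ¬ s ≤ r
<⇒≱ r<s s≤r = <-irrefl refl (<-≤-trans r<s s≤r)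

0≤expTerm : ∀ n k → 0ℚ ≤ expTerm n k
0≤expTerm n k = /-mono-≤ 0 1 (n ℕ.^ k) (k !) {{_}} {{k ℕ.!≢0}} ℕ.z≤n

0≤expSum : ∀ n N → 0ℚ ≤ expSum n N
0≤expSum n zero    = ≤-refl
0≤expSum n (suc N) = ≤-trans (0≤expSum n N)
  (subst (_≤ expSum n N + expTerm n N) (+-identityʳ (expSum n N)) (+-monoʳ-≤ (expSum n N) (0≤expTerm n N)))

expTerm≤expSum : ∀ n N → expTerm n N ≤ expSum n (suc N)
expTerm≤expSum n N = subst (_≤ expSum n N + expTerm n N) (+-identityˡ (expTerm n N))
  (+-monoˡ-≤ (expTerm n N) (0≤expSum n N))

-- The single term n^k / k! of the exponential series is already a lower bound.
exp≤⇒power≤ : ∀ n p k → exp n ≤ʳ ⌜ ι p ⌝ → n ℕ.^ k ℕ.≤ p ℕ.* k !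
exp≤⇒power≤ n p k exp≤p = subst (ℕ._≤ p ℕ.* k !) (ℕ.*-identityʳ (n ℕ.^ k))
  (/-cancel-≤ (n ℕ.^ k) (k !) p 1 {{k ℕ.!≢0}} (≤-trans (expTerm≤expSum n k) (≮⇒≥ λ p<S →
    let s , p<s , s<S = <-dense p<S
        a , a≡p , s<a = exp≤p (expSum n (suc k) , (suc k , refl) , s<S)
    in <-irrefl refl (<-trans p<s (subst (s <_) a≡p s<a)))))

exp≤⇒≤ : ∀ {n p} B k → B ℕ.* k ! ℕ.≤ n ℕ.^ k → exp n ≤ʳ ⌜ ι p ⌝ → B ℕ.≤ p
exp≤⇒≤ {n} {p} B k Bk!≤nᵏ exp≤p = ℕ.*-cancelʳ-≤ B p (k !) {{k ℕ.!≢0}}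
  (ℕ.≤-trans Bk!≤nᵏ (exp≤⇒power≤ n p k exp≤p))

-- The terms 100^k / k! are largest at k = 99 and k = 100, and that value still exceeds 2^139,
-- against e^100 of about 2^144.
exp100-bound : ∀ {p} → exp 100 ≤ʳ ⌜ ι p ⌝ → 2 ℕ.^ 139 ℕ.≤ p
exp100-bound {p} = exp≤⇒≤ {100} {p} (2 ℕ.^ 139) 100 (from-yes (2 ℕ.^ 139 ℕ.* 100 ! ℕ.≤? 100 ℕ.^ 100))

above : ∀ u → ∃[ n ] u < ι n
above u = suc ℤ.∣ ↥ u ∣ , ≤-<-trans (bound u) (ι-mono-< (ℕ.n<1+n ℤ.∣ ↥ u ∣))
  where
  bound : ∀ u → u ≤ ι ℤ.∣ ↥ u ∣
  bound u@(mkℚ (+ a) d-1 _) = subst (_≤ ι a) (↥p/↧p≡p u)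
    (/-mono-≤ a (suc d-1) a 1 (ℕ.*-monoʳ-≤ a (ℕ.s≤s ℕ.z≤n)))
  bound (mkℚ -[1+ a ] d-1 c) = ≤-trans (<⇒≤ (negative⁻¹ (mkℚ -[1+ a ] d-1 c))) (0≤ι (suc a))

-- This is `⌜ ι m ⌝ ≤ʳ x` with the embedding unfolded. Membership of `ι m` in the cut would be too
-- strong: cuts are open, and x may equal m.
ι≤ : ℝ → ℕ → Set
ι≤ x m = ∀ {s} → s < ι m → lower x s

module Classical (em : ExcludedMiddle 0ℓ) (x : ℝ) where

  -- The floor of x, reached by climbing from `m₀`; a rational outside the cut bounds the number of
  -- steps.
  integer-part : ∀ {m₀} → ι≤ x m₀ → ∃[ m ] (m₀ ℕ.≤ m × ι≤ x m × ¬ ι≤ x (suc m))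
  integer-part {m₀} base = let u , u∉x = proper x ; k , u<k = above u in
    search k m₀ ℕ.≤-refl base λ ιk≤x → u∉x (ιk≤x (<-≤-trans u<k (ι-mono-≤ (ℕ.m≤m+n k m₀))))
    where
    search : ∀ k m → m₀ ℕ.≤ m → ι≤ x m → ¬ ι≤ x (k ℕ.+ m) →
      ∃[ m ] (m₀ ℕ.≤ m × ι≤ x m × ¬ ι≤ x (suc m))
    search zero    m _    ιm≤x ιm≰x = contradiction (λ {s} → ιm≤x {s}) ιm≰x
    search (suc k) m m₀≤m ιm≤x ιk+m≰x = by-cases em
      where
      by-cases : Dec (ι≤ x (suc m)) → ∃[ m ] (m₀ ℕ.≤ m × ι≤ x m × ¬ ι≤ x (suc m))
      by-cases (no ιm+1≰x)  = m , m₀≤m , (λ {s} → ιm≤x {s}) , ιm+1≰x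
      by-cases (yes ιm+1≤x) = search k (suc m) (ℕ.m≤n⇒m≤1+n m₀≤m) ιm+1≤x
        (subst (λ n → ¬ ι≤ x n) (sym (ℕ.+-suc k m)) ιk+m≰x)

  -- A witness is drawn from the failure of a universal statement, which takes double negation
  -- elimination both for its existence and for membership in the cut.
  not-below : ∀ {m} → ¬ ι≤ x m → ∃[ s ] (s < ι m × ¬ lower x s)
  not-below {m} ιm≰x = decidable-stable em λ none → ιm≰x λ {s} s<m →
    decidable-stable em λ s∉x → none (s , s<m , s∉x)

module _ (em : ExcludedMiddle 0ℓ) (ε : ℝ) (ε≤½ : ε ≤ʳ ⌜ ½ ⌝) (p : ℕ) .{{_ : ℕ.NonZero p}} where

  private
    X : ℝ
    X = p ^ʳ ((+ 1 / 3) ·ʳ ε)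

  -- Every s < X with s ≥ 1 lies below some t ≤ p^(a/b), where 3a/b < ε.
  record Approximation (s : ℚ) : Set where
    field
      t         : ℚ
      s<t       : s < t
      a b       : ℕ
      {{b≢0}}   : ℕ.NonZero b
      tᵇ≤pᵃ     : t ^ b ≤ ι (p ℕ.^ a)
      e         : ℚ
      e∈ε       : lower ε e
      a/b<e/3   : + a / b < (+ 1 / 3) * e

  approximate : ∀ {s} → 1ℚ ≤ s → lower X s → Approximation s
  approximate {s} 1≤s (t , (r , (_ , (e , e∈ε , refl) , r<e/3) , t≤pʳ) , s<t) =
    let a , ↥r≡a , tᵇ≤pᵃ = natural-exponent {p} {r} {t} (≤-<-trans 1≤s s<t) t≤pʳ in record
    { t = t ; s<t = s<t ; a = a ; b = ↧ₙ r ; tᵇ≤pᵃ = tᵇ≤pᵃ ; e = e ; e∈ε = e∈ε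
    ; a/b<e/3 = subst (_< (+ 1 / 3) * e) (sym (trans (cong (_/ ↧ₙ r) (sym ↥r≡a)) (↥p/↧p≡p r))) r<e/3
    }

  -- As ε ≤ 1/2, the exponents a/b < e/3 that approximate X stay below 1/6.
  below-sixth-root : ∀ {m} → 1 ℕ.≤ m → lower X (ι m) → m ℕ.^ 6 ℕ.≤ p
  below-sixth-root {m} 1≤m m∈X = ι-cancel-≤ (≤-trans (≤-reflexive (sym (ι-^ m 6)))
    (≤-trans (^-mono-≤ (0≤ι m) (<⇒≤ s<t) 6)
      (sixth-root a b (≤-trans (0≤ι m) (<⇒≤ s<t)) tᵇ≤pᵃ 6a≤b)))
    where
    open Approximation (approximate (ι-mono-≤ 1≤m) m∈X)
    instance _ = b≢0
    e<½ : e < ½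
    e<½ with _ , refl , e<½ ← ε≤½ e∈ε = e<½
    a/b≤1/6 : + a / b ≤ + 1 / 6
    a/b≤1/6 = <⇒≤ (<-trans a/b<e/3 (*-monoʳ-<-pos (+ 1 / 3) e<½))
    6a≤b : 6 ℕ.* a ℕ.≤ b
    6a≤b = subst₂ ℕ._≤_ (ℕ.*-comm a 6) (ℕ.*-identityˡ b) (/-cancel-≤ a b 1 6 a/b≤1/6)

  -- Rationals under m lie in the cut of X, hence below some t with t^b ≤ p^a and a/b < e/3 for an e
  -- in the cut of ε. Then (q/72)² ≤ p t⁶ places q/72 under p^(1/2 + 3a/b), an exponent under 1/2 +
  -- ε. The tuple gives one witness for each nested supremum.
  upper-bound : ∀ {m q} → 75 ℕ.≤ m → ι≤ X m → q ℕ.* q ℕ.≤ 5000 ℕ.* p ℕ.* m ℕ.^ 6 →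
    ⌜ ι q ⌝ ≤ʳ ι 72 ·ʳ p ^ʳ (⌜ ½ ⌝ +ʳ ε)
  upper-bound {m} {q} 75≤m ιm≤X q²≤ {s} (_ , refl , s<q) =
    ι 72 * y , (y , (w , (R , (x₁ + e′ , (x₁ , e′ , (½ , refl , x₁<½) , e′∈ε , refl) , R<x₁+e′) ,
      half-plus-triple a b (/-mono-≤ 0 1 q 72 ℕ.z≤n) 0≤t w²≤pt⁶ tᵇ≤pᵃ) , y<w) , refl) , s<72y
    where
    s₀ w : ℚ
    -- A rational strictly under m, as the open cut requires; the loss is affordable because 5000 ·
    -- 300⁶ ≤ 72² · 299⁶.
    s₀ = + (299 ℕ.* m) / 300
    w  = + q / 72

    s₀<m : s₀ < ι m
    s₀<m = ≰⇒> λ ιm≤s₀ → ℕ.<⇒≱ (ℕ.m<n+m (299 ℕ.* m) (ℕ.≤-trans (ℕ.s≤s ℕ.z≤n) 75≤m))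
      (subst₂ ℕ._≤_ (ℕ.*-comm m 300) (ℕ.*-identityʳ (299 ℕ.* m)) (/-cancel-≤ m 1 (299 ℕ.* m) 300 ιm≤s₀))
    1≤s₀ : 1ℚ ≤ s₀
    1≤s₀ = /-mono-≤ 1 1 (299 ℕ.* m) 300 (ℕ.*-monoˡ-≤ 1
      (ℕ.≤-trans (from-yes (300 ℕ.≤? 299 ℕ.* 75)) (ℕ.*-monoʳ-≤ 299 75≤m)))

    open Approximation (approximate 1≤s₀ (ιm≤X s₀<m))
    instance
      _ = b≢0
      _ = ℕ.m*n≢0 2 b

    0≤s₀ : 0ℚ ≤ s₀
    0≤s₀ = ≤-trans (0≤ι 1) 1≤s₀
    0≤t : 0ℚ ≤ t
    0≤t = ≤-trans 0≤s₀ (<⇒≤ s<t)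
    w²≤pt⁶ : w ^ 2 ≤ ι p * t ^ 6
    w²≤pt⁶ = ≤-trans
      (sixth-power-comparison {q} {m} {p} 5000 299 300 72 q²≤
        (from-yes (5000 ℕ.* 300 ℕ.^ 6 ℕ.≤? 72 ℕ.^ 2 ℕ.* 299 ℕ.^ 6)))
      (*-monoˡ-≤-nonNeg (ι p) {{nonNegative (0≤ι p)}} (^-mono-≤ 0≤s₀ (<⇒≤ s<t) 6))

    R : ℚ
    R = + (b ℕ.+ 6 ℕ.* a) / (2 ℕ.* b)
    larger = rounded ε e∈ε
    e′ = proj₁ larger
    e′∈ε = proj₂ (proj₂ larger)
    R<½+e′ : R < ½ + e′
    R<½+e′ = subst (_< ½ + e′) (sym (half-plus-triple-value a b)) (+-monoʳ-< ½
      (<-trans (subst (ι 3 * (+ a / b) <_)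
          (trans (sym (*-assoc (ι 3) (+ 1 / 3) e)) (*-identityˡ e)) (*-monoʳ-<-pos (ι 3) a/b<e/3))
        (proj₁ (proj₂ larger))))
    gap : ∃[ x₁ ] (R - e′ < x₁ × x₁ < ½)
    gap = <-dense (subst (R - e′ <_)
      (trans (+-assoc ½ e′ (- e′)) (trans (cong (λ z → ½ + z) (+-inverseʳ e′)) (+-identityʳ ½)))
      (+-monoˡ-< (- e′) R<½+e′))
    x₁ = proj₁ gap
    x₁<½ = proj₂ (proj₂ gap)
    R<x₁+e′ : R < x₁ + e′
    R<x₁+e′ = subst (_< x₁ + e′)
      (trans (+-assoc R (- e′) e′) (trans (cong (λ z → R + z) (+-inverseˡ e′)) (+-identityʳ R)))
      (+-monoˡ-< e′ (proj₁ (proj₂ gap)))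

    72w≡q : w * ι 72 ≡ ι q
    72w≡q = trans (/-* q 72 72) (≤-antisym
      (/-mono-≤ (q ℕ.* 72) 72 q 1 (ℕ.≤-reflexive (ℕ.*-identityʳ (q ℕ.* 72))))
      (/-mono-≤ q 1 (q ℕ.* 72) 72 (ℕ.≤-reflexive (sym (ℕ.*-identityʳ (q ℕ.* 72))))))
    y₀ = s * (+ 1 / 72)
    72y₀≡s : y₀ * ι 72 ≡ s
    72y₀≡s = trans (*-assoc s (+ 1 / 72) (ι 72)) (*-identityʳ s)
    y₀<w : y₀ < w
    y₀<w = ≰⇒> λ w≤y₀ → <⇒≱ s<q (subst₂ _≤_ 72w≡q 72y₀≡s (*-monoʳ-≤-nonNeg (ι 72) w≤y₀))
    between = <-dense y₀<w
    y = proj₁ between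
    y<w = proj₂ (proj₂ between)
    s<72y : s < ι 72 * y
    s<72y = subst₂ _<_ 72y₀≡s (*-comm y (ι 72)) (*-monoˡ-<-pos (ι 72) (proj₁ (proj₂ between)))

  -- The floor itself may equal X and so lie outside the open cut. Its predecessor lies inside, and
  -- the ratio of the two is at most 75/74, whose sixth power is below 2.
  floor-sixth-power : ∀ {m} → 75 ℕ.≤ m → ι≤ X m → m ℕ.^ 6 ℕ.≤ 2 ℕ.* p
  floor-sixth-power {suc m} (ℕ.s≤s 74≤m) ιm≤X = begin
    suc m ℕ.^ 6                  ≡⟨ ℕ.*-identityˡ (suc m ℕ.^ 6) ⟨
    1 ℕ.* 1 ℕ.* suc m ℕ.^ 6      ≤⟨ sixth-power-bound {suc m} {m} 74 75 2 1 1 74[m+1]≤75m (from-yes (1 ℕ.* 75 ℕ.^ 6 ℕ.≤? 74 ℕ.^ 6 ℕ.* 2)) ⟩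
    2 ℕ.* 1 ℕ.* m ℕ.^ 6          ≤⟨ ℕ.*-monoʳ-≤ 2 (below-sixth-root (ℕ.≤-trans (ℕ.s≤s ℕ.z≤n) 74≤m) (ιm≤X (ι-mono-< (ℕ.n<1+n m)))) ⟩
    2 ℕ.* p                      ∎
    where
    open ℕ.≤-Reasoning
    74[m+1]≤75m : 74 ℕ.* suc m ℕ.≤ 75 ℕ.* m
    74[m+1]≤75m = subst (ℕ._≤ 75 ℕ.* m) (sym (ℕ.*-suc 74 m)) (ℕ.+-monoˡ-≤ (74 ℕ.* m) 74≤m)

  Good : ℕ → Set
  Good q = Prime q × X <ʳ ⌜ ι q ⌝ × ⌜ ι q ⌝ ≤ʳ ι 72 ·ʳ p ^ʳ (⌜ ½ ⌝ +ʳ ε) × CubicResidue p q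

  -- A rational outside the cut of the upper limit bounds every good q; below that bound excluded
  -- middle decides `Good`.
  good-cardinality : ∃[ qs ] (HasCardinality Good (length qs) × (∀ {q} → Good q → q ∈ qs))
  good-cardinality = qs
    , (qs , Unique.filter⁺ good? (Unique.upTo⁺ N)
         , (λ q → mk⇔ (λ q∈ → proj₂ (∈-filter⁻ good? {xs = upTo N} q∈)) member) , refl)
    , member
    where
    good? : ∀ q → Dec (Good q)
    good? q = em
    Y = ι 72 ·ʳ p ^ʳ (⌜ ½ ⌝ +ʳ ε)
    bound : ∃[ N ] (∀ {q} → Good q → q ℕ.< N)
    bound = let u , u∉Y = proper Y ; N , u<N = above u in
      N , λ {q} (_ , _ , q≤Y , _) → ℕ.≰⇒> λ N≤q → u∉Y (q≤Y (ι q , refl , <-≤-trans u<N (ι-mono-≤ N≤q)))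
    N = proj₁ bound
    qs = filter good? (upTo N)
    member : ∀ {q} → Good q → q ∈ qs
    member good = ∈-filter⁺ good? (∈-upTo⁺ (proj₂ bound good)) good

  -- X may exceed its floor m, but it does not exceed m + 1; this is why the counts are carried out
  -- against `suc m`.
  fifteenth : ∀ {m n} → ¬ ι≤ X (suc m) → suc m ℕ.≤ n ℕ.* 15 → (+ 1 / 15) ·ʳ X ≤ʳ ⌜ ι n ⌝
  fifteenth {m} {n} ι[m+1]≰X m+1≤15n (_ , (x , x∈X , refl) , s<x/15) =
    let s , s<m+1 , s∉X = Classical.not-below em X {suc m} ι[m+1]≰X in
    ι n , refl , <-trans s<x/15 (subst ((+ 1 / 15) * x <_) n-fifteenth
      (*-monoʳ-<-pos (+ 1 / 15) (<-≤-trans (<-trans (lower<upper X x∈X s∉X) s<m+1) (ι-mono-≤ {suc m} {n ℕ.* 15} m+1≤15n))))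
    where
    n-fifteenth : (+ 1 / 15) * ι (n ℕ.* 15) ≡ ι n
    n-fifteenth = trans (cong ((+ 1 / 15) *_) (sym (ι-* n 15))) (trans (*-comm (+ 1 / 15) (ι n * ι 15))
      (trans (*-assoc (ι n) (ι 15) (+ 1 / 15)) (*-identityʳ (ι n))))

  module _ {m : ℕ} (p-prime : Prime p) (75≤m : 75 ℕ.≤ m) (ιm≤X : ι≤ X m) (ι[m+1]≰X : ¬ ι≤ X (suc m)) where

    residue⇒good : ∀ {q} → Prime q × m ℕ.< q × q ℕ.* q ℕ.≤ 5000 ℕ.* p ℕ.* m ℕ.^ 6 × IsResidue p q → Good q
    residue⇒good {q} (q-prime , m<q , q²≤ , residue) =
      q-prime , X<q , upper-bound {m} {q} 75≤m ιm≤X q²≤ , residue⇒CubicResidue p-prime q-prime residue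
      where
      X<q : X <ʳ ⌜ ι q ⌝
      X<q = let s , s<m+1 , s∉X = Classical.not-below em X {suc m} ι[m+1]≰X in
        s , (_ , refl , <-≤-trans s<m+1 (ι-mono-≤ {suc m} {q} m<q)) , s∉X

    good-count : ∀ {qs} → (∀ {q} → Good q → q ∈ qs) → Found p m → suc m ℕ.≤ length qs ℕ.* 15
    good-count {qs} member (ks , unique , residues , m+1≤15k) = ℕ.≤-trans m+1≤15k (ℕ.≤-trans
      (ℕ.*-monoʳ-≤ 15 (unique-⊆⇒length≤ unique (λ q∈ → member (residue⇒good (All.lookup residues q∈)))))
      (ℕ.≤-reflexive (ℕ.*-comm 15 (length qs))))

theorem2 : ExcludedMiddle 0ℓ →
    (ε : ℝ) → ⌜ 0ℚ ⌝ <ʳ ε → ε ≤ʳ ⌜ ½ ⌝ →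
    (p : ℕ) .{{_ : ℕ.NonZero p}} → Prime p →
    ⌜ ι 75 ⌝ ≤ʳ p ^ʳ ((+ 1 / 3) ·ʳ ε) →
    exp 100 ≤ʳ ⌜ ι p ⌝ →
    ∃[ n ] (HasCardinality
    (λ q → Prime q
    × p ^ʳ ((+ 1 / 3) ·ʳ ε) <ʳ ⌜ ι q ⌝
    × ⌜ ι q ⌝ ≤ʳ ι 72 ·ʳ p ^ʳ (⌜ ½ ⌝ +ʳ ε)
    × CubicResidue p q)
    n
    × (+ 1 / 15) ·ʳ p ^ʳ ((+ 1 / 3) ·ʳ ε) ≤ʳ ⌜ ι n ⌝)
theorem2 em ε _ ε≤½ p p-prime 75≤X exp≤p =
  let m , 75≤m , ιm≤X , ι[m+1]≰X = Classical.integer-part em (p ^ʳ ((+ 1 / 3) ·ʳ ε)) {75}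
        (λ s<75 → 75≤X (ι 75 , refl , s<75))
      qs , cardinality , member = good-cardinality em ε ε≤½ p
      found = many-cubic-residues p-prime (exp100-bound {p} exp≤p) 75≤m (floor-sixth-power em ε ε≤½ p 75≤m ιm≤X)
  in length qs , cardinality , fifteenth em ε ε≤½ p {m} {length qs} ι[m+1]≰X
       (good-count em ε ε≤½ p p-prime 75≤m ιm≤X ι[m+1]≰X member found)
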